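{- Let $k\ge 1$ and let $T$ be one of the four standard Young tableaux of size $3$. Then \[ s_{\mathsf{shape}(T)}[s_k]=\sum_{\substack{S\in\mathsf{SSYT}_{(k,k,k)}\\ \mathsf{type}(S)=T}} s_{\mathsf{shape}(S)}. \]
   Context: $s_\lambda$ is the Schur function, $s_k=s_{(k)}$, and $f[g]$ denotes plethysm of symmetric functions. Tableaux: rows are numbered $1,2,3,\dots$ with row 1 the longest; entries weakly increase along rows and strictly increase along columns (from row 1 to row 2 to row 3). The four standard tableaux of size 3 are: $T_a$, the single row $1,2,3$ (shape $(3)$); $T_b$, row 1 $=1,2$ and row 2 $=3$ (shape $(2,1)$); $T_c$, row 1 $=1,3$ and row 2 $=2$ (shape $(2,1)$); $T_d$, the single column with row $i$ containing $i$ (shape $(1,1,1)$). The transpose $T^t$ of a standard tableau is obtained by reflecting in the main diagonal: $T_a^t=T_d$, $T_d^t=T_a$, $T_b^t=T_c$, $T_c^t=T_b$. $\mathsf{SSYT}_{(k,k,k)}$ is the set of semistandard Young tableaux containing exactly $k$ entries $1$, $k$ entries $2$ and $k$ entries $3$; $\mathsf{shape}(S)$ is the shape of $S$. For such $S$ let $N_r$ be the number of cells with entry $r$ in row 2 of $S$. The type of $S\in\mathsf{SSYT}_{(k,k,k)}$ is defined recursively: (1) if $k=1$ and $S$ is standard, $\mathsf{type}(S)=S$; (2) otherwise, if $S$ has one or two rows: $\mathsf{type}(S)=T_a$ if $N_2$ is even, $N_3\ge 2N_2$ and $N_3\ne 2N_2+1$; $\mathsf{type}(S)=T_d$ if $N_2$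 is odd, $N_3\ge 2N_2$ and $N_3\ne 2N_2+1$; $\mathsf{type}(S)=T_b$ if $N_2$ is even and ($N_3<2N_2$ or $N_3=2N_2+1$); $\mathsf{type}(S)=T_c$ if $N_2$ is odd and ($N_3<2N_2$ or $N_3=2N_2+1$); (3) if $S$ has three rows, let $\overline S$ be $S$ with its first column removed (an element of $\mathsf{SSYT}_{(k-1,k-1,k-1)}$) and set $\mathsf{type}(S)=\mathsf{type}(\overline S)^t$. -}

module Defs where

open import Data.Bool using (Bool; true; false; _∧_; _∨_; not; if_then_else_)
open import Data.Nat using (ℕ; zero; suc; _+_; _*_; _∸_; _≤ᵇ_; _<ᵇ_; _≡ᵇ_; _%_)
open import Data.Fin using (Fin; toℕ)
open import Data.List using (List; []; _∷_; map; concatMap; length; allFin; upTo; lookup; filterᵇ; foldr; sum)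
open import Data.Vec using (Vec; []; _∷_; tabulate; replicate; zipWith)

-- Tableaux: a filling is a list of rows (row 1 first), entries in Fin N
-- (Fin N with its natural order stands for the alphabet 1 < 2 < ... < N).

Tableau : ℕ → Set
Tableau N = List (List (Fin N))

shapeOf : ∀ {N} → Tableau N → List ℕ
shapeOf = map length

words : (N m : ℕ) → List (List (Fin N))
words N zero    = [] ∷ []
words N (suc m) = concatMap (λ i → map (i ∷_) (words N m)) (allFin N)

fillings : (N : ℕ) → List ℕ → List (Tableau N)
fillings N []      = [] ∷ []
fillings N (r ∷ sh) = concatMap (λ w → map (w ∷_) (fillings N sh)) (words N r)

rowWeak : ∀ {N} → List (Fin N) → Bool
rowWeak []           = true
rowWeak (x ∷ [])     = true
rowWeak (x ∷ y ∷ xs) = (toℕ x ≤ᵇ toℕ y) ∧ rowWeak (y ∷ xs)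

colStrict : ∀ {N} → List (Fin N) → List (Fin N) → Bool
colStrict _        []       = true
colStrict []       (_ ∷ _)  = false
colStrict (x ∷ xs) (y ∷ ys) = (toℕ x <ᵇ toℕ y) ∧ colStrict xs ys

isSSYT : ∀ {N} → Tableau N → Bool
isSSYT []               = true
isSSYT (r ∷ [])         = rowWeak r
isSSYT (r ∷ r' ∷ rs)    = rowWeak r ∧ colStrict r r' ∧ isSSYT (r' ∷ rs)

vecEqᵇ : ∀ {n} → Vec ℕ n → Vec ℕ n → Bool
vecEqᵇ []       []       = true
vecEqᵇ (a ∷ as) (b ∷ bs) = (a ≡ᵇ b) ∧ vecEqᵇ as bs

-- total weight x^T of a tableau when letter i is given monomial x^(w i)
weight : ∀ {N n} → (Fin N → Vec ℕ n) → Tableau N → Vec ℕ n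
weight {n = n} w t =
  foldr (λ row acc → foldr (λ i a → zipWith _+_ (w i) a) acc row) (replicate n 0) t

-- Coefficient of x^α in s_λ(y_1,…,y_N) where y_i = x^(w i):
-- number of SSYT of shape λ with entries in {1..N} and total weight α.
schurSubstCoeff : (N : ℕ) → ∀ {n} → (Fin N → Vec ℕ n) → List ℕ → Vec ℕ n → ℕ
schurSubstCoeff N w sh α =
  length (filterᵇ (λ t → isSSYT t ∧ vecEqᵇ (weight w t) α) (fillings N sh))

unitVec : ∀ {n} → Fin n → Vec ℕ n
unitVec i = tabulate (λ j → if toℕ i ≡ᵇ toℕ j then 1 else 0)

schurCoeff : List ℕ → (n : ℕ) → Vec ℕ n → ℕ
schurCoeff sh n α = schurSubstCoeff n unitVec sh α

-- all exponent vectors of monomials of degree k in n variables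
-- (the monomials of s_k = h_k, each with coefficient 1)
monomials : (n k : ℕ) → List (Vec ℕ n)
monomials zero    zero    = [] ∷ []
monomials zero    (suc _) = []
monomials (suc n) k = concatMap (λ i → map (i ∷_) (monomials n (k ∸ i))) (upTo (suc k))

-- coefficient of x^α in the plethysm s_λ[s_k](x_1,…,x_n),
-- i.e. s_λ evaluated at the monomials of s_k(x_1,…,x_n)
plethCoeff : List ℕ → (k n : ℕ) → Vec ℕ n → ℕ
plethCoeff sh k n α = schurSubstCoeff (length ms) (lookup ms) sh α
  where ms = monomials n k

dropEmpty : ∀ {A : Set} → List (List A) → List (List A)
dropEmpty []            = []
dropEmpty ([] ∷ rs)     = dropEmpty rs
dropEmpty ((x ∷ r) ∷ rs) = (x ∷ r) ∷ dropEmpty rs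

dropZeros : List ℕ → List ℕ
dropZeros []          = []
dropZeros (zero ∷ l)  = dropZeros l
dropZeros (suc m ∷ l) = suc m ∷ dropZeros l

partitions3 : ℕ → List (List ℕ)
partitions3 m =
  concatMap (λ a → concatMap (λ b → concatMap (λ c →
     if (b ≤ᵇ a) ∧ (c ≤ᵇ b) ∧ (a + b + c ≡ᵇ m)
       then dropZeros (a ∷ b ∷ c ∷ []) ∷ [] else [])
     (upTo (suc m))) (upTo (suc m))) (upTo (suc m))

SSYTkkk : ℕ → List (Tableau 3)
SSYTkkk k = concatMap
  (λ sh′ → filterᵇ (λ t → isSSYT t ∧ vecEqᵇ (weight unitVec t) (k ∷ k ∷ k ∷ []))
                  (fillings 3 sh′))
  (partitions3 (3 * k))

data Std3 : Set where
  Ta Tb Tc Td : Std3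

std3Shape : Std3 → List ℕ
std3Shape Ta = 3 ∷ []
std3Shape Tb = 2 ∷ 1 ∷ []
std3Shape Tc = 2 ∷ 1 ∷ []
std3Shape Td = 1 ∷ 1 ∷ 1 ∷ []

transpose3 : Std3 → Std3
transpose3 Ta = Td
transpose3 Td = Ta
transpose3 Tb = Tc
transpose3 Tc = Tb

std3Eqᵇ : Std3 → Std3 → Bool
std3Eqᵇ Ta Ta = true
std3Eqᵇ Tb Tb = true
std3Eqᵇ Tc Tc = true
std3Eqᵇ Td Td = true
std3Eqᵇ _  _  = false

-- a standard filling of size 3 (entries 0,1,2 of Fin 3 stand for 1,2,3)
asStd : Tableau 3 → Std3
asStd (row1 ∷ [])                       = Ta
asStd (row1 ∷ (c ∷ []) ∷ [])            = if toℕ c ≡ᵇ 2 then Tb else Tc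
asStd _                                 = Td

-- number of cells with entry r (r = 1,2,3 encoded as 0,1,2) in row 2
countIn : ℕ → List (Fin 3) → ℕ
countIn r []       = 0
countIn r (x ∷ xs) = (if toℕ x ≡ᵇ r then 1 else 0) + countIn r xs

row2 : Tableau 3 → List (Fin 3)
row2 (_ ∷ r ∷ _) = r
row2 _           = []

N₂ N₃ : Tableau 3 → ℕ
N₂ S = countIn 1 (row2 S)
N₃ S = countIn 2 (row2 S)

typeFewRows : Tableau 3 → Std3
typeFewRows S =
  let n2 = N₂ S ; n3 = N₃ S
      big = (2 * n2 ≤ᵇ n3) ∧ not (n3 ≡ᵇ 2 * n2 + 1)
      ev  = n2 % 2 ≡ᵇ 0
  in if big then (if ev then Ta else Td) else (if ev then Tb else Tc)

removeFirstCol : ∀ {A : Set} → List (List A) → List (List A)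
removeFirstCol rs = dropEmpty (map tl rs)
  where tl : ∀ {A : Set} → List A → List A
        tl []       = []
        tl (_ ∷ xs) = xs

-- type k S for S ∈ SSYT_(k,k,k); the k = 0 clause is never used for k ≥ 1
typeOf : ℕ → Tableau 3 → Std3
typeOf zero          S = Ta
typeOf (suc zero)    S = asStd S
typeOf (suc (suc k)) S =
  if 3 ≤ᵇ length S then transpose3 (typeOf (suc k) (removeFirstCol S))
                    else typeFewRows S

{-# OPTIONS --safe #-}
module Submission where

-- Write A, B, C for s_(3), s_(2,1), s_(1,1,1) of h_k = s_k. Then A + 2B + C = h_k³,
-- A − C = p₂[h_k] h_k and A − B + C = p₃[h_k], which determines A, B and C. Each right side
-- is expanded in Schur functions by induction on the number of variables, splitting off the
-- last one. For p_d[h_k] it suffices that the claimed coefficients are compatible with the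
-- branching rule s_λ(x₁,…,x_{n+1}) = ∑ s_μ(x₁,…,x_n) x_{n+1}^{|λ/μ|}, over horizontal strips λ/μ;
-- products with h_k are given by the Pieri rule, which is proved the same way with Fomin's local rule.
-- The coefficients of s_λ are ∑_S 1, ∑_S (−1)^{x(S)} and ψ(λ₂ − λ₃), where S runs over SSYT_(k,k,k)
-- of shape λ, x(S) is the number of 2's in row 2 and ψ is 3-periodic with values 1, −1, 0.
-- Counting types over the interval of possible x gives the same three linear relations between
-- the sums over the S of each type.

open import Defs
open import Data.Nat using (ℕ; zero; suc; _+_; _*_; _∸_; _≤_; _<_; z≤n; s≤s; _≤ᵇ_; _<ᵇ_; _≡ᵇ_; _%_; _⊓_; _⊔_)
open import Data.Vec as Vec using (Vec; []; _∷_; _∷ʳ_; zipWith; tabulate)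
open import Data.List as List using (List; []; _∷_; _++_; map; concatMap; foldr; upTo; applyUpTo; filterᵇ; length; allFin; replicate)
open import Data.Nat.ListAction using (sum)
open import Relation.Binary.PropositionalEquality
open import Data.Bool using (Bool; true; false; not; _∧_; if_then_else_; T)
import Data.Bool.Properties as Bool
open import Data.Empty using (⊥; ⊥-elim)
open import Data.Fin as Fin using (Fin; toℕ; inject₁; fromℕ) renaming (zero to fzero; suc to fsuc)
import Data.Fin.Properties as Fin
open import Data.Integer using (ℤ; 0ℤ; 1ℤ; -1ℤ; +_) renaming (_+_ to _+ℤ_; _*_ to _·_; -_ to -ℤ_; _-_ to _-ℤ_)
import Data.Integer.Properties as ℤ
open import Algebra.Properties.AbelianGroup ℤ.+-0-abelianGroup using (∙-cancelˡ; ∙-cancelʳ)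
import Data.Integer.Tactic.RingSolver as ℤSolver
import Data.List.Properties as List
open import Data.List.Membership.Propositional using (_∈_)
open import Data.List.Membership.Propositional.Properties using (∈-upTo⁻)
open import Data.List.Relation.Unary.Any using (here; there)
open import Data.Nat.Divisibility using (_∣_; _∣?_; divides; ∣m+n∣m⇒∣n; ∣m∣n⇒∣m+n; m∣m*n; ∣-refl)
open import Data.Nat.DivMod using (_/_; m/n*n≡m; m*n/n≡m)
open import Data.Nat.Properties using (_≤?_; _≟_)
import Data.Nat.Properties as ℕ
import Data.Nat.Tactic.RingSolver as ℕSolver
open import Data.Product using (_×_; _,_; proj₁; proj₂)
open import Data.Sum using (_⊎_; inj₁; inj₂)
import Data.Vec.Properties as Vec
open import Function using (_∘_; id)
open import Relation.Nullary using (Dec; does; yes; no; ¬_; contradiction; _×-dec_; T?)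
open ≡-Reasoning

-- There are four type sums but only three plethysms: `Tb` and `Tc` have the same shape, so their
-- sums must be shown equal separately. This is the vanishing of the sum of `bc` over the admissible
-- x, and it would already fail for an interval of two values without the exceptional case N₃ = 2 N₂
-- + 1 of the definition.
--
-- The counting rests on one symmetry. The rule for at most two rows is transposed by (N₂ , N₃) ↦
-- (N₂ + 1 , N₃ + 2), exactly as it is by one further column of length 3. On the diagonal N₂ + N₃ =
-- f + 3 this leaves the transposed types of the diagonal f together with one type each of `Ta`,
-- `Tb` and `Tc`; hence the period 3.
--
-- All Schur expansions involved have at most three rows, so triples suffice as shapes; triples that
-- are not weakly decreasing carry zero. Since s_(3), s_(2,1) and s_(1,1,1) have denominators in
-- terms of power sums, the relations are kept over ℤ and the factors 2 and 3 are cancelled only at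
-- the end.

private variable
  A A′ : Set
  P Q R : Set

-- Finite sums and Iverson brackets

opaque
  ∑ : List A → (A → ℤ) → ℤ
  ∑ xs f = foldr (λ x s → f x +ℤ s) 0ℤ xs

  ∑-[] : ∀ (f : A → ℤ) → ∑ [] f ≡ 0ℤ
  ∑-[] f = refl

  ∑-∷ : ∀ x (xs : List A) (f : A → ℤ) → ∑ (x ∷ xs) f ≡ f x +ℤ ∑ xs f
  ∑-∷ x xs f = refl

∑-singleton : ∀ x (f : A → ℤ) → ∑ (x ∷ []) f ≡ f x
∑-singleton x f = trans (∑-∷ x [] f) (trans (cong (f x +ℤ_) (∑-[] f)) (ℤ.+-identityʳ (f x)))

opaque
  unfolding ∑

  ∑-cong-∈ : ∀ (xs : List A) {f g : A → ℤ} → (∀ {x} → x ∈ xs → f x ≡ g x) → ∑ xs f ≡ ∑ xs g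
  ∑-cong-∈ []       h = refl
  ∑-cong-∈ (x ∷ xs) h = cong₂ _+ℤ_ (h (here refl)) (∑-cong-∈ xs (h ∘ there))

  ∑-cong : ∀ (xs : List A) {f g : A → ℤ} → (∀ x → f x ≡ g x) → ∑ xs f ≡ ∑ xs g
  ∑-cong xs h = ∑-cong-∈ xs (λ {x} _ → h x)

  ∑-zero : ∀ (xs : List A) → ∑ xs (λ _ → 0ℤ) ≡ 0ℤ
  ∑-zero []       = refl
  ∑-zero (x ∷ xs) = trans (ℤ.+-identityˡ _) (∑-zero xs)

  ∑-0 : ∀ (xs : List A) {f : A → ℤ} → (∀ x → f x ≡ 0ℤ) → ∑ xs f ≡ 0ℤ
  ∑-0 xs h = trans (∑-cong xs h) (∑-zero xs)

  ∑-+ : ∀ (xs : List A) (f g : A → ℤ) → ∑ xs (λ x → f x +ℤ g x) ≡ ∑ xs f +ℤ ∑ xs g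
  ∑-+ []       f g = refl
  ∑-+ (x ∷ xs) f g = trans (cong (f x +ℤ g x +ℤ_) (∑-+ xs f g)) (shuffle (f x) (g x) (∑ xs f) (∑ xs g))
    where
    shuffle : ∀ a b c d → (a +ℤ b) +ℤ (c +ℤ d) ≡ (a +ℤ c) +ℤ (b +ℤ d)
    shuffle = ℤSolver.solve-∀

  ∑-*ˡ : ∀ (xs : List A) a (f : A → ℤ) → a · ∑ xs f ≡ ∑ xs (λ x → a · f x)
  ∑-*ˡ []       a f = ℤ.*-zeroʳ a
  ∑-*ˡ (x ∷ xs) a f = trans (ℤ.*-distribˡ-+ a (f x) _) (cong (a · f x +ℤ_) (∑-*ˡ xs a f))

  ∑-*ʳ : ∀ (xs : List A) (f : A → ℤ) a → ∑ xs f · a ≡ ∑ xs (λ x → f x · a)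
  ∑-*ʳ xs f a = trans (ℤ.*-comm _ a) (trans (∑-*ˡ xs a f) (∑-cong xs (λ x → ℤ.*-comm a (f x))))

  ∑-swap : ∀ (xs : List A) (ys : List A′) (f : A → A′ → ℤ) → ∑ xs (λ x → ∑ ys (f x)) ≡ ∑ ys (λ y → ∑ xs (λ x → f x y))
  ∑-swap []       ys f = sym (∑-zero ys)
  ∑-swap (x ∷ xs) ys f = trans (cong (∑ ys (f x) +ℤ_) (∑-swap xs ys f)) (sym (∑-+ ys (f x) _))

  ∑-++ : ∀ (xs ys : List A) (f : A → ℤ) → ∑ (xs ++ ys) f ≡ ∑ xs f +ℤ ∑ ys f
  ∑-++ []       ys f = sym (ℤ.+-identityˡ _)
  ∑-++ (x ∷ xs) ys f = trans (cong (f x +ℤ_) (∑-++ xs ys f)) (sym (ℤ.+-assoc (f x) _ _))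

  ∑-map : ∀ (g : A → A′) xs (f : A′ → ℤ) → ∑ (map g xs) f ≡ ∑ xs (f ∘ g)
  ∑-map g []       f = refl
  ∑-map g (x ∷ xs) f = cong (f (g x) +ℤ_) (∑-map g xs f)

  ∑-concatMap : ∀ (g : A → List A′) xs (f : A′ → ℤ) → ∑ (concatMap g xs) f ≡ ∑ xs (λ x → ∑ (g x) f)
  ∑-concatMap g []       f = refl
  ∑-concatMap g (x ∷ xs) f = trans (∑-++ (g x) _ f) (cong (∑ (g x) f +ℤ_) (∑-concatMap g xs f))

[_]ᵇ : Bool → ℤ
[ true  ]ᵇ = 1ℤ
[ false ]ᵇ = 0ℤ

[]ᵇ-∧ : ∀ a b → [ a ∧ b ]ᵇ ≡ [ a ]ᵇ · [ b ]ᵇ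
[]ᵇ-∧ true  b = sym (ℤ.*-identityˡ _)
[]ᵇ-∧ false b = refl

opaque
  unfolding ∑

  ∑-filterᵇ : ∀ p (xs : List A) (f : A → ℤ) → ∑ (filterᵇ p xs) f ≡ ∑ xs (λ x → [ p x ]ᵇ · f x)
  ∑-filterᵇ p []       f = refl
  ∑-filterᵇ p (x ∷ xs) f with p x
  ... | true  = cong₂ _+ℤ_ (sym (ℤ.*-identityˡ (f x))) (∑-filterᵇ p xs f)
  ... | false = trans (∑-filterᵇ p xs f) (sym (ℤ.+-identityˡ _))

  length-filterᵇ-∑ : ∀ p (xs : List A) → + length (filterᵇ p xs) ≡ ∑ xs (λ x → [ p x ]ᵇ)
  length-filterᵇ-∑ p []       = refl
  length-filterᵇ-∑ p (x ∷ xs) with p x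
  ... | true  = cong (1ℤ +ℤ_) (length-filterᵇ-∑ p xs)
  ... | false = trans (length-filterᵇ-∑ p xs) (sym (ℤ.+-identityˡ _))

⟦_⟧ : Dec P → ℤ
⟦ p? ⟧ = [ does p? ]ᵇ

⟦⟧-yes : (p? : Dec P) → P → ⟦ p? ⟧ ≡ 1ℤ
⟦⟧-yes (yes _) p = refl
⟦⟧-yes (no ¬p) p = contradiction p ¬p

⟦⟧-no : (p? : Dec P) → ¬ P → ⟦ p? ⟧ ≡ 0ℤ
⟦⟧-no (yes p) ¬p = contradiction p ¬p
⟦⟧-no (no _)  ¬p = refl

⟦⟧-yes-* : (p? : Dec P) → P → ∀ x → ⟦ p? ⟧ · x ≡ x
⟦⟧-yes-* p? p x = trans (cong (_· x) (⟦⟧-yes p? p)) (ℤ.*-identityˡ x)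

⟦⟧-no-* : (p? : Dec P) → ¬ P → ∀ x → ⟦ p? ⟧ · x ≡ 0ℤ
⟦⟧-no-* p? ¬p x = cong (_· x) (⟦⟧-no p? ¬p)

⟦⟧-⇔ : (p? : Dec P) (q? : Dec Q) → (P → Q) → (Q → P) → ⟦ p? ⟧ ≡ ⟦ q? ⟧
⟦⟧-⇔ (yes p) q? f g = sym (⟦⟧-yes q? (f p))
⟦⟧-⇔ (no ¬p) q? f g = sym (⟦⟧-no q? (¬p ∘ g))

⟦⟧-*-cong : (p? : Dec P) (q? : Dec Q) {x y : ℤ} → (P → Q) → (Q → P) → (P → x ≡ y) →
            ⟦ p? ⟧ · x ≡ ⟦ q? ⟧ · y
⟦⟧-*-cong (yes p) q? {y = y} f g h = trans (trans (ℤ.*-identityˡ _) (h p)) (sym (⟦⟧-yes-* q? (f p) y))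
⟦⟧-*-cong (no ¬p) q? {y = y} f g h = sym (⟦⟧-no-* q? (¬p ∘ g) y)

⟦⟧-*-congʳ : (p? : Dec P) {x y : ℤ} → (P → x ≡ y) → ⟦ p? ⟧ · x ≡ ⟦ p? ⟧ · y
⟦⟧-*-congʳ p? = ⟦⟧-*-cong p? p? id id

⟦⟧-× : (p? : Dec P) (q? : Dec Q) → ⟦ p? ×-dec q? ⟧ ≡ ⟦ p? ⟧ · ⟦ q? ⟧
⟦⟧-× p? q? = []ᵇ-∧ (does p?) (does q?)

⟦⟧-merge : (p? : Dec P) (q? : Dec Q) (r? : Dec R) → (P → Q → R) → (R → P × Q) →
           ∀ x → ⟦ p? ⟧ · (⟦ q? ⟧ · x) ≡ ⟦ r? ⟧ · x
⟦⟧-merge (yes p) q? r? f g x =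
  trans (ℤ.*-identityˡ _) (cong (_· x) (⟦⟧-⇔ q? r? (f p) (proj₂ ∘ g)))
⟦⟧-merge (no ¬p) q? r? f g x = sym (⟦⟧-no-* r? (¬p ∘ proj₁ ∘ g) x)

⟦⟧-nest : (p? : Dec P) (q? : Dec Q) → ∀ x → ⟦ p? ⟧ · (⟦ q? ⟧ · x) ≡ ⟦ p? ×-dec q? ⟧ · x
⟦⟧-nest p? q? = ⟦⟧-merge p? q? (p? ×-dec q?) _,_ id

⟦⟧-merge₂ : (p? : Dec P) (q? : Dec Q) (r? : Dec R) → (P → Q → R) → (R → P × Q) →
            ⟦ p? ⟧ · ⟦ q? ⟧ ≡ ⟦ r? ⟧
⟦⟧-merge₂ p? q? r? f g =
  trans (sym (⟦⟧-× p? q?)) (⟦⟧-⇔ (p? ×-dec q?) r? (λ (p , q) → f p q) g)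

∑< : ℕ → (ℕ → ℤ) → ℤ
∑< n = ∑ (upTo n)

∑-applyUpTo : ∀ (g : ℕ → A) n (f : A → ℤ) → ∑ (applyUpTo g n) f ≡ ∑< n (f ∘ g)
∑-applyUpTo g zero    f = trans (∑-[] f) (sym (∑-[] (f ∘ g)))
∑-applyUpTo g (suc n) f = begin
  ∑ (applyUpTo g (suc n)) f ≡⟨ ∑-∷ (g 0) _ f ⟩
  f (g 0) +ℤ ∑ (applyUpTo (g ∘ suc) n) f
    ≡⟨ cong (f (g 0) +ℤ_) (trans (∑-applyUpTo (g ∘ suc) n f) (sym (∑-applyUpTo suc n (f ∘ g)))) ⟩
  f (g 0) +ℤ ∑ (applyUpTo suc n) (f ∘ g) ≡⟨ ∑-∷ 0 _ (f ∘ g) ⟨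
  ∑< (suc n) (f ∘ g) ∎

∑<-suc : ∀ n (f : ℕ → ℤ) → ∑< (suc n) f ≡ f 0 +ℤ ∑< n (f ∘ suc)
∑<-suc n f = trans (∑-∷ 0 _ f) (cong (f 0 +ℤ_) (∑-applyUpTo suc n f))

∑<-zero : ∀ (f : ℕ → ℤ) → ∑< 0 f ≡ 0ℤ
∑<-zero = ∑-[]

∑<-one : ∀ (f : ℕ → ℤ) → ∑< 1 f ≡ f 0
∑<-one f = trans (∑<-suc 0 f) (trans (cong (f 0 +ℤ_) (∑<-zero (f ∘ suc))) (ℤ.+-identityʳ (f 0)))

∑<-snoc : ∀ n (f : ℕ → ℤ) → ∑< (suc n) f ≡ ∑< n f +ℤ f n
∑<-snoc zero    f = trans (∑<-one f) (sym (trans (cong (_+ℤ f 0) (∑<-zero f)) (ℤ.+-identityˡ (f 0))))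
∑<-snoc (suc n) f = begin
  ∑< (suc (suc n)) f ≡⟨ ∑<-suc (suc n) f ⟩
  f 0 +ℤ ∑< (suc n) (f ∘ suc) ≡⟨ cong (f 0 +ℤ_) (∑<-snoc n (f ∘ suc)) ⟩
  f 0 +ℤ (∑< n (f ∘ suc) +ℤ f (suc n)) ≡⟨ ℤ.+-assoc (f 0) _ _ ⟨
  f 0 +ℤ ∑< n (f ∘ suc) +ℤ f (suc n) ≡⟨ cong (_+ℤ f (suc n)) (∑<-suc n f) ⟨
  ∑< (suc n) f +ℤ f (suc n) ∎

∑<-cong : ∀ n {f g : ℕ → ℤ} → (∀ i → i < n → f i ≡ g i) → ∑< n f ≡ ∑< n g
∑<-cong n h = ∑-cong-∈ (upTo n) (λ {i} i∈ → h i (∈-upTo⁻ i∈))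

∑<-0 : ∀ n {f : ℕ → ℤ} → (∀ i → i < n → f i ≡ 0ℤ) → ∑< n f ≡ 0ℤ
∑<-0 n h = trans (∑<-cong n h) (∑-zero (upTo n))

∑<-interval : ∀ N lo t (f : ℕ → ℤ) → lo + t < N →
  ∑< N (λ i → ⟦ (lo ≤? i) ×-dec (i ≤? lo + t) ⟧ · f i) ≡ ∑< (suc t) (λ j → f (lo + j))
∑<-interval (suc N) zero zero f _ = begin
  _ ≡⟨ ∑<-suc N _ ⟩
  1ℤ · f 0 +ℤ ∑< N (λ i → 0ℤ · f (suc i)) ≡⟨ cong₂ _+ℤ_ (ℤ.*-identityˡ (f 0)) (∑-0 (upTo N) (λ _ → refl)) ⟩
  f 0 +ℤ 0ℤ ≡⟨ ℤ.+-identityʳ (f 0) ⟩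
  f 0 ≡⟨ ∑<-one f ⟨
  ∑< 1 f ∎
∑<-interval (suc N) zero (suc t) f (s≤s t<N) = begin
  _ ≡⟨ ∑<-suc N _ ⟩
  1ℤ · f 0 +ℤ ∑< N (λ i → ⟦ (0 ≤? suc i) ×-dec (suc i ≤? suc t) ⟧ · f (suc i))
    ≡⟨ cong₂ _+ℤ_ (ℤ.*-identityˡ (f 0)) (∑-cong (upTo N) (λ i →
         cong (_· f (suc i)) (⟦⟧-⇔ ((0 ≤? suc i) ×-dec (suc i ≤? suc t)) ((0 ≤? i) ×-dec (i ≤? t))
           (λ { (_ , s≤s q) → z≤n , q }) (λ (_ , q) → z≤n , s≤s q)))) ⟩
  f 0 +ℤ ∑< N (λ i → ⟦ (0 ≤? i) ×-dec (i ≤? t) ⟧ · f (suc i))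
    ≡⟨ cong (f 0 +ℤ_) (∑<-interval N zero t (f ∘ suc) t<N) ⟩
  f 0 +ℤ ∑< (suc t) (f ∘ suc) ≡⟨ ∑<-suc (suc t) f ⟨
  ∑< (suc (suc t)) f ∎
∑<-interval (suc N) (suc lo) t f (s≤s lt) = begin
  _ ≡⟨ ∑<-suc N _ ⟩
  0ℤ · f 0 +ℤ ∑< N (λ i → ⟦ (suc lo ≤? suc i) ×-dec (suc i ≤? suc lo + t) ⟧ · f (suc i))
    ≡⟨ ℤ.+-identityˡ _ ⟩
  ∑< N (λ i → ⟦ (suc lo ≤? suc i) ×-dec (suc i ≤? suc lo + t) ⟧ · f (suc i))
    ≡⟨ ∑-cong (upTo N) (λ i →
         cong (_· f (suc i)) (⟦⟧-⇔ ((suc lo ≤? suc i) ×-dec (suc i ≤? suc lo + t)) ((lo ≤? i) ×-dec (i ≤? lo + t))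
           (λ { (s≤s p , s≤s q) → p , q }) (λ (p , q) → s≤s p , s≤s q))) ⟩
  ∑< N (λ i → ⟦ (lo ≤? i) ×-dec (i ≤? lo + t) ⟧ · f (suc i))
    ≡⟨ ∑<-interval N lo t (f ∘ suc) lt ⟩
  ∑< (suc t) (λ j → f (suc lo + j)) ∎

∑<-extend : ∀ N t (f : ℕ → ℤ) → t < N → ∑< (suc t) f ≡ ∑< N (λ i → ⟦ i ≤? t ⟧ · f i)
∑<-extend N t f t<N = trans (sym (∑<-interval N 0 t f t<N))
  (∑-cong (upTo N) (λ i → cong (_· f i) (⟦⟧-⇔ ((0 ≤? i) ×-dec (i ≤? t)) (i ≤? t) proj₂ (z≤n ,_))))

∑<-reverse : ∀ t (f : ℕ → ℤ) → ∑< (suc t) f ≡ ∑< (suc t) (λ i → f (t ∸ i))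
∑<-reverse zero    f = trans (∑<-one f) (sym (∑<-one (λ i → f (0 ∸ i))))
∑<-reverse (suc t) f = begin
  ∑< (suc (suc t)) f ≡⟨ ∑<-snoc (suc t) f ⟩
  ∑< (suc t) f +ℤ f (suc t) ≡⟨ ℤ.+-comm _ (f (suc t)) ⟩
  f (suc t) +ℤ ∑< (suc t) f ≡⟨ cong (f (suc t) +ℤ_) (∑<-reverse t f) ⟩
  f (suc t) +ℤ ∑< (suc t) (λ i → f (t ∸ i)) ≡⟨ ∑<-suc (suc t) (λ i → f (suc t ∸ i)) ⟨
  ∑< (suc (suc t)) (λ i → f (suc t ∸ i)) ∎

-- Eliminates a summation variable that the condition determines: `a` is the only index that can
-- satisfy `P`, and it does so exactly when `Q` holds. Solving a size equation for one part of a
-- shape has this form.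
∑<-collapse : ∀ N {P : ℕ → Set} (P? : ∀ i → Dec (P i)) (q? : Dec Q) a (f : ℕ → ℤ) →
  (∀ i → i < N → P i → i ≡ a × Q) → (Q → P a) → (Q → a < N) →
  ∑< N (λ i → ⟦ P? i ⟧ · f i) ≡ ⟦ q? ⟧ · f a
∑<-collapse N P? (no ¬q) a f h₁ h₂ h₃ =
  ∑<-0 N (λ i i<N → ⟦⟧-no-* (P? i) (λ p → ¬q (proj₂ (h₁ i i<N p))) (f i))
∑<-collapse N P? (yes q) a f h₁ h₂ h₃ = begin
  ∑< N (λ i → ⟦ P? i ⟧ · f i)
    ≡⟨ ∑<-cong N (λ i i<N → cong (_· f i) (⟦⟧-⇔ (P? i) ((a ≤? i) ×-dec (i ≤? a + 0))
         (λ p → ℕ.≤-reflexive (sym (proj₁ (h₁ i i<N p))) , ℕ.≤-reflexive (trans (proj₁ (h₁ i i<N p)) (sym (ℕ.+-identityʳ a))))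
         (λ (l , r) → subst _ (ℕ.≤-antisym l (subst (i ≤_) (ℕ.+-identityʳ a) r)) (h₂ q)))) ⟩
  ∑< N (λ i → ⟦ (a ≤? i) ×-dec (i ≤? a + 0) ⟧ · f i)
    ≡⟨ ∑<-interval N a 0 f (subst (_< N) (sym (ℕ.+-identityʳ a)) (h₃ q)) ⟩
  ∑< 1 (λ j → f (a + j)) ≡⟨ ∑<-one (λ j → f (a + j)) ⟩
  f (a + 0) ≡⟨ cong f (ℕ.+-identityʳ a) ⟩
  f a ≡⟨ ℤ.*-identityˡ (f a) ⟨
  1ℤ · f a ∎

-- The involution i ↦ lo + hi ∸ i of an interval. No lo ≤ hi is assumed, because the common interval
-- of two shapes may be empty.
∑<-reflect : ∀ N lo hi (f : ℕ → ℤ) → hi < N →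
  ∑< N (λ i → ⟦ (lo ≤? i) ×-dec (i ≤? hi) ⟧ · f i) ≡
  ∑< N (λ i → ⟦ (lo ≤? i) ×-dec (i ≤? hi) ⟧ · f (lo + hi ∸ i))
∑<-reflect N lo hi f hi<N with lo ≤? hi
... | no lo≰hi = trans (∑-0 (upTo N) (empty f)) (sym (∑-0 (upTo N) (empty (λ i → f (lo + hi ∸ i)))))
  where
  empty : ∀ g i → ⟦ (lo ≤? i) ×-dec (i ≤? hi) ⟧ · g i ≡ 0ℤ
  empty g i = ⟦⟧-no-* ((lo ≤? i) ×-dec (i ≤? hi)) (λ (p , q) → lo≰hi (ℕ.≤-trans p q)) (g i)
... | yes lo≤hi with hi ∸ lo | ℕ.m+[n∸m]≡n lo≤hi
... | t | refl = begin
  _ ≡⟨ ∑<-interval N lo t f hi<N ⟩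
  ∑< (suc t) (λ j → f (lo + j)) ≡⟨ ∑<-reverse t (λ j → f (lo + j)) ⟩
  ∑< (suc t) (λ j → f (lo + (t ∸ j)))
    ≡⟨ ∑<-cong (suc t) (λ { j (s≤s j≤t) → cong f (eq j j≤t) }) ⟩
  ∑< (suc t) (λ j → f (lo + (lo + t) ∸ (lo + j)))
    ≡⟨ ∑<-interval N lo t (λ i → f (lo + (lo + t) ∸ i)) hi<N ⟨
  _ ∎
  where
  eq : ∀ j → j ≤ t → lo + (t ∸ j) ≡ lo + (lo + t) ∸ (lo + j)
  eq j j≤t = begin
    lo + (t ∸ j) ≡⟨ ℕ.+-∸-assoc lo j≤t ⟨
    lo + t ∸ j ≡⟨ ℕ.[m+n]∸[m+o]≡n∸o lo (lo + t) j ⟨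
    lo + (lo + t) ∸ (lo + j) ∎

-- Removing the largest letter from a tableau

opaque
  unfolding ∑

  ∑-tabulate-snoc : ∀ {n} (g : Fin (suc n) → A) (f : A → ℤ) →
    ∑ (List.tabulate g) f ≡ ∑ (List.tabulate (g ∘ inject₁)) f +ℤ f (g (fromℕ n))
  ∑-tabulate-snoc {n = zero}  g f = ℤ.+-comm (f (g fzero)) 0ℤ
  ∑-tabulate-snoc {n = suc n} g f =
    trans (cong (f (g fzero) +ℤ_) (∑-tabulate-snoc (g ∘ fsuc) f)) (sym (ℤ.+-assoc (f (g fzero)) _ _))

  ∑-tabulate : ∀ {n} (g : Fin n → A) (f : A → ℤ) → ∑ (List.tabulate g) f ≡ ∑ (allFin n) (f ∘ g)
  ∑-tabulate {n = zero}  g f = refl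
  ∑-tabulate {n = suc n} g f = cong (f (g fzero) +ℤ_)
    (trans (∑-tabulate (g ∘ fsuc) f) (sym (∑-tabulate fsuc (f ∘ g))))

∑-allFin-snoc : ∀ n (f : Fin (suc n) → ℤ) →
  ∑ (allFin (suc n)) f ≡ ∑ (allFin n) (f ∘ inject₁) +ℤ f (fromℕ n)
∑-allFin-snoc n f = trans (∑-tabulate-snoc id f) (cong (_+ℤ f (fromℕ n)) (∑-tabulate inject₁ f))

∑-words-zero : ∀ N (f : List (Fin N) → ℤ) → ∑ (words N 0) f ≡ f []
∑-words-zero N f = ∑-singleton [] f

∑-words-suc : ∀ N m (f : List (Fin N) → ℤ) →
  ∑ (words N (suc m)) f ≡ ∑ (allFin N) (λ i → ∑ (words N m) (λ w → f (i ∷ w)))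
∑-words-suc N m f = trans (∑-concatMap (λ i → map (i ∷_) (words N m)) (allFin N) f)
  (∑-cong (allFin N) (λ i → ∑-map (i ∷_) (words N m) f))

∑-fillings-∷ : ∀ N r sh (f : Tableau N → ℤ) →
  ∑ (fillings N (r ∷ sh)) f ≡ ∑ (words N r) (λ w → ∑ (fillings N sh) (λ t → f (w ∷ t)))
∑-fillings-∷ N r sh f = trans (∑-concatMap (λ w → map (w ∷_) (fillings N sh)) (words N r) f)
  (∑-cong (words N r) (λ w → ∑-map (w ∷_) (fillings N sh) f))

∑-fillings-[] : ∀ N (f : Tableau N → ℤ) → ∑ (fillings N []) f ≡ f []
∑-fillings-[] N f = ∑-singleton [] f

opaque
  unfolding ∑

  ∑-words-cong : ∀ N m {f g : List (Fin N) → ℤ} → (∀ w → length w ≡ m → f w ≡ g w) →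
    ∑ (words N m) f ≡ ∑ (words N m) g
  ∑-words-cong N zero    h = cong (_+ℤ 0ℤ) (h [] refl)
  ∑-words-cong N (suc m) {f} {g} h =
    trans (∑-words-suc N m f)
      (trans (∑-cong (allFin N) (λ i → ∑-words-cong N m (λ w e → h (i ∷ w) (cong suc e))))
        (sym (∑-words-suc N m g)))

extend : ∀ {N} → List (Fin N) → ℕ → List (Fin (suc N))
extend {N} u m = map inject₁ u ++ replicate m (fromℕ N)

headLe : ∀ {N} → Fin N → List (Fin N) → Bool
headLe x []      = true
headLe x (y ∷ _) = toℕ x ≤ᵇ toℕ y

rowWeak-∷ : ∀ {N} (x : Fin N) w → rowWeak (x ∷ w) ≡ headLe x w ∧ rowWeak w
rowWeak-∷ x []      = refl
rowWeak-∷ x (y ∷ w) = refl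

T⇒≡true : ∀ {b} → T b → b ≡ true
T⇒≡true {true} _ = refl

≤⇒≤ᵇ-true : ∀ {m n} → m ≤ n → (m ≤ᵇ n) ≡ true
≤⇒≤ᵇ-true p = T⇒≡true (ℕ.≤⇒≤ᵇ p)

<⇒<ᵇ-true : ∀ {m n} → m < n → (m <ᵇ n) ≡ true
<⇒<ᵇ-true p = T⇒≡true (ℕ.<⇒<ᵇ p)

≰⇒≤ᵇ-false : ∀ {m n} → ¬ (m ≤ n) → (m ≤ᵇ n) ≡ false
≰⇒≤ᵇ-false {m} {n} ¬p with m ≤ᵇ n in eq
... | true  = contradiction (ℕ.≤ᵇ⇒≤ m n (subst T (sym eq) _)) ¬p
... | false = refl

≮⇒<ᵇ-false : ∀ {m n} → ¬ (m < n) → (m <ᵇ n) ≡ false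
≮⇒<ᵇ-false {m} {n} ¬p with m <ᵇ n in eq
... | true  = contradiction (ℕ.<ᵇ⇒< m n (subst T (sym eq) _)) ¬p
... | false = refl

inject₁<fromℕ : ∀ {N} (i : Fin N) → toℕ (inject₁ i) < toℕ (fromℕ N)
inject₁<fromℕ {N} i rewrite Fin.toℕ-inject₁ i | Fin.toℕ-fromℕ N = Fin.toℕ<n i

headLe-inject₁ : ∀ {N} (i : Fin N) u m → headLe (inject₁ i) (extend u m) ≡ headLe i u
headLe-inject₁ i []      zero    = refl
headLe-inject₁ i []      (suc m) = ≤⇒≤ᵇ-true (ℕ.<⇒≤ (inject₁<fromℕ i))
headLe-inject₁ i (j ∷ u) m rewrite Fin.toℕ-inject₁ i | Fin.toℕ-inject₁ j = refl

headLe-last : ∀ {N} m → headLe (fromℕ N) (extend [] m) ≡ true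
headLe-last zero    = refl
headLe-last {N} (suc m) = ≤⇒≤ᵇ-true (ℕ.≤-refl {toℕ (fromℕ N)})

RowBranching : ℕ → ℕ → Set
RowBranching N r = (G : List (Fin (suc N)) → ℤ) →
  ∑ (words (suc N) r) (λ w → [ rowWeak w ]ᵇ · G w) ≡
  ∑< (suc r) (λ m → ∑ (words N m) (λ u → [ rowWeak u ]ᵇ · G (extend u (r ∸ m))))

-- Induction on the length through the first letter. A letter of the smaller alphabet is put in
-- front of `u`; after a largest letter only largest letters can follow, so that case contributes
-- the single term m = 0.
row-branching : ∀ N r → RowBranching N r
row-branching N zero G = begin
  _ ≡⟨ ∑-words-zero (suc N) _ ⟩
  1ℤ · G [] ≡⟨ ∑-words-zero N _ ⟨
  ∑ (words N 0) (λ u → [ rowWeak u ]ᵇ · G (extend u 0)) ≡⟨ ∑<-one _ ⟨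
  _ ∎
row-branching N (suc r) G = begin
  ∑ (words (suc N) (suc r)) (λ w → [ rowWeak w ]ᵇ · G w)
    ≡⟨ ∑-words-suc (suc N) r _ ⟩
  ∑ (allFin (suc N)) (λ i → ∑ (words (suc N) r) (λ w → [ rowWeak (i ∷ w) ]ᵇ · G (i ∷ w)))
    ≡⟨ ∑-allFin-snoc N _ ⟩
  ∑ (allFin N) (λ i → byHead (inject₁ i)) +ℤ byHead (fromℕ N)
    ≡⟨ cong₂ _+ℤ_ (∑-cong (allFin N) small) large ⟩
  ∑ (allFin N) (λ i → ∑< (suc r) (λ m → ∑ (words N m) (λ u → term m (i ∷ u)))) +ℤ F 0
    ≡⟨ cong (_+ℤ F 0) (∑-swap (allFin N) (upTo (suc r)) _) ⟩
  ∑< (suc r) (λ m → ∑ (allFin N) (λ i → ∑ (words N m) (λ u → term m (i ∷ u)))) +ℤ F 0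
    ≡⟨ cong (_+ℤ F 0) (∑-cong (upTo (suc r)) (λ m → sym (∑-words-suc N m (term m)))) ⟩
  ∑< (suc r) (F ∘ suc) +ℤ F 0 ≡⟨ ℤ.+-comm _ (F 0) ⟩
  F 0 +ℤ ∑< (suc r) (F ∘ suc) ≡⟨ ∑<-suc (suc r) F ⟨
  ∑< (suc (suc r)) F ∎
  where
  byHead : Fin (suc N) → ℤ
  byHead i = ∑ (words (suc N) r) (λ w → [ rowWeak (i ∷ w) ]ᵇ · G (i ∷ w))
  term : ℕ → List (Fin N) → ℤ
  term m u = [ rowWeak u ]ᵇ · G (extend u (r ∸ m))
  F : ℕ → ℤ
  F m = ∑ (words N m) (λ u → [ rowWeak u ]ᵇ · G (extend u (suc r ∸ m)))
  byHead≡ : ∀ i → byHead i ≡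
    ∑< (suc r) (λ m → ∑ (words N m) (λ u →
      [ rowWeak u ]ᵇ · ([ headLe i (extend u (r ∸ m)) ]ᵇ · G (i ∷ extend u (r ∸ m)))))
  byHead≡ i = trans (∑-cong (words (suc N) r) split) (row-branching N r (λ w → [ headLe i w ]ᵇ · G (i ∷ w)))
    where
    swap : ∀ a b c → (a · b) · c ≡ b · (a · c)
    swap = ℤSolver.solve-∀
    split : ∀ w → [ rowWeak (i ∷ w) ]ᵇ · G (i ∷ w) ≡ [ rowWeak w ]ᵇ · ([ headLe i w ]ᵇ · G (i ∷ w))
    split w = begin
      [ rowWeak (i ∷ w) ]ᵇ · G (i ∷ w) ≡⟨ cong (λ b → [ b ]ᵇ · G (i ∷ w)) (rowWeak-∷ i w) ⟩
      [ headLe i w ∧ rowWeak w ]ᵇ · G (i ∷ w) ≡⟨ cong (_· G (i ∷ w)) ([]ᵇ-∧ (headLe i w) (rowWeak w)) ⟩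
      ([ headLe i w ]ᵇ · [ rowWeak w ]ᵇ) · G (i ∷ w) ≡⟨ swap [ headLe i w ]ᵇ [ rowWeak w ]ᵇ (G (i ∷ w)) ⟩
      [ rowWeak w ]ᵇ · ([ headLe i w ]ᵇ · G (i ∷ w)) ∎
  small : ∀ i → byHead (inject₁ i) ≡ ∑< (suc r) (λ m → ∑ (words N m) (λ u → term m (i ∷ u)))
  small i = trans (byHead≡ (inject₁ i)) (∑-cong (upTo (suc r)) (λ m → ∑-cong (words N m) (merge m)))
    where
    swap : ∀ a b c → b · (a · c) ≡ (a · b) · c
    swap = ℤSolver.solve-∀
    merge : ∀ m u → [ rowWeak u ]ᵇ · ([ headLe (inject₁ i) (extend u (r ∸ m)) ]ᵇ · G (inject₁ i ∷ extend u (r ∸ m)))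
                    ≡ term m (i ∷ u)
    merge m u = begin
      [ rowWeak u ]ᵇ · ([ headLe (inject₁ i) (extend u (r ∸ m)) ]ᵇ · g)
        ≡⟨ cong (λ b → [ rowWeak u ]ᵇ · ([ b ]ᵇ · g)) (headLe-inject₁ i u (r ∸ m)) ⟩
      [ rowWeak u ]ᵇ · ([ headLe i u ]ᵇ · g) ≡⟨ swap [ headLe i u ]ᵇ [ rowWeak u ]ᵇ g ⟩
      ([ headLe i u ]ᵇ · [ rowWeak u ]ᵇ) · g ≡⟨ cong (_· g) ([]ᵇ-∧ (headLe i u) (rowWeak u)) ⟨
      [ headLe i u ∧ rowWeak u ]ᵇ · g ≡⟨ cong (λ b → [ b ]ᵇ · g) (rowWeak-∷ i u) ⟨
      [ rowWeak (i ∷ u) ]ᵇ · g ∎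
      where g = G (inject₁ i ∷ extend u (r ∸ m))
  large : byHead (fromℕ N) ≡ F 0
  large = begin
    byHead (fromℕ N) ≡⟨ byHead≡ (fromℕ N) ⟩
    _ ≡⟨ ∑<-suc r _ ⟩
    ∑ (words N 0) (λ u → h 0 u) +ℤ ∑< r (λ m → ∑ (words N (suc m)) (h (suc m)))
      ≡⟨ cong₂ _+ℤ_ (∑-words-zero N (h 0)) (∑-0 (upTo r) (λ m →
           trans (∑-words-suc N m (h (suc m))) (∑-0 (allFin N) (λ i → ∑-0 (words N m) (vanish m i))))) ⟩
    h 0 [] +ℤ 0ℤ ≡⟨ ℤ.+-identityʳ (h 0 []) ⟩
    1ℤ · ([ headLe (fromℕ N) (extend [] r) ]ᵇ · G (extend [] (suc r)))
      ≡⟨ cong (λ b → 1ℤ · ([ b ]ᵇ · G (extend [] (suc r)))) (headLe-last {N} r) ⟩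
    1ℤ · (1ℤ · G (extend [] (suc r))) ≡⟨ cong (1ℤ ·_) (ℤ.*-identityˡ (G (extend [] (suc r)))) ⟩
    1ℤ · G (extend [] (suc r)) ≡⟨ ∑-words-zero N (λ u → [ rowWeak u ]ᵇ · G (extend u (suc r))) ⟨
    F 0 ∎
    where
    h : ℕ → List (Fin N) → ℤ
    h m u = [ rowWeak u ]ᵇ · ([ headLe (fromℕ N) (extend u (r ∸ m)) ]ᵇ · G (fromℕ N ∷ extend u (r ∸ m)))
    vanish : ∀ m i u → h (suc m) (i ∷ u) ≡ 0ℤ
    vanish m i u = trans
      (cong (λ b → [ rowWeak (i ∷ u) ]ᵇ · ([ b ]ᵇ · g)) (≰⇒≤ᵇ-false (ℕ.<⇒≱ (inject₁<fromℕ i))))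
      (trans (cong ([ rowWeak (i ∷ u) ]ᵇ ·_) (ℤ.*-zeroˡ g)) (ℤ.*-zeroʳ [ rowWeak (i ∷ u) ]ᵇ))
      where g = G (fromℕ N ∷ extend (i ∷ u) (r ∸ suc m))

≤ᵇ-suc : ∀ m n → (suc m ≤ᵇ suc n) ≡ (m ≤ᵇ n)
≤ᵇ-suc zero    n = refl
≤ᵇ-suc (suc m) n = refl

-- Nothing can stand strictly below a largest letter, so the whole lower row, its own largest
-- letters included, must lie under `u`. This is the source of the interlacing inequalities.
colStrict-extend : ∀ {N} (u u' : List (Fin N)) m m' →
  colStrict (extend u m) (extend u' m') ≡ colStrict u u' ∧ (length u' + m' ≤ᵇ length u)
colStrict-extend []      []       m       zero     = refl
colStrict-extend []      []       zero    (suc m') = refl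
colStrict-extend {N} []  []       (suc m) (suc m') =
  cong (_∧ colStrict (replicate m (fromℕ N)) (replicate m' (fromℕ N))) (≮⇒<ᵇ-false (ℕ.<-irrefl {toℕ (fromℕ N)} refl))
colStrict-extend []      (y ∷ u') zero    m'       = refl
colStrict-extend {N} []  (y ∷ u') (suc m) m'       =
  cong (_∧ colStrict (replicate m (fromℕ N)) (extend u' m')) (≮⇒<ᵇ-false (ℕ.<⇒≯ (inject₁<fromℕ y)))
colStrict-extend (x ∷ u) []       m       zero     = refl
colStrict-extend {N} (x ∷ u) [] m      (suc m') = begin
  (toℕ (inject₁ x) <ᵇ toℕ (fromℕ N)) ∧ colStrict (extend u m) (extend [] m')
    ≡⟨ cong (_∧ colStrict (extend u m) (extend [] m')) (<⇒<ᵇ-true (inject₁<fromℕ x)) ⟩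
  colStrict (extend u m) (extend [] m') ≡⟨ colStrict-extend u [] m m' ⟩
  colStrict u [] ∧ (m' ≤ᵇ length u) ≡⟨ cong (_∧ (m' ≤ᵇ length u)) (colStrict-[] u) ⟩
  (m' ≤ᵇ length u) ≡⟨ ≤ᵇ-suc m' (length u) ⟨
  (suc m' ≤ᵇ suc (length u)) ∎
  where
  colStrict-[] : ∀ {N} (u : List (Fin N)) → colStrict u [] ≡ true
  colStrict-[] []      = refl
  colStrict-[] (_ ∷ _) = refl
colStrict-extend (x ∷ u) (y ∷ u') m       m'       = begin
  (toℕ (inject₁ x) <ᵇ toℕ (inject₁ y)) ∧ colStrict (extend u m) (extend u' m')
    ≡⟨ cong₂ _∧_ (cong₂ _<ᵇ_ (Fin.toℕ-inject₁ x) (Fin.toℕ-inject₁ y)) (colStrict-extend u u' m m') ⟩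
  (toℕ x <ᵇ toℕ y) ∧ (colStrict u u' ∧ (length u' + m' ≤ᵇ length u)) ≡⟨ Bool.∧-assoc (toℕ x <ᵇ toℕ y) _ _ ⟨
  ((toℕ x <ᵇ toℕ y) ∧ colStrict u u') ∧ (length u' + m' ≤ᵇ length u) ≡⟨ cong (((toℕ x <ᵇ toℕ y) ∧ colStrict u u') ∧_) (≤ᵇ-suc (length u' + m') (length u)) ⟨
  ((toℕ x <ᵇ toℕ y) ∧ colStrict u u') ∧ (suc (length u' + m') ≤ᵇ suc (length u)) ∎

-- Horizontal strips and the branching rule

Shape : Set
Shape = ℕ × ℕ × ℕ

∣_∣ : Shape → ℕ
∣ a , b , c ∣ = a + b + c

infix 4 _≽_ _≽?_

-- The horizontal strip condition in its interlacing form a ≥ a' ≥ b ≥ b' ≥ c ≥ c'. It forces both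
-- triples to be weakly decreasing, which is why `Shape` itself carries no such condition.
_≽_ : Shape → Shape → Set
(a , b , c) ≽ (a' , b' , c') = (a' ≤ a × b ≤ a') × (b' ≤ b × c ≤ b') × c' ≤ c

_≽?_ : ∀ s t → Dec (s ≽ t)
(a , b , c) ≽? (a' , b' , c') = ((a' ≤? a) ×-dec (b ≤? a')) ×-dec (((b' ≤? b) ×-dec (c ≤? b')) ×-dec (c' ≤? c))

-- A fixed range for all sums over shapes: sizes and strip conditions enter as brackets in the
-- summand, so that the order of summation can be changed freely.
box : ℕ → List Shape
box B = concatMap (λ a → concatMap (λ b → map (λ c → a , b , c) (upTo B)) (upTo B)) (upTo B)

∑-box : ∀ B (f : Shape → ℤ) → ∑ (box B) f ≡ ∑< B (λ a → ∑< B (λ b → ∑< B (λ c → f (a , b , c))))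
∑-box B f = trans (∑-concatMap _ (upTo B) f) (∑-cong (upTo B) (λ a →
  trans (∑-concatMap _ (upTo B) f) (∑-cong (upTo B) (λ b → ∑-map _ (upTo B) f))))

∑-box-cong : ∀ B {f g : Shape → ℤ} → (∀ a b c → a < B → b < B → c < B → f (a , b , c) ≡ g (a , b , c)) →
  ∑ (box B) f ≡ ∑ (box B) g
∑-box-cong B {f} {g} h = trans (∑-box B f) (trans
  (∑<-cong B (λ a a< → ∑<-cong B (λ b b< → ∑<-cong B (λ c c< → h a b c a< b< c<))))
  (sym (∑-box B g)))

rows : (N r : ℕ) → List (List (Fin N))
rows N r = filterᵇ rowWeak (words N r)

∑-rows-zero : ∀ N (f : List (Fin N) → ℤ) → ∑ (rows N 0) f ≡ f []
∑-rows-zero N f = ∑-singleton [] f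

∑-rows-cong : ∀ N r {f g : List (Fin N) → ℤ} → (∀ w → length w ≡ r → f w ≡ g w) →
  ∑ (rows N r) f ≡ ∑ (rows N r) g
∑-rows-cong N r {f} {g} h = trans (∑-filterᵇ rowWeak (words N r) f) (trans
  (∑-words-cong N r (λ w e → cong ([ rowWeak w ]ᵇ ·_) (h w e)))
  (sym (∑-filterᵇ rowWeak (words N r) g)))

∑-rows-suc : ∀ N B r (f : List (Fin (suc N)) → ℤ) → r < B →
  ∑ (rows (suc N) r) f ≡ ∑< B (λ m → ⟦ m ≤? r ⟧ · ∑ (rows N m) (λ u → f (extend u (r ∸ m))))
∑-rows-suc N B r f r<B = begin
  ∑ (rows (suc N) r) f ≡⟨ ∑-filterᵇ rowWeak (words (suc N) r) f ⟩
  _ ≡⟨ row-branching N r f ⟩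
  ∑< (suc r) (λ m → ∑ (words N m) (λ u → [ rowWeak u ]ᵇ · f (extend u (r ∸ m))))
    ≡⟨ ∑-cong (upTo (suc r)) (λ m → sym (∑-filterᵇ rowWeak (words N m) _)) ⟩
  ∑< (suc r) (λ m → ∑ (rows N m) (λ u → f (extend u (r ∸ m)))) ≡⟨ ∑<-extend B r _ r<B ⟩
  _ ∎

Filling : ℕ → Set
Filling N = List (Fin N) → List (Fin N) → List (Fin N) → ℤ

ssytSum : (N : ℕ) → Shape → Filling N → ℤ
ssytSum N (a , b , c) G = ∑ (rows N a) λ u → ∑ (rows N b) λ v → ∑ (rows N c) λ w →
  [ colStrict u v ]ᵇ · ([ colStrict v w ]ᵇ · G u v w)

ssytSum-cong : ∀ N s {G G' : Filling N} →
  (∀ u v w → G u v w ≡ G' u v w) → ssytSum N s G ≡ ssytSum N s G'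
ssytSum-cong N (a , b , c) h = ∑-cong (rows N a) λ u → ∑-cong (rows N b) λ v → ∑-cong (rows N c) λ w →
  cong (λ x → [ colStrict u v ]ᵇ · ([ colStrict v w ]ᵇ · x)) (h u v w)

∑-∑-*ˡ : ∀ {A B : Set} (xs : List A) (ys : List B) (p : B → ℤ) (f : A → B → ℤ) →
  ∑ xs (λ x → ∑ ys (λ y → p y · f x y)) ≡ ∑ ys (λ y → p y · ∑ xs (λ x → f x y))
∑-∑-*ˡ xs ys p f = trans (∑-swap xs ys (λ x y → p y · f x y))
  (∑-cong ys (λ y → sym (∑-*ˡ xs (p y) (λ x → f x y))))

-- The largest letters sit at the ends of the rows; `row-branching` detaches them row by row, and
-- `colStrict-extend` converts the column conditions between the old rows into those between the
-- shortened rows and the interlacing of the two shapes.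
ssytSum-suc : ∀ N B a b c → a < B → b < B → c < B →
  (G : Filling (suc N)) →
  ssytSum (suc N) (a , b , c) G ≡
  ∑ (box B) (λ (a' , b' , c') → ⟦ (a , b , c) ≽? (a' , b' , c') ⟧ ·
    ssytSum N (a' , b' , c') (λ u v w → G (extend u (a ∸ a')) (extend v (b ∸ b')) (extend w (c ∸ c'))))
ssytSum-suc N B a b c a<B b<B c<B G = begin
  ∑ (rows (suc N) a) (λ u → ∑ (rows (suc N) b) λ v → ∑ (rows (suc N) c) (F u v))
    ≡⟨ ∑-rows-suc N B a _ a<B ⟩
  ∑< B (λ a' → ⟦ a' ≤? a ⟧ · ∑ (rows N a') λ u → ∑ (rows (suc N) b) λ v → ∑ (rows (suc N) c) (F (u +ᵃ a') v))
    ≡⟨ ∑-cong (upTo B) (λ a' → cong (⟦ a' ≤? a ⟧ ·_) (step-b a')) ⟩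
  ∑< B (λ a' → ⟦ a' ≤? a ⟧ · ∑< B (λ b' → ⟦ b' ≤? b ⟧ · ∑< B (λ c' → ⟦ c' ≤? c ⟧ · X a' b' c')))
    ≡⟨ ∑-cong (upTo B) (λ a' → trans (∑-*ˡ (upTo B) ⟦ a' ≤? a ⟧ _) (∑-cong (upTo B) (λ b' →
         trans (cong (⟦ a' ≤? a ⟧ ·_) (∑-*ˡ (upTo B) ⟦ b' ≤? b ⟧ _))
           (trans (∑-*ˡ (upTo B) ⟦ a' ≤? a ⟧ _) (∑-cong (upTo B) (pointwise a' b')))))) ⟩
  ∑< B (λ a' → ∑< B (λ b' → ∑< B (λ c' → ⟦ (a , b , c) ≽? (a' , b' , c') ⟧ · Y a' b' c')))
    ≡⟨ ∑-box B _ ⟨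
  _ ∎
  where
  _+ᵃ_ _+ᵇ_ _+ᶜ_ : List (Fin N) → ℕ → List (Fin (suc N))
  u +ᵃ m = extend u (a ∸ m)
  v +ᵇ m = extend v (b ∸ m)
  w +ᶜ m = extend w (c ∸ m)
  F : Filling (suc N)
  F u v w = [ colStrict u v ]ᵇ · ([ colStrict v w ]ᵇ · G u v w)
  X Y : ℕ → ℕ → ℕ → ℤ
  X a' b' c' = ∑ (rows N a') λ u → ∑ (rows N b') λ v → ∑ (rows N c') λ w →
    F (u +ᵃ a') (v +ᵇ b') (w +ᶜ c')
  Y a' b' c' = ssytSum N (a' , b' , c') (λ u v w → G (u +ᵃ a') (v +ᵇ b') (w +ᶜ c'))
  step-c : ∀ a' b' u → ∑ (rows N b') (λ v → ∑ (rows (suc N) c) (F (u +ᵃ a') (v +ᵇ b'))) ≡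
    ∑< B (λ c' → ⟦ c' ≤? c ⟧ · ∑ (rows N b') λ v → ∑ (rows N c') λ w →
      F (u +ᵃ a') (v +ᵇ b') (w +ᶜ c'))
  step-c a' b' u = trans (∑-cong (rows N b') (λ v → ∑-rows-suc N B c _ c<B))
    (∑-∑-*ˡ (rows N b') (upTo B) (λ c' → ⟦ c' ≤? c ⟧) _)
  step-b : ∀ a' → ∑ (rows N a') (λ u → ∑ (rows (suc N) b) λ v → ∑ (rows (suc N) c) (F (u +ᵃ a') v)) ≡
    ∑< B (λ b' → ⟦ b' ≤? b ⟧ · ∑< B (λ c' → ⟦ c' ≤? c ⟧ · X a' b' c'))
  step-b a' = begin
    _ ≡⟨ ∑-cong (rows N a') (λ u → ∑-rows-suc N B b _ b<B) ⟩
    _ ≡⟨ ∑-∑-*ˡ (rows N a') (upTo B) (λ b' → ⟦ b' ≤? b ⟧) _ ⟩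
    ∑< B (λ b' → ⟦ b' ≤? b ⟧ · ∑ (rows N a') λ u → ∑ (rows N b') λ v → ∑ (rows (suc N) c) (F (u +ᵃ a') (v +ᵇ b')))
      ≡⟨ ∑-cong (upTo B) (λ b' → cong (⟦ b' ≤? b ⟧ ·_) (trans (∑-cong (rows N a') (step-c a' b'))
           (∑-∑-*ˡ (rows N a') (upTo B) (λ c' → ⟦ c' ≤? c ⟧) _))) ⟩
    _ ∎
  -- The bounds b' ≤ b and c' ≤ c make the truncated subtractions exact, so the length tests of
  -- `colStrict-extend` read b ≤ a' and c ≤ b'.
  columns : ∀ a' b' c' → b' ≤ b → c' ≤ c → X a' b' c' ≡ ⟦ b ≤? a' ⟧ · (⟦ c ≤? b' ⟧ · Y a' b' c')
  columns a' b' c' b'≤b c'≤c = begin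
    X a' b' c'
      ≡⟨ ∑-rows-cong N a' (λ u lu → ∑-rows-cong N b' (λ v lv → ∑-rows-cong N c' (λ w lw → entry u v w lu lv lw))) ⟩
    ∑ (rows N a') (λ u → ∑ (rows N b') λ v → ∑ (rows N c') λ w → k · E u v w)
      ≡⟨ ∑-cong (rows N a') (λ u → ∑-cong (rows N b') (λ v → sym (∑-*ˡ (rows N c') k (E u v)))) ⟩
    _ ≡⟨ ∑-cong (rows N a') (λ u → sym (∑-*ˡ (rows N b') k (λ v → ∑ (rows N c') (E u v)))) ⟩
    _ ≡⟨ ∑-*ˡ (rows N a') k _ ⟨
    k · Y a' b' c' ≡⟨ ℤ.*-assoc ⟦ b ≤? a' ⟧ ⟦ c ≤? b' ⟧ (Y a' b' c') ⟩
    _ ∎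
    where
    k = ⟦ b ≤? a' ⟧ · ⟦ c ≤? b' ⟧
    E : Filling N
    E u v w = [ colStrict u v ]ᵇ · ([ colStrict v w ]ᵇ · G (u +ᵃ a') (v +ᵇ b') (w +ᶜ c'))
    shuffle : ∀ p q r s x → (p · q) · ((r · s) · x) ≡ (q · s) · (p · (r · x))
    shuffle = ℤSolver.solve-∀
    column : ∀ (u v : List (Fin N)) m {a' b b'} → length u ≡ a' → length v ≡ b' → b' ≤ b →
      [ colStrict (extend u m) (extend v (b ∸ b')) ]ᵇ ≡ [ colStrict u v ]ᵇ · ⟦ b ≤? a' ⟧
    column u v m {b = b} refl refl le = trans (cong [_]ᵇ (colStrict-extend u v m (b ∸ length v)))
      (trans ([]ᵇ-∧ (colStrict u v) _) (cong (λ z → [ colStrict u v ]ᵇ · ⟦ z ≤? length u ⟧) (ℕ.m+[n∸m]≡n le)))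
    entry : ∀ u v w → length u ≡ a' → length v ≡ b' → length w ≡ c' →
      F (u +ᵃ a') (v +ᵇ b') (w +ᶜ c') ≡ k · E u v w
    entry u v w lu lv lw = trans
      (cong₂ (λ x y → x · (y · G (u +ᵃ a') (v +ᵇ b') (w +ᶜ c')))
        (column u v (a ∸ a') lu lv b'≤b) (column v w (b ∸ b') lv lw c'≤c))
      (shuffle [ colStrict u v ]ᵇ ⟦ b ≤? a' ⟧ [ colStrict v w ]ᵇ ⟦ c ≤? b' ⟧ _)
  pointwise : ∀ a' b' c' → ⟦ a' ≤? a ⟧ · (⟦ b' ≤? b ⟧ · (⟦ c' ≤? c ⟧ · X a' b' c')) ≡
    ⟦ (a , b , c) ≽? (a' , b' , c') ⟧ · Y a' b' c'
  pointwise a' b' c' = begin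
    ⟦ a' ≤? a ⟧ · (⟦ b' ≤? b ⟧ · (⟦ c' ≤? c ⟧ · X a' b' c'))
      ≡⟨ cong (⟦ a' ≤? a ⟧ ·_) (⟦⟧-*-congʳ (b' ≤? b) (λ p → ⟦⟧-*-congʳ (c' ≤? c) (columns a' b' c' p))) ⟩
    ⟦ a' ≤? a ⟧ · (⟦ b' ≤? b ⟧ · (⟦ c' ≤? c ⟧ · (⟦ b ≤? a' ⟧ · (⟦ c ≤? b' ⟧ · Y a' b' c'))))
      ≡⟨ rearrange ⟦ a' ≤? a ⟧ ⟦ b' ≤? b ⟧ ⟦ c' ≤? c ⟧ ⟦ b ≤? a' ⟧ ⟦ c ≤? b' ⟧ (Y a' b' c') ⟩
    ((⟦ a' ≤? a ⟧ · ⟦ b ≤? a' ⟧) · ((⟦ b' ≤? b ⟧ · ⟦ c ≤? b' ⟧) · ⟦ c' ≤? c ⟧)) · Y a' b' c'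
      ≡⟨ cong (_· Y a' b' c') (trans (⟦⟧-× ((a' ≤? a) ×-dec (b ≤? a')) (((b' ≤? b) ×-dec (c ≤? b')) ×-dec (c' ≤? c)))
           (cong₂ _·_ (⟦⟧-× (a' ≤? a) (b ≤? a'))
             (trans (⟦⟧-× ((b' ≤? b) ×-dec (c ≤? b')) (c' ≤? c)) (cong (_· ⟦ c' ≤? c ⟧) (⟦⟧-× (b' ≤? b) (c ≤? b')))))) ⟨
    _ ∎
    where
    rearrange : ∀ p q r s t y → p · (q · (r · (s · (t · y)))) ≡ ((p · s) · ((q · t) · r)) · y
    rearrange = ℤSolver.solve-∀

ssytSum-zero : ∀ s (G : Filling 0) →
  ssytSum 0 s G ≡ [ ∣ s ∣ ≡ᵇ 0 ]ᵇ · G [] [] []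
ssytSum-zero (suc a , b , c) G = ∑-[] _
ssytSum-zero (zero , suc b , c) G = trans (∑-rows-zero 0 _) (∑-[] _)
ssytSum-zero (zero , zero , suc c) G = trans (∑-rows-zero 0 _) (trans (∑-rows-zero 0 _) (∑-[] _))
ssytSum-zero (zero , zero , zero) G = trans (∑-rows-zero 0 _) (trans (∑-rows-zero 0 _) (trans (∑-rows-zero 0 _) (cong (1ℤ ·_) (ℤ.*-identityˡ (G [] [] [])))))

-- Exponent vectors and the last variable

infixl 6 _⊕_

_⊕_ : ∀ {n} → Vec ℕ n → Vec ℕ n → Vec ℕ n
_⊕_ = zipWith _+_

⊕-∷ʳ : ∀ {n} (xs ys : Vec ℕ n) x y → (xs ∷ʳ x) ⊕ (ys ∷ʳ y) ≡ (xs ⊕ ys) ∷ʳ (x + y)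
⊕-∷ʳ []       []       x y = refl
⊕-∷ʳ (a ∷ xs) (b ∷ ys) x y = cong (a + b ∷_) (⊕-∷ʳ xs ys x y)

tabulate-∷ʳ : ∀ {n} (f : Fin (suc n) → ℕ) → tabulate f ≡ tabulate (f ∘ inject₁) ∷ʳ f (fromℕ n)
tabulate-∷ʳ {zero}  f = refl
tabulate-∷ʳ {suc n} f = cong (f fzero ∷_) (tabulate-∷ʳ (f ∘ fsuc))

replicate-∷ʳ : ∀ n (x : ℕ) → Vec.replicate (suc n) x ≡ Vec.replicate n x ∷ʳ x
replicate-∷ʳ zero    x = refl
replicate-∷ʳ (suc n) x = cong (x ∷_) (replicate-∷ʳ n x)

tabulate-const : ∀ n (x : ℕ) → tabulate {n = n} (λ _ → x) ≡ Vec.replicate n x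
tabulate-const zero    x = refl
tabulate-const (suc n) x = cong (x ∷_) (tabulate-const n x)

≢⇒≡ᵇ-false : ∀ {m n} → m ≢ n → (m ≡ᵇ n) ≡ false
≢⇒≡ᵇ-false {m} {n} ¬p with m ≡ᵇ n in eq
... | true  = contradiction (ℕ.≡ᵇ⇒≡ m n (subst T (sym eq) _)) ¬p
... | false = refl

≡ᵇ-refl : ∀ n → (n ≡ᵇ n) ≡ true
≡ᵇ-refl n = T⇒≡true (ℕ.≡⇒≡ᵇ n n refl)

unitVec-inject₁ : ∀ {n} (i : Fin n) → unitVec (inject₁ i) ≡ unitVec i ∷ʳ 0
unitVec-inject₁ {n} i = trans (tabulate-∷ʳ (λ j → if toℕ (inject₁ i) ≡ᵇ toℕ j then 1 else 0)) (cong₂ _∷ʳ_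
  (Vec.tabulate-cong (λ j → cong₂ (λ x y → if x ≡ᵇ y then 1 else 0) (Fin.toℕ-inject₁ i) (Fin.toℕ-inject₁ j)))
  (cong (if_then 1 else 0) (≢⇒≡ᵇ-false (ℕ.<⇒≢ (inject₁<fromℕ i)))))

unitVec-fromℕ : ∀ n → unitVec (fromℕ n) ≡ Vec.replicate n 0 ∷ʳ 1
unitVec-fromℕ n = trans (tabulate-∷ʳ (λ j → if toℕ (fromℕ n) ≡ᵇ toℕ j then 1 else 0)) (cong₂ _∷ʳ_
  (trans (Vec.tabulate-cong (λ j → cong (if_then 1 else 0) (≢⇒≡ᵇ-false (λ e → ℕ.<⇒≢ (inject₁<fromℕ j) (sym e)))))
    (tabulate-const n 0))
  (cong (if_then 1 else 0) (≡ᵇ-refl (toℕ (fromℕ n)))))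

⊕-identityˡ : ∀ {n} (xs : Vec ℕ n) → Vec.replicate n 0 ⊕ xs ≡ xs
⊕-identityˡ []       = refl
⊕-identityˡ (x ∷ xs) = cong (x ∷_) (⊕-identityˡ xs)

addRow : ∀ {n} → List (Fin n) → Vec ℕ n → Vec ℕ n
addRow row acc = foldr (λ i a → unitVec i ⊕ a) acc row

addRow-extend : ∀ {n} (u : List (Fin n)) m acc e → addRow (extend u m) (acc ∷ʳ e) ≡ addRow u acc ∷ʳ (m + e)
addRow-extend []      zero    acc e = refl
addRow-extend {n} []  (suc m) acc e = begin
  unitVec (fromℕ n) ⊕ (addRow (extend [] m) (acc ∷ʳ e))
    ≡⟨ cong₂ _⊕_ (unitVec-fromℕ n) (addRow-extend [] m acc e) ⟩
  (Vec.replicate n 0 ∷ʳ 1) ⊕ (acc ∷ʳ (m + e)) ≡⟨ ⊕-∷ʳ _ acc 1 (m + e) ⟩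
  (Vec.replicate n 0 ⊕ acc) ∷ʳ suc (m + e) ≡⟨ cong (_∷ʳ suc (m + e)) (⊕-identityˡ acc) ⟩
  acc ∷ʳ suc (m + e) ∎
addRow-extend (i ∷ u) m       acc e =
  trans (cong₂ _⊕_ (unitVec-inject₁ i) (addRow-extend u m acc e)) (⊕-∷ʳ (unitVec i) (addRow u acc) 0 (m + e))

weight₃ : ∀ {n} → List (Fin n) → List (Fin n) → List (Fin n) → Vec ℕ n
weight₃ u v w = weight unitVec (u ∷ v ∷ w ∷ [])

weight₃-extend : ∀ {n} (u v w : List (Fin n)) l m o →
  weight₃ (extend u l) (extend v m) (extend w o) ≡ weight₃ u v w ∷ʳ (l + (m + (o + 0)))
weight₃-extend {n} u v w l m o = begin
  addRow (extend u l) (addRow (extend v m) (addRow (extend w o) (Vec.replicate (suc n) 0)))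
    ≡⟨ cong (λ z → addRow (extend u l) (addRow (extend v m) (addRow (extend w o) z))) (replicate-∷ʳ n 0) ⟩
  addRow (extend u l) (addRow (extend v m) (addRow (extend w o) (Vec.replicate n 0 ∷ʳ 0)))
    ≡⟨ cong (λ z → addRow (extend u l) (addRow (extend v m) z)) (addRow-extend w o _ 0) ⟩
  addRow (extend u l) (addRow (extend v m) (addRow w (Vec.replicate n 0) ∷ʳ (o + 0)))
    ≡⟨ cong (addRow (extend u l)) (addRow-extend v m _ (o + 0)) ⟩
  addRow (extend u l) (addRow v (addRow w (Vec.replicate n 0)) ∷ʳ (m + (o + 0)))
    ≡⟨ addRow-extend u l _ (m + (o + 0)) ⟩
  weight₃ u v w ∷ʳ (l + (m + (o + 0))) ∎

-- A polynomial f is represented by the functional G ↦ ∑ G(β) over the exponents β of its monomials;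
-- its coefficient of x^α is the value at the indicator function of α.
opaque
  schur : (n : ℕ) → Shape → (Vec ℕ n → ℤ) → ℤ
  schur n s G = ssytSum n s (λ u v w → G (weight₃ u v w))

  schur-cong : ∀ n s {G G' : Vec ℕ n → ℤ} → (∀ α → G α ≡ G' α) → schur n s G ≡ schur n s G'
  schur-cong n s h = ssytSum-cong n s (λ u v w → h (weight₃ u v w))

≽-∣∣ : ∀ {a b c a' b' c'} → (a , b , c) ≽ (a' , b' , c') →
  (a ∸ a') + ((b ∸ b') + ((c ∸ c') + 0)) ≡ (a + b + c) ∸ (a' + b' + c')
≽-∣∣ {a} {b} {c} {a'} {b'} {c'} ((p , _) , (q , _) , r) = sym (begin
  (a + b + c) ∸ (a' + b' + c')
    ≡⟨ cong (_∸ (a' + b' + c')) (cong₂ _+_ (cong₂ _+_ (ℕ.m+[n∸m]≡n p) (ℕ.m+[n∸m]≡n q)) (ℕ.m+[n∸m]≡n r)) ⟨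
  ((a' + (a ∸ a')) + (b' + (b ∸ b')) + (c' + (c ∸ c'))) ∸ (a' + b' + c')
    ≡⟨ cong (_∸ (a' + b' + c')) (shuffle a' (a ∸ a') b' (b ∸ b') c' (c ∸ c')) ⟩
  (a' + b' + c') + ((a ∸ a') + ((b ∸ b') + ((c ∸ c') + 0))) ∸ (a' + b' + c')
    ≡⟨ ℕ.m+n∸m≡n (a' + b' + c') _ ⟩
  (a ∸ a') + ((b ∸ b') + ((c ∸ c') + 0)) ∎)
  where
  shuffle : ∀ x x' y y' z z' → (x + x') + (y + y') + (z + z') ≡ (x + y + z) + (x' + (y' + (z' + 0)))
  shuffle = ℕSolver.solve-∀

opaque
  unfolding schur

  schur-suc : ∀ n B a b c → a < B → b < B → c < B → (G : Vec ℕ (suc n) → ℤ) →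
    schur (suc n) (a , b , c) G ≡
    ∑ (box B) (λ t → ⟦ (a , b , c) ≽? t ⟧ · schur n t (λ α → G (α ∷ʳ (a + b + c ∸ ∣ t ∣))))
  schur-suc n B a b c a<B b<B c<B G = trans (ssytSum-suc n B a b c a<B b<B c<B _)
    (∑-cong (box B) (λ { t@(a' , b' , c') → ⟦⟧-*-congʳ ((a , b , c) ≽? t) (λ p → ssytSum-cong n t (λ u v w →
      cong G (trans (weight₃-extend u v w (a ∸ a') (b ∸ b') (c ∸ c')) (cong (weight₃ u v w ∷ʳ_) (≽-∣∣ p))))) }))

  schur-zero : ∀ s (G : Vec ℕ 0 → ℤ) → schur 0 s G ≡ [ ∣ s ∣ ≡ᵇ 0 ]ᵇ · G []
  schur-zero s G = ssytSum-zero s _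

-- Monomials of h_k and induction on the number of variables

∑-triangle-swap : ∀ k (f : ℕ → ℕ → ℤ) →
  ∑< (suc k) (λ i → ∑< (suc (k ∸ i)) (f i)) ≡ ∑< (suc k) (λ j → ∑< (suc (k ∸ j)) (λ i → f i j))
∑-triangle-swap k f = begin
  ∑< (suc k) (λ i → ∑< (suc (k ∸ i)) (f i))
    ≡⟨ ∑<-cong (suc k) (λ i i< → square i i< (f i)) ⟩
  ∑< (suc k) (λ i → ∑< (suc k) (λ j → ⟦ i + j ≤? k ⟧ · f i j))
    ≡⟨ ∑-swap (upTo (suc k)) (upTo (suc k)) _ ⟩
  ∑< (suc k) (λ j → ∑< (suc k) (λ i → ⟦ i + j ≤? k ⟧ · f i j))
    ≡⟨ ∑-cong (upTo (suc k)) (λ j → ∑-cong (upTo (suc k)) (λ i → cong (λ z → ⟦ z ≤? k ⟧ · f i j) (ℕ.+-comm i j))) ⟩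
  ∑< (suc k) (λ j → ∑< (suc k) (λ i → ⟦ j + i ≤? k ⟧ · f i j))
    ≡⟨ ∑<-cong (suc k) (λ j j< → sym (square j j< (λ i → f i j))) ⟩
  ∑< (suc k) (λ j → ∑< (suc (k ∸ j)) (λ i → f i j)) ∎
  where
  square : ∀ i → i < suc k → (g : ℕ → ℤ) → ∑< (suc (k ∸ i)) g ≡ ∑< (suc k) (λ j → ⟦ i + j ≤? k ⟧ · g j)
  square i (s≤s i≤k) g = trans (∑<-extend (suc k) (k ∸ i) g (s≤s (ℕ.m∸n≤m k i)))
    (∑-cong (upTo (suc k)) (λ j → cong (_· g j) (⟦⟧-⇔ (j ≤? k ∸ i) (i + j ≤? k)
      (λ p → subst (i + j ≤_) (ℕ.m+[n∸m]≡n i≤k) (ℕ.+-monoʳ-≤ i p))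
      (λ p → subst (_≤ k ∸ i) (ℕ.m+n∸m≡n i j) (ℕ.∸-monoˡ-≤ i p)))))

∑-monomials-∷ : ∀ n k (G : Vec ℕ (suc n) → ℤ) →
  ∑ (monomials (suc n) k) G ≡ ∑< (suc k) (λ i → ∑ (monomials n (k ∸ i)) (λ β → G (i ∷ β)))
∑-monomials-∷ n k G = trans (∑-concatMap _ (upTo (suc k)) G)
  (∑-cong (upTo (suc k)) (λ i → ∑-map (i ∷_) (monomials n (k ∸ i)) G))

-- `monomials` splits off the first exponent, whereas removing the largest letter of a tableau
-- splits off the last one; this reconciles the two recursions.
∑-monomials-∷ʳ : ∀ n k (G : Vec ℕ (suc n) → ℤ) →
  ∑ (monomials (suc n) k) G ≡ ∑< (suc k) (λ i → ∑ (monomials n (k ∸ i)) (λ β → G (β ∷ʳ i)))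
∑-monomials-∷ʳ zero k G = trans (∑-monomials-∷ zero k G)
  (∑-cong (upTo (suc k)) (λ i → ∑-cong (monomials zero (k ∸ i)) (λ { [] → refl })))
∑-monomials-∷ʳ (suc n) k G = begin
  ∑ (monomials (suc (suc n)) k) G ≡⟨ ∑-monomials-∷ (suc n) k G ⟩
  ∑< (suc k) (λ i → ∑ (monomials (suc n) (k ∸ i)) (λ β → G (i ∷ β)))
    ≡⟨ ∑-cong (upTo (suc k)) (λ i → ∑-monomials-∷ʳ n (k ∸ i) (λ β → G (i ∷ β))) ⟩
  ∑< (suc k) (λ i → ∑< (suc (k ∸ i)) (λ j → ∑ (monomials n (k ∸ i ∸ j)) (λ β → G (i ∷ (β ∷ʳ j)))))
    ≡⟨ ∑-triangle-swap k _ ⟩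
  ∑< (suc k) (λ j → ∑< (suc (k ∸ j)) (λ i → ∑ (monomials n (k ∸ i ∸ j)) (λ β → G (i ∷ (β ∷ʳ j)))))
    ≡⟨ ∑-cong (upTo (suc k)) (λ j → ∑-cong (upTo (suc (k ∸ j))) (λ i →
         cong (λ z → ∑ (monomials n z) (λ β → G (i ∷ (β ∷ʳ j)))) (∸-swap i j))) ⟩
  ∑< (suc k) (λ j → ∑< (suc (k ∸ j)) (λ i → ∑ (monomials n (k ∸ j ∸ i)) (λ β → G (i ∷ (β ∷ʳ j)))))
    ≡⟨ ∑-cong (upTo (suc k)) (λ j → sym (∑-monomials-∷ n (k ∸ j) (λ β → G (β ∷ʳ j)))) ⟩
  _ ∎
  where
  ∸-swap : ∀ i j → k ∸ i ∸ j ≡ k ∸ j ∸ i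
  ∸-swap i j = trans (ℕ.∸-+-assoc k i j) (trans (cong (k ∸_) (ℕ.+-comm i j)) (sym (ℕ.∸-+-assoc k j i)))

∑-box-rot : ∀ B (f : Shape → ℤ) → ∑ (box B) f ≡ ∑< B (λ b → ∑< B (λ c → ∑< B (λ a → f (a , b , c))))
∑-box-rot B f = trans (∑-box B f) (trans (∑-swap (upTo B) (upTo B) _)
  (∑-cong (upTo B) (λ b → ∑-swap (upTo B) (upTo B) (λ a c → f (a , b , c)))))

∑-box-collapse : ∀ B {P : Shape → Set} {Q : Set} (P? : ∀ s → Dec (P s)) (q? : Dec Q) a₀ b₀ c₀ (f : Shape → ℤ) →
  (∀ s → P s → s ≡ (a₀ , b₀ , c₀) × Q) → (Q → P (a₀ , b₀ , c₀)) → (Q → a₀ < B × b₀ < B × c₀ < B) →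
  ∑ (box B) (λ s → ⟦ P? s ⟧ · f s) ≡ ⟦ q? ⟧ · f (a₀ , b₀ , c₀)
∑-box-collapse B {P} {Q} P? q? a₀ b₀ c₀ f h₁ h₂ h₃ = begin
  _ ≡⟨ ∑-box B _ ⟩
  ∑< B (λ a → ∑< B (λ b → ∑< B (λ c → ⟦ P? (a , b , c) ⟧ · f (a , b , c))))
    ≡⟨ ∑-cong (upTo B) (λ a → ∑-cong (upTo B) (λ b → ∑<-collapse B (λ c → P? (a , b , c)) (q? ×-dec ((a ≟ a₀) ×-dec (b ≟ b₀))) c₀ (λ c → f (a , b , c))
         (λ c _ p → case₁ (h₁ (a , b , c) p)) (λ { (q , refl , refl) → h₂ q }) (λ (q , _) → proj₂ (proj₂ (h₃ q))))) ⟩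
  ∑< B (λ a → ∑< B (λ b → ⟦ q? ×-dec ((a ≟ a₀) ×-dec (b ≟ b₀)) ⟧ · f (a , b , c₀)))
    ≡⟨ ∑-cong (upTo B) (λ a → ∑<-collapse B (λ b → q? ×-dec ((a ≟ a₀) ×-dec (b ≟ b₀))) (q? ×-dec (a ≟ a₀)) b₀ (λ b → f (a , b , c₀))
         (λ { b _ (q , e , e') → e' , q , e }) (λ { (q , e) → q , e , refl }) (λ (q , _) → proj₁ (proj₂ (h₃ q)))) ⟩
  ∑< B (λ a → ⟦ q? ×-dec (a ≟ a₀) ⟧ · f (a , b₀ , c₀))
    ≡⟨ ∑<-collapse B (λ a → q? ×-dec (a ≟ a₀)) q? a₀ (λ a → f (a , b₀ , c₀)) (λ { a _ (q , e) → e , q }) (λ q → q , refl) (λ q → proj₁ (h₃ q)) ⟩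
  _ ∎
  where
  case₁ : ∀ {a b c} → (a , b , c) ≡ (a₀ , b₀ , c₀) × Q → c ≡ c₀ × (Q × (a ≡ a₀ × b ≡ b₀))
  case₁ (refl , q) = refl , q , refl , refl

+0+0 : ∀ m → m + 0 + 0 ≡ m
+0+0 m = trans (ℕ.+-identityʳ (m + 0)) (ℕ.+-identityʳ m)

∣∣≡0⇒≡ : ∀ a b c → a + b + c ≡ 0 → (a , b , c) ≡ (0 , 0 , 0)
∣∣≡0⇒≡ zero zero zero _ = refl

∑-box-empty : ∀ B (f : Shape → ℤ) → 0 < B → ∑ (box B) (λ s → ⟦ ∣ s ∣ ≟ 0 ⟧ · f s) ≡ f (0 , 0 , 0)
∑-box-empty B f 0<B = trans
  (∑-box-collapse B (λ s → ∣ s ∣ ≟ 0) (0 ≟ 0) 0 0 0 f (λ (a , b , c) e → ∣∣≡0⇒≡ a b c e , refl) (λ _ → refl) (λ _ → 0<B , 0<B , 0<B))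
  (ℤ.*-identityˡ (f (0 , 0 , 0)))

∑-monomials-00 : ∀ (f : Vec ℕ 0 → ℤ) → ∑ (monomials 0 0) f ≡ f []
∑-monomials-00 f = ∑-singleton [] f

∑-schur-zero : ∀ B m → m < B → ∀ (c : Shape → ℤ) (G : Vec ℕ 0 → ℤ) →
  ∑ (box B) (λ s → ⟦ ∣ s ∣ ≟ m ⟧ · (c s · schur 0 s G)) ≡ [ m ≡ᵇ 0 ]ᵇ · (c (0 , 0 , 0) · G [])
∑-schur-zero B zero    lt c G = trans (∑-box-empty B _ lt) (trans
  (cong (c (0 , 0 , 0) ·_) (trans (schur-zero (0 , 0 , 0) G) (ℤ.*-identityˡ (G []))))
  (sym (ℤ.*-identityˡ (c (0 , 0 , 0) · G []))))
∑-schur-zero B (suc m) lt c G = ∑-0 (box B) (λ s → trans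
  (⟦⟧-*-congʳ (∣ s ∣ ≟ suc m) {y = 0ℤ} (λ e → trans (cong (c s ·_) (trans (schur-zero s G)
    (cong (λ z → [ z ≡ᵇ 0 ]ᵇ · G []) e))) (ℤ.*-zeroʳ (c s))))
  (ℤ.*-zeroʳ ⟦ ∣ s ∣ ≟ suc m ⟧))

swap-∸ : ∀ d k i s → i ≤ k → s ≡ d * (k ∸ i) → d * i ≡ d * k ∸ s
swap-∸ d k i s i≤k refl = sym (begin
  d * k ∸ d * (k ∸ i) ≡⟨ ℕ.*-distribˡ-∸ d k (k ∸ i) ⟨
  d * (k ∸ (k ∸ i)) ≡⟨ cong (d *_) (ℕ.m∸[m∸n]≡n i≤k) ⟩
  d * i ∎)

<B-∣∣ : ∀ B a b c m → a + b + c ≡ m → m < B → a < B × b < B × c < B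
<B-∣∣ B a b c m refl m<B =
    ℕ.≤-<-trans (ℕ.≤-trans (ℕ.m≤m+n a b) (ℕ.m≤m+n (a + b) c)) m<B
  , ℕ.≤-<-trans (ℕ.≤-trans (ℕ.m≤n+m b a) (ℕ.m≤m+n (a + b) c)) m<B
  , ℕ.≤-<-trans (ℕ.m≤n+m c (a + b)) m<B

schur-branching : ∀ n B m → m < B → ∀ s → ∣ s ∣ ≡ m → (G : Vec ℕ (suc n) → ℤ) →
  schur (suc n) s G ≡ ∑ (box B) (λ t → ⟦ s ≽? t ⟧ · schur n t (λ α → G (α ∷ʳ (m ∸ ∣ t ∣))))
schur-branching n B m m<B s@(a , b , c) refl G =
  let (l₁ , l₂ , l₃) = <B-∣∣ B a b c m refl m<B in schur-suc n B a b c l₁ l₂ l₃ G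

-- If the coefficients c are compatible with branching, then ∑_{|s| = dk} c(s) s_s
-- and p_d[h_k] satisfy the same recursion in the number of variables.
module PowerSum (B d' : ℕ) (c : Shape → ℤ) (c-∅ : c (0 , 0 , 0) ≡ 1ℤ) where

  d : ℕ
  d = suc d'

  -- The right side reflects that p_d[h_k] in n + 1 variables is the sum over i of p_d[h_(k-i)] in n
  -- variables times the power d i of the last variable: a shape t is met once for every i with |t|
  -- = d (k - i).
  Compatible : Set
  Compatible = ∀ t k → d * k < B →
    ∑ (box B) (λ s → ⟦ ∣ s ∣ ≟ d * k ⟧ · (⟦ s ≽? t ⟧ · c s)) ≡
    ∑< (suc k) (λ i → ⟦ ∣ t ∣ ≟ d * (k ∸ i) ⟧) · c t

  expansion : Compatible → ∀ n k → d * k < B → ∀ (G : Vec ℕ n → ℤ) →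
    ∑ (monomials n k) (λ β → G (Vec.map (d *_) β)) ≡
    ∑ (box B) (λ s → ⟦ ∣ s ∣ ≟ d * k ⟧ · (c s · schur n s G))
  expansion H zero zero lt G = begin
    ∑ (monomials 0 0) (λ β → G (Vec.map (d *_) β)) ≡⟨ ∑-monomials-00 _ ⟩
    G [] ≡⟨ trans (ℤ.*-identityˡ (1ℤ · G [])) (ℤ.*-identityˡ (G [])) ⟨
    1ℤ · (1ℤ · G []) ≡⟨ cong₂ (λ x y → [ x ≡ᵇ 0 ]ᵇ · (y · G [])) (ℕ.*-zeroʳ d) c-∅ ⟨
    [ d * 0 ≡ᵇ 0 ]ᵇ · (c (0 , 0 , 0) · G []) ≡⟨ ∑-schur-zero B (d * 0) lt c G ⟨
    _ ∎
  expansion H zero (suc k) lt G = trans (∑-[] _) (sym (∑-schur-zero B (d * suc k) lt c G))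
  expansion H (suc n) k lt G = begin
    ∑ (monomials (suc n) k) (λ β → G (Vec.map (d *_) β)) ≡⟨ ∑-monomials-∷ʳ n k _ ⟩
    ∑< (suc k) (λ i → ∑ (monomials n (k ∸ i)) (λ β → G (Vec.map (d *_) (β ∷ʳ i))))
      ≡⟨ ∑-cong (upTo (suc k)) (λ i → trans (∑-cong (monomials n (k ∸ i)) (λ β → cong G (Vec.map-∷ʳ (d *_) i β)))
           (expansion H n (k ∸ i) (ℕ.≤-<-trans (ℕ.*-monoʳ-≤ d (ℕ.m∸n≤m k i)) lt) (λ α → G (α ∷ʳ (d * i))))) ⟩
    ∑< (suc k) (λ i → ∑ (box B) (λ t → ⟦ ∣ t ∣ ≟ d * (k ∸ i) ⟧ · (c t · schur n t (λ α → G (α ∷ʳ (d * i))))))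
      -- Where the bracket is nonzero, the exponent d i of the last variable equals d k ∸ ∣ t ∣, so
      -- the Schur factor no longer depends on i and the sum over i becomes a mere count.
      ≡⟨ ∑<-cong (suc k) (λ { i (s≤s i≤k) → ∑-cong (box B) (λ t → ⟦⟧-*-congʳ (∣ t ∣ ≟ d * (k ∸ i)) (λ e →
           cong (c t ·_) (schur-cong n t (λ α → cong (λ z → G (α ∷ʳ z)) (swap-∸ d k i ∣ t ∣ i≤k e))))) }) ⟩
    ∑< (suc k) (λ i → ∑ (box B) (λ t → ⟦ ∣ t ∣ ≟ d * (k ∸ i) ⟧ · (c t · Φ t)))
      ≡⟨ ∑-swap (upTo (suc k)) (box B) _ ⟩
    ∑ (box B) (λ t → ∑< (suc k) (λ i → ⟦ ∣ t ∣ ≟ d * (k ∸ i) ⟧ · (c t · Φ t)))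
      ≡⟨ ∑-cong (box B) (λ t → trans (sym (∑-*ʳ (upTo (suc k)) (λ i → ⟦ ∣ t ∣ ≟ d * (k ∸ i) ⟧) (c t · Φ t)))
           (sym (ℤ.*-assoc (∑< (suc k) (λ i → ⟦ ∣ t ∣ ≟ d * (k ∸ i) ⟧)) (c t) (Φ t)))) ⟩
    ∑ (box B) (λ t → (∑< (suc k) (λ i → ⟦ ∣ t ∣ ≟ d * (k ∸ i) ⟧) · c t) · Φ t)
      ≡⟨ ∑-cong (box B) (λ t → cong (_· Φ t) (H t k lt)) ⟨
    ∑ (box B) (λ t → ∑ (box B) (λ s → ⟦ ∣ s ∣ ≟ d * k ⟧ · (⟦ s ≽? t ⟧ · c s)) · Φ t)
      ≡⟨ ∑-cong (box B) (λ t → ∑-*ʳ (box B) _ (Φ t)) ⟩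
    ∑ (box B) (λ t → ∑ (box B) (λ s → (⟦ ∣ s ∣ ≟ d * k ⟧ · (⟦ s ≽? t ⟧ · c s)) · Φ t))
      ≡⟨ ∑-swap (box B) (box B) _ ⟩
    ∑ (box B) (λ s → ∑ (box B) (λ t → (⟦ ∣ s ∣ ≟ d * k ⟧ · (⟦ s ≽? t ⟧ · c s)) · Φ t))
      ≡⟨ ∑-cong (box B) (λ s → trans (∑-cong (box B) (λ t → shuffle ⟦ ∣ s ∣ ≟ d * k ⟧ ⟦ s ≽? t ⟧ (c s) (Φ t)))
           (trans (sym (∑-*ˡ (box B) ⟦ ∣ s ∣ ≟ d * k ⟧ _)) (cong (⟦ ∣ s ∣ ≟ d * k ⟧ ·_) (sym (∑-*ˡ (box B) (c s) _))))) ⟩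
    ∑ (box B) (λ s → ⟦ ∣ s ∣ ≟ d * k ⟧ · (c s · ∑ (box B) (λ t → ⟦ s ≽? t ⟧ · Φ t)))
      ≡⟨ ∑-cong (box B) (λ s → ⟦⟧-*-congʳ (∣ s ∣ ≟ d * k) (λ e → cong (c s ·_) (sym (schur-branching n B (d * k) lt s e G)))) ⟩
    _ ∎
    where
    Φ : Shape → ℤ
    Φ t = schur n t (λ α → G (α ∷ʳ (d * k ∸ ∣ t ∣)))
    shuffle : ∀ p q r x → (p · (q · r)) · x ≡ p · (r · (q · x))
    shuffle = ℤSolver.solve-∀

-- Fomin's local rule and the Pieri rule

≤-balance : ∀ {P Q R T} → R + Q ≡ P + T → P ≤ Q → R ≤ T
≤-balance {P} {Q} {R} {T} e p≤q =
  ℕ.+-cancelʳ-≤ Q R T (subst₂ _≤_ (sym e) (ℕ.+-comm Q T) (ℕ.+-monoˡ-≤ T p≤q))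

⊓+⊔ : ∀ m n → (m ⊓ n) + (m ⊔ n) ≡ m + n
⊓+⊔ m n with ℕ.≤-total m n
... | inj₁ m≤n = cong₂ _+_ (ℕ.m≤n⇒m⊓n≡m m≤n) (ℕ.m≤n⇒m⊔n≡n m≤n)
... | inj₂ n≤m = trans (cong₂ _+_ (ℕ.m≥n⇒m⊓n≡n n≤m) (ℕ.m≥n⇒m⊔n≡m n≤m)) (ℕ.+-comm n m)

_∈[_,_]? : ∀ i lo hi → Dec (lo ≤ i × i ≤ hi)
i ∈[ lo , hi ]? = (lo ≤? i) ×-dec (i ≤? hi)

-- Fomin's local rule: for fixed shapes μ, κ the shapes ν below both and the shapes λ above both
-- correspond by reflecting ν₁ ↔ λ₂ and ν₂ ↔ λ₃ in the common intervals
-- [κ₂ ⊔ μ₂ , κ₁ ⊓ μ₁] and [κ₃ , κ₂ ⊓ μ₂]; the length of λ₁ absorbs the remaining boxes.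
module LocalRule (B μ₁ μ₂ c : ℕ) (m<B : μ₁ + μ₂ + c < B) (κ₁ κ₂ κ₃ : ℕ) where

  μ κ : Shape
  μ = μ₁ , μ₂ , 0
  κ = κ₁ , κ₂ , κ₃

  lo₁ hi₁ lo₂ hi₂ : ℕ
  lo₁ = κ₂ ⊔ μ₂
  hi₁ = κ₁ ⊓ μ₁
  lo₂ = κ₃
  hi₂ = κ₂ ⊓ μ₂

  μ₁<B : μ₁ < B
  μ₁<B = proj₁ (<B-∣∣ B μ₁ μ₂ c _ refl m<B)

  hi₁<B : hi₁ < B
  hi₁<B = ℕ.≤-<-trans (ℕ.m⊓n≤n κ₁ μ₁) μ₁<B

  hi₂<B : hi₂ < B
  hi₂<B = ℕ.≤-<-trans (ℕ.m⊓n≤n κ₂ μ₂) (proj₁ (proj₂ (<B-∣∣ B μ₁ μ₂ c _ refl m<B)))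

  -- Since μ has two rows, ν = (x , y , 0). The sizes determine i, which exists when |κ| exceeds |ν|
  -- by at most c.
  below : ∑ (box B) (λ ν → ∑< (suc c) (λ i → ⟦ μ ≽? ν ⟧ · (⟦ ∣ κ ∣ ≟ ∣ ν ∣ + (c ∸ i) ⟧ · ⟦ κ ≽? ν ⟧))) ≡
    ∑< B (λ x → ⟦ x ∈[ lo₁ , hi₁ ]? ⟧ · ∑< B (λ y → ⟦ y ∈[ lo₂ , hi₂ ]? ⟧ · ⟦ κ₁ + κ₂ + κ₃ ≤? x + y + c ⟧))
  below = begin
    _ ≡⟨ ∑-cong (box B) sum-i ⟩
    ∑ (box B) (λ ν → ⟦ (μ ≽? ν) ×-dec (κ ≽? ν) ⟧ · ⟦ ∣ κ ∣ ≤? ∣ ν ∣ + c ⟧) ≡⟨ ∑-box B _ ⟩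
    _ ≡⟨ ∑-cong (upTo B) (λ x → trans (∑-cong (upTo B) (λ y → trans (sum-z x y)
           (ℤ.*-assoc ⟦ x ∈[ lo₁ , hi₁ ]? ⟧ ⟦ y ∈[ lo₂ , hi₂ ]? ⟧ _)))
           (sym (∑-*ˡ (upTo B) ⟦ x ∈[ lo₁ , hi₁ ]? ⟧ _))) ⟩
    _ ∎
    where
    ≽-∣∣-≤ : ∀ {ν} → κ ≽ ν → ∣ ν ∣ ≤ ∣ κ ∣
    ≽-∣∣-≤ ((p , _) , (q , _) , r) = ℕ.+-mono-≤ (ℕ.+-mono-≤ p q) r
    shuffle : ∀ p q r → p · (q · r) ≡ (p · r) · q
    shuffle = ℤSolver.solve-∀
    one : ∀ ν → κ ≽ ν → ∑< (suc c) (λ i → ⟦ ∣ κ ∣ ≟ ∣ ν ∣ + (c ∸ i) ⟧) ≡ ⟦ ∣ κ ∣ ≤? ∣ ν ∣ + c ⟧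
    one ν κ≽ν = begin
      ∑< (suc c) (λ i → ⟦ ∣ κ ∣ ≟ ∣ ν ∣ + (c ∸ i) ⟧) ≡⟨ ∑<-reverse c (λ i → ⟦ ∣ κ ∣ ≟ ∣ ν ∣ + (c ∸ i) ⟧) ⟩
      ∑< (suc c) (λ i → ⟦ ∣ κ ∣ ≟ ∣ ν ∣ + (c ∸ (c ∸ i)) ⟧)
        ≡⟨ ∑<-cong (suc c) (λ { i (s≤s i≤c) → trans (cong (λ z → ⟦ ∣ κ ∣ ≟ ∣ ν ∣ + z ⟧) (ℕ.m∸[m∸n]≡n i≤c)) (sym (ℤ.*-identityʳ ⟦ ∣ κ ∣ ≟ ∣ ν ∣ + i ⟧)) }) ⟩
      ∑< (suc c) (λ i → ⟦ ∣ κ ∣ ≟ ∣ ν ∣ + i ⟧ · 1ℤ)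
        ≡⟨ ∑<-collapse (suc c) (λ i → ∣ κ ∣ ≟ ∣ ν ∣ + i) (∣ κ ∣ ≤? ∣ ν ∣ + c) (∣ κ ∣ ∸ ∣ ν ∣) (λ _ → 1ℤ)
             (λ { i (s≤s i≤c) e → sym (trans (cong (_∸ ∣ ν ∣) e) (ℕ.m+n∸m≡n ∣ ν ∣ i))
                    , subst (_≤ ∣ ν ∣ + c) (sym e) (ℕ.+-monoʳ-≤ ∣ ν ∣ i≤c) })
             (λ _ → sym (ℕ.m+[n∸m]≡n (≽-∣∣-≤ κ≽ν)))
             (λ p → s≤s (subst (∣ κ ∣ ∸ ∣ ν ∣ ≤_) (ℕ.m+n∸m≡n ∣ ν ∣ c) (ℕ.∸-monoˡ-≤ ∣ ν ∣ p))) ⟩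
      ⟦ ∣ κ ∣ ≤? ∣ ν ∣ + c ⟧ · 1ℤ ≡⟨ ℤ.*-identityʳ _ ⟩
      _ ∎
    sum-i : ∀ ν → ∑< (suc c) (λ i → ⟦ μ ≽? ν ⟧ · (⟦ ∣ κ ∣ ≟ ∣ ν ∣ + (c ∸ i) ⟧ · ⟦ κ ≽? ν ⟧)) ≡
      ⟦ (μ ≽? ν) ×-dec (κ ≽? ν) ⟧ · ⟦ ∣ κ ∣ ≤? ∣ ν ∣ + c ⟧
    sum-i ν = begin
      _ ≡⟨ ∑-cong (upTo (suc c)) (λ i → trans (shuffle ⟦ μ ≽? ν ⟧ _ ⟦ κ ≽? ν ⟧)
             (cong (_· ⟦ ∣ κ ∣ ≟ ∣ ν ∣ + (c ∸ i) ⟧) (sym (⟦⟧-× (μ ≽? ν) (κ ≽? ν))))) ⟩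
      _ ≡⟨ ∑-*ˡ (upTo (suc c)) ⟦ (μ ≽? ν) ×-dec (κ ≽? ν) ⟧ _ ⟨
      ⟦ (μ ≽? ν) ×-dec (κ ≽? ν) ⟧ · ∑< (suc c) (λ i → ⟦ ∣ κ ∣ ≟ ∣ ν ∣ + (c ∸ i) ⟧)
        ≡⟨ ⟦⟧-*-congʳ ((μ ≽? ν) ×-dec (κ ≽? ν)) (λ (_ , p) → one ν p) ⟩
      _ ∎
    sum-z : ∀ x y → ∑< B (λ z → ⟦ (μ ≽? (x , y , z)) ×-dec (κ ≽? (x , y , z)) ⟧ · ⟦ ∣ κ ∣ ≤? x + y + z + c ⟧) ≡
      (⟦ x ∈[ lo₁ , hi₁ ]? ⟧ · ⟦ y ∈[ lo₂ , hi₂ ]? ⟧) · ⟦ κ₁ + κ₂ + κ₃ ≤? x + y + c ⟧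
    sum-z x y = trans
      (∑<-collapse B (λ z → (μ ≽? (x , y , z)) ×-dec (κ ≽? (x , y , z))) ((x ∈[ lo₁ , hi₁ ]?) ×-dec (y ∈[ lo₂ , hi₂ ]?)) 0 (λ z → ⟦ ∣ κ ∣ ≤? x + y + z + c ⟧)
        (λ { z _ (((p₁ , p₂) , (p₃ , _) , p₄) , ((q₁ , q₂) , (q₃ , q₄) , _)) →
               ℕ.n≤0⇒n≡0 p₄ , (ℕ.⊔-lub q₂ p₂ , ℕ.⊓-glb q₁ p₁) , (q₄ , ℕ.⊓-glb q₃ p₃) })
        (λ ((p , q) , (r , s)) →
           ((ℕ.≤-trans q (ℕ.m⊓n≤n κ₁ μ₁) , ℕ.≤-trans (ℕ.m≤n⊔m κ₂ μ₂) p) , (ℕ.≤-trans s (ℕ.m⊓n≤n κ₂ μ₂) , z≤n) , z≤n)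
           , ((ℕ.≤-trans q (ℕ.m⊓n≤m κ₁ μ₁) , ℕ.≤-trans (ℕ.m≤m⊔n κ₂ μ₂) p) , (ℕ.≤-trans s (ℕ.m⊓n≤m κ₂ μ₂) , r) , z≤n))
        (λ _ → ℕ.≤-<-trans z≤n m<B))
      (cong₂ _·_ (⟦⟧-× (x ∈[ lo₁ , hi₁ ]?) (y ∈[ lo₂ , hi₂ ]?)) (cong (λ z → ⟦ ∣ κ ∣ ≤? z + c ⟧) (ℕ.+-identityʳ (x + y))))

  -- Here s = (z , x , y). The size determines z, and its lower bound κ₁ ⊔ μ₁ turns into an upper
  -- bound for x + y; the intervals for x and y are those of `below`.
  above : ∑ (box B) (λ s → ⟦ ∣ s ∣ ≟ μ₁ + μ₂ + c ⟧ · (⟦ s ≽? μ ⟧ · ⟦ s ≽? κ ⟧)) ≡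
    ∑< B (λ x → ⟦ x ∈[ lo₁ , hi₁ ]? ⟧ · ∑< B (λ y → ⟦ y ∈[ lo₂ , hi₂ ]? ⟧ · ⟦ x + y + (κ₁ ⊔ μ₁) ≤? μ₁ + μ₂ + c ⟧))
  above = begin
    _ ≡⟨ ∑-box-rot B _ ⟩
    _ ≡⟨ ∑-cong (upTo B) (λ x → trans (∑-cong (upTo B) (λ y → trans (first x y)
           (ℤ.*-assoc ⟦ x ∈[ lo₁ , hi₁ ]? ⟧ ⟦ y ∈[ lo₂ , hi₂ ]? ⟧ _)))
           (sym (∑-*ˡ (upTo B) ⟦ x ∈[ lo₁ , hi₁ ]? ⟧ _))) ⟩
    _ ∎
    where
    all? : ∀ x y z → Dec (z + x + y ≡ μ₁ + μ₂ + c × (z , x , y) ≽ μ × (z , x , y) ≽ κ)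
    all? x y z = (z + x + y ≟ μ₁ + μ₂ + c) ×-dec (((z , x , y) ≽? μ) ×-dec ((z , x , y) ≽? κ))
    rot : ∀ x y z → x + y + z ≡ z + x + y
    rot = ℕSolver.solve-∀
    first : ∀ x y → ∑< B (λ z → ⟦ z + x + y ≟ μ₁ + μ₂ + c ⟧ · (⟦ (z , x , y) ≽? μ ⟧ · ⟦ (z , x , y) ≽? κ ⟧)) ≡
      (⟦ x ∈[ lo₁ , hi₁ ]? ⟧ · ⟦ y ∈[ lo₂ , hi₂ ]? ⟧) · ⟦ x + y + (κ₁ ⊔ μ₁) ≤? μ₁ + μ₂ + c ⟧
    first x y = begin
      _ ≡⟨ ∑-cong (upTo B) (λ z → trans (sym (trans (⟦⟧-× (z + x + y ≟ μ₁ + μ₂ + c) (((z , x , y) ≽? μ) ×-dec ((z , x , y) ≽? κ)))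
             (cong (⟦ z + x + y ≟ μ₁ + μ₂ + c ⟧ ·_) (⟦⟧-× ((z , x , y) ≽? μ) ((z , x , y) ≽? κ))))) (sym (ℤ.*-identityʳ _))) ⟩
      ∑< B (λ z → ⟦ all? x y z ⟧ · 1ℤ)
        ≡⟨ ∑<-collapse B (all? x y) (((x ∈[ lo₁ , hi₁ ]?) ×-dec (y ∈[ lo₂ , hi₂ ]?)) ×-dec (x + y + (κ₁ ⊔ μ₁) ≤? μ₁ + μ₂ + c))
             (μ₁ + μ₂ + c ∸ (x + y)) (λ _ → 1ℤ)
             (λ { z _ (e , ((p₁ , p₂) , (p₃ , p₄) , _) , ((q₁ , q₂) , (q₃ , q₄) , q₅)) →
                sym (trans (cong (_∸ (x + y)) (trans (sym e) (sym (rot x y z)))) (ℕ.m+n∸m≡n (x + y) z))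
                , ((ℕ.⊔-lub q₃ p₃ , ℕ.⊓-glb q₂ p₂) , (q₅ , ℕ.⊓-glb q₄ p₄))
                , subst (x + y + (κ₁ ⊔ μ₁) ≤_) (trans (rot x y z) e) (ℕ.+-monoʳ-≤ (x + y) (ℕ.⊔-lub q₁ p₁)) })
             (λ { (((p , q) , (r , s)) , t) →
                let M≤ = subst (_≤ μ₁ + μ₂ + c ∸ (x + y)) (ℕ.m+n∸m≡n (x + y) (κ₁ ⊔ μ₁)) (ℕ.∸-monoˡ-≤ (x + y) t)
                    e = ℕ.m+[n∸m]≡n (ℕ.≤-trans (ℕ.m≤m+n (x + y) (κ₁ ⊔ μ₁)) t)
                in trans (sym (rot x y _)) e
                 , ((ℕ.≤-trans (ℕ.m≤n⊔m κ₁ μ₁) M≤ , ℕ.≤-trans q (ℕ.m⊓n≤n κ₁ μ₁)) , (ℕ.≤-trans (ℕ.m≤n⊔m κ₂ μ₂) p , ℕ.≤-trans s (ℕ.m⊓n≤n κ₂ μ₂)) , z≤n)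
                 , ((ℕ.≤-trans (ℕ.m≤m⊔n κ₁ μ₁) M≤ , ℕ.≤-trans q (ℕ.m⊓n≤m κ₁ μ₁)) , (ℕ.≤-trans (ℕ.m≤m⊔n κ₂ μ₂) p , ℕ.≤-trans s (ℕ.m⊓n≤m κ₂ μ₂)) , r) })
             (λ _ → ℕ.≤-<-trans (ℕ.m∸n≤m _ (x + y)) m<B) ⟩
      _ ≡⟨ ℤ.*-identityʳ _ ⟩
      _ ≡⟨ trans (⟦⟧-× ((x ∈[ lo₁ , hi₁ ]?) ×-dec (y ∈[ lo₂ , hi₂ ]?)) (x + y + (κ₁ ⊔ μ₁) ≤? μ₁ + μ₂ + c))
             (cong (_· ⟦ x + y + (κ₁ ⊔ μ₁) ≤? μ₁ + μ₂ + c ⟧) (⟦⟧-× (x ∈[ lo₁ , hi₁ ]?) (y ∈[ lo₂ , hi₂ ]?))) ⟩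
      _ ∎

  local-rule :
    ∑ (box B) (λ ν → ∑< (suc c) (λ i → ⟦ μ ≽? ν ⟧ · (⟦ ∣ κ ∣ ≟ ∣ ν ∣ + (c ∸ i) ⟧ · ⟦ κ ≽? ν ⟧))) ≡
    ∑ (box B) (λ s → ⟦ ∣ s ∣ ≟ μ₁ + μ₂ + c ⟧ · (⟦ s ≽? μ ⟧ · ⟦ s ≽? κ ⟧))
  local-rule = begin
    _ ≡⟨ below ⟩
    ∑< B (λ x → ⟦ x ∈[ lo₁ , hi₁ ]? ⟧ · ∑< B (λ y → ⟦ y ∈[ lo₂ , hi₂ ]? ⟧ · ⟦ κ₁ + κ₂ + κ₃ ≤? x + y + c ⟧))
      ≡⟨ ∑<-reflect B lo₁ hi₁ _ hi₁<B ⟩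
    _ ≡⟨ ∑-cong (upTo B) (λ x → cong (⟦ x ∈[ lo₁ , hi₁ ]? ⟧ ·_) (∑<-reflect B lo₂ hi₂ _ hi₂<B)) ⟩
    ∑< B (λ x → ⟦ x ∈[ lo₁ , hi₁ ]? ⟧ · ∑< B (λ y → ⟦ y ∈[ lo₂ , hi₂ ]? ⟧ ·
        ⟦ κ₁ + κ₂ + κ₃ ≤? (lo₁ + hi₁ ∸ x) + (lo₂ + hi₂ ∸ y) + c ⟧))
      ≡⟨ ∑-cong (upTo B) (λ x → ⟦⟧-*-congʳ (x ∈[ lo₁ , hi₁ ]?) (λ (_ , x≤) → ∑-cong (upTo B) (λ y →
           ⟦⟧-*-congʳ (y ∈[ lo₂ , hi₂ ]?) (λ (_ , y≤) → reflected x y x≤ y≤)))) ⟩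
    _ ≡⟨ above ⟨
    _ ∎
    where
    reflected : ∀ x y → x ≤ hi₁ → y ≤ hi₂ →
      ⟦ κ₁ + κ₂ + κ₃ ≤? (lo₁ + hi₁ ∸ x) + (lo₂ + hi₂ ∸ y) + c ⟧ ≡ ⟦ x + y + (κ₁ ⊔ μ₁) ≤? μ₁ + μ₂ + c ⟧
    reflected x y x≤ y≤ = ⟦⟧-⇔ (κ₁ + κ₂ + κ₃ ≤? _) (x + y + (κ₁ ⊔ μ₁) ≤? _)
      -- The two inequalities have the same slack. In `eq` the sums lo + hi pair the minimum with
      -- the maximum of κ₂ and μ₂, and κ₁ ⊔ μ₁ completes κ₁ ⊓ μ₁.
      (≤-balance eq) (≤-balance (sym eq))
      where
      x' y' : ℕ
      x' = lo₁ + hi₁ ∸ x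
      y' = lo₂ + hi₂ ∸ y
      sh₁ : ∀ x y m x' y' c → x + y + m + (x' + y' + c) ≡ (x + x') + (y + y') + m + c
      sh₁ = ℕSolver.solve-∀
      sh₂ : ∀ l h l' h' m c → (l + h) + (l' + h') + m + c ≡ l' + (h' + l) + (h + m) + c
      sh₂ = ℕSolver.solve-∀
      sh₃ : ∀ k₁ k₂ k₃ m₁ m₂ c → k₃ + (k₂ + m₂) + (k₁ + m₁) + c ≡ k₁ + k₂ + k₃ + (m₁ + m₂ + c)
      sh₃ = ℕSolver.solve-∀
      eq : x + y + (κ₁ ⊔ μ₁) + (x' + y' + c) ≡ κ₁ + κ₂ + κ₃ + (μ₁ + μ₂ + c)
      eq = begin
        x + y + (κ₁ ⊔ μ₁) + (x' + y' + c) ≡⟨ sh₁ x y (κ₁ ⊔ μ₁) x' y' c ⟩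
        (x + x') + (y + y') + (κ₁ ⊔ μ₁) + c
          ≡⟨ cong₂ (λ p q → p + q + (κ₁ ⊔ μ₁) + c) (ℕ.m+[n∸m]≡n (ℕ.≤-trans x≤ (ℕ.m≤n+m hi₁ lo₁))) (ℕ.m+[n∸m]≡n (ℕ.≤-trans y≤ (ℕ.m≤n+m hi₂ lo₂))) ⟩
        (lo₁ + hi₁) + (lo₂ + hi₂) + (κ₁ ⊔ μ₁) + c ≡⟨ sh₂ lo₁ hi₁ lo₂ hi₂ (κ₁ ⊔ μ₁) c ⟩
        lo₂ + (hi₂ + lo₁) + (hi₁ + (κ₁ ⊔ μ₁)) + c
          ≡⟨ cong₂ (λ p q → κ₃ + p + q + c) (⊓+⊔ κ₂ μ₂) (⊓+⊔ κ₁ μ₁) ⟩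
        κ₃ + (κ₂ + μ₂) + (κ₁ + μ₁) + c ≡⟨ sh₃ κ₁ κ₂ κ₃ μ₁ μ₂ c ⟩
        κ₁ + κ₂ + κ₃ + (μ₁ + μ₂ + c) ∎

module _ (B : ℕ) where

  -- Translating the argument of the functional by γ is multiplication by x^γ, so the left side is
  -- s_μ h_c. Two rows in μ keep the product within three rows.
  pieri : ∀ n μ₁ μ₂ c → μ₁ + μ₂ + c < B → (G : Vec ℕ n → ℤ) →
    ∑ (monomials n c) (λ γ → schur n (μ₁ , μ₂ , 0) (λ α → G (α ⊕ γ))) ≡
    ∑ (box B) (λ s → ⟦ ∣ s ∣ ≟ μ₁ + μ₂ + c ⟧ · (⟦ s ≽? (μ₁ , μ₂ , 0) ⟧ · schur n s G))
  pieri zero μ₁ μ₂ zero lt G = begin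
    _ ≡⟨ ∑-monomials-00 _ ⟩
    schur 0 (μ₁ , μ₂ , 0) (λ α → G (α ⊕ [])) ≡⟨ schur-zero (μ₁ , μ₂ , 0) _ ⟩
    ⟦ μ₁ + μ₂ + 0 ≟ 0 ⟧ · G []
      ≡⟨ ⟦⟧-*-congʳ (μ₁ + μ₂ + 0 ≟ 0) (λ e → sym (⟦⟧-yes-* ((0 , 0 , 0) ≽? (μ₁ , μ₂ , 0)) (trivial (∣∣≡0⇒≡ μ₁ μ₂ 0 e)) (G []))) ⟩
    ⟦ μ₁ + μ₂ + 0 ≟ 0 ⟧ · (⟦ (0 , 0 , 0) ≽? (μ₁ , μ₂ , 0) ⟧ · G [])
      ≡⟨ ∑-schur-zero B (μ₁ + μ₂ + 0) lt (λ s → ⟦ s ≽? (μ₁ , μ₂ , 0) ⟧) G ⟨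
    _ ∎
    where
    trivial : (μ₁ , μ₂ , 0) ≡ (0 , 0 , 0) → (0 , 0 , 0) ≽ (μ₁ , μ₂ , 0)
    trivial refl = (z≤n , z≤n) , (z≤n , z≤n) , z≤n
  pieri zero μ₁ μ₂ (suc c) lt G = trans (∑-[] _) (sym (trans
    (∑-schur-zero B (μ₁ + μ₂ + suc c) lt (λ s → ⟦ s ≽? (μ₁ , μ₂ , 0) ⟧) G)
    (cong (λ z → [ z ≡ᵇ 0 ]ᵇ · (⟦ (0 , 0 , 0) ≽? (μ₁ , μ₂ , 0) ⟧ · G [])) (ℕ.+-suc (μ₁ + μ₂) c))))
  pieri (suc n) μ₁ μ₂ c lt G = begin
    ∑ (monomials (suc n) c) (λ γ → schur (suc n) μ (λ α → G (α ⊕ γ))) ≡⟨ ∑-monomials-∷ʳ n c _ ⟩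
    ∑< (suc c) (λ i → ∑ (monomials n (c ∸ i)) (λ γ → schur (suc n) μ (λ α → G (α ⊕ (γ ∷ʳ i)))))
      ≡⟨ ∑-cong (upTo (suc c)) (λ i → trans (∑-cong (monomials n (c ∸ i)) (branch i))
           (∑-∑-*ˡ (monomials n (c ∸ i)) (box B) (λ ν → ⟦ μ ≽? ν ⟧) _)) ⟩
    ∑< (suc c) (λ i → ∑ (box B) (λ ν → ⟦ μ ≽? ν ⟧ · ∑ (monomials n (c ∸ i)) (λ γ → schur n ν (λ α → Gᵢ i ν (α ⊕ γ)))))
      -- μ ≽ ν forces ν₃ = 0, so the induction hypothesis for two-row shapes applies to ν.
      ≡⟨ ∑<-cong (suc c) (λ { i (s≤s i≤c) → ∑-cong (box B) (λ { ν@(ν₁ , ν₂ , ν₃) → ⟦⟧-*-congʳ (μ ≽? ν) (hyp i i≤c ν₁ ν₂ ν₃) }) }) ⟩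
    ∑< (suc c) (λ i → ∑ (box B) (λ ν → ⟦ μ ≽? ν ⟧ ·
      ∑ (box B) (λ κ → (⟦ ∣ κ ∣ ≟ ∣ ν ∣ + (c ∸ i) ⟧ · ⟦ κ ≽? ν ⟧) · Φ κ)))
      ≡⟨ ∑-swap (upTo (suc c)) (box B) _ ⟩
    _ ≡⟨ ∑-cong (box B) (λ ν → ∑-cong (upTo (suc c)) (λ i → trans (∑-*ˡ (box B) ⟦ μ ≽? ν ⟧ _)
           (∑-cong (box B) (λ κ → sym (ℤ.*-assoc ⟦ μ ≽? ν ⟧ (⟦ ∣ κ ∣ ≟ ∣ ν ∣ + (c ∸ i) ⟧ · ⟦ κ ≽? ν ⟧) (Φ κ)))))) ⟩
    ∑ (box B) (λ ν → ∑< (suc c) (λ i → ∑ (box B) (λ κ → K κ ν i · Φ κ)))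
      ≡⟨ trans (∑-cong (box B) (λ ν → ∑-swap (upTo (suc c)) (box B) _)) (∑-swap (box B) (box B) _) ⟩
    ∑ (box B) (λ κ → ∑ (box B) (λ ν → ∑< (suc c) (λ i → K κ ν i · Φ κ)))
      ≡⟨ ∑-cong (box B) (λ κ → trans (∑-cong (box B) (λ ν → sym (∑-*ʳ (upTo (suc c)) (K κ ν) (Φ κ)))) (sym (∑-*ʳ (box B) _ (Φ κ)))) ⟩
    ∑ (box B) (λ κ → ∑ (box B) (λ ν → ∑< (suc c) (K κ ν)) · Φ κ)
      -- The shape κ is what the last variable leaves behind. The ways from μ down to ν and up to κ
      -- are exchanged for the ways from μ up to s and down to κ, which is the branching of the
      -- claimed right side.
      ≡⟨ ∑-cong (box B) (λ { κ@(κ₁ , κ₂ , κ₃) → cong (_· Φ κ) (LocalRule.local-rule B μ₁ μ₂ c lt κ₁ κ₂ κ₃) }) ⟩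
    ∑ (box B) (λ κ → ∑ (box B) (λ s → ⟦ ∣ s ∣ ≟ μ₁ + μ₂ + c ⟧ · (⟦ s ≽? μ ⟧ · ⟦ s ≽? κ ⟧)) · Φ κ)
      ≡⟨ trans (∑-cong (box B) (λ κ → ∑-*ʳ (box B) _ (Φ κ))) (∑-swap (box B) (box B) _) ⟩
    ∑ (box B) (λ s → ∑ (box B) (λ κ → (⟦ ∣ s ∣ ≟ μ₁ + μ₂ + c ⟧ · (⟦ s ≽? μ ⟧ · ⟦ s ≽? κ ⟧)) · Φ κ))
      ≡⟨ ∑-cong (box B) (λ s → trans (∑-cong (box B) (λ κ → shuffle ⟦ ∣ s ∣ ≟ μ₁ + μ₂ + c ⟧ ⟦ s ≽? μ ⟧ ⟦ s ≽? κ ⟧ (Φ κ)))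
           (trans (sym (∑-*ˡ (box B) ⟦ ∣ s ∣ ≟ μ₁ + μ₂ + c ⟧ _)) (cong (⟦ ∣ s ∣ ≟ μ₁ + μ₂ + c ⟧ ·_) (sym (∑-*ˡ (box B) ⟦ s ≽? μ ⟧ _))))) ⟩
    ∑ (box B) (λ s → ⟦ ∣ s ∣ ≟ μ₁ + μ₂ + c ⟧ · (⟦ s ≽? μ ⟧ · ∑ (box B) (λ κ → ⟦ s ≽? κ ⟧ · Φ κ)))
      ≡⟨ ∑-cong (box B) (λ s → ⟦⟧-*-congʳ (∣ s ∣ ≟ μ₁ + μ₂ + c) (λ e → cong (⟦ s ≽? μ ⟧ ·_)
           (sym (schur-branching n B (μ₁ + μ₂ + c) lt s e G)))) ⟩
    _ ∎
    where
    μ : Shape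
    μ = μ₁ , μ₂ , 0
    Φ : Shape → ℤ
    Φ κ = schur n κ (λ α → G (α ∷ʳ (μ₁ + μ₂ + c ∸ ∣ κ ∣)))
    K : Shape → Shape → ℕ → ℤ
    K κ ν i = ⟦ μ ≽? ν ⟧ · (⟦ ∣ κ ∣ ≟ ∣ ν ∣ + (c ∸ i) ⟧ · ⟦ κ ≽? ν ⟧)
    Gᵢ : ℕ → Shape → Vec ℕ n → ℤ
    Gᵢ i ν α = G (α ∷ʳ (μ₁ + μ₂ + 0 ∸ ∣ ν ∣ + i))
    shuffle : ∀ p q r x → (p · (q · r)) · x ≡ p · (q · (r · x))
    shuffle = ℤSolver.solve-∀
    branch : ∀ i γ → schur (suc n) μ (λ α → G (α ⊕ (γ ∷ʳ i))) ≡
      ∑ (box B) (λ ν → ⟦ μ ≽? ν ⟧ · schur n ν (λ α → G (α ⊕ γ ∷ʳ (μ₁ + μ₂ + 0 ∸ ∣ ν ∣ + i))))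
    branch i γ = trans (schur-branching n B ∣ μ ∣ (ℕ.≤-<-trans (ℕ.+-monoʳ-≤ (μ₁ + μ₂) z≤n) lt) μ refl _)
      (∑-cong (box B) (λ ν → cong (⟦ μ ≽? ν ⟧ ·_) (schur-cong n ν (λ α → cong G (⊕-∷ʳ α γ _ i)))))
    degree : ∀ i v w → i ≤ c → v ≤ μ₁ + μ₂ → w ≡ v + (c ∸ i) → μ₁ + μ₂ + 0 ∸ v + i ≡ μ₁ + μ₂ + c ∸ w
    degree i v w i≤c v≤μ refl = begin
      μ₁ + μ₂ + 0 ∸ v + i ≡⟨ cong (λ z → z ∸ v + i) (ℕ.+-identityʳ (μ₁ + μ₂)) ⟩
      μ₁ + μ₂ ∸ v + i ≡⟨ cong (λ z → μ₁ + μ₂ ∸ v + z) (ℕ.m∸[m∸n]≡n i≤c) ⟨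
      μ₁ + μ₂ ∸ v + (c ∸ (c ∸ i)) ≡⟨ ℕ.+-∸-assoc (μ₁ + μ₂ ∸ v) (ℕ.m∸n≤m c i) ⟨
      μ₁ + μ₂ ∸ v + c ∸ (c ∸ i) ≡⟨ cong (_∸ (c ∸ i)) (ℕ.+-∸-comm c v≤μ) ⟨
      μ₁ + μ₂ + c ∸ v ∸ (c ∸ i) ≡⟨ ℕ.∸-+-assoc (μ₁ + μ₂ + c) v (c ∸ i) ⟩
      μ₁ + μ₂ + c ∸ (v + (c ∸ i)) ∎
    hyp : ∀ i → i ≤ c → ∀ ν₁ ν₂ ν₃ → let ν = ν₁ , ν₂ , ν₃ in μ ≽ ν →
      ∑ (monomials n (c ∸ i)) (λ γ → schur n ν (λ α → Gᵢ i ν (α ⊕ γ))) ≡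
      ∑ (box B) (λ κ → (⟦ ∣ κ ∣ ≟ ∣ ν ∣ + (c ∸ i) ⟧ · ⟦ κ ≽? ν ⟧) · Φ κ)
    hyp i i≤c ν₁ ν₂ .0 ((p , _) , (q , _) , z≤n) = begin
      _ ≡⟨ pieri n ν₁ ν₂ (c ∸ i) (ℕ.≤-<-trans (ℕ.+-mono-≤ (ℕ.+-mono-≤ p q) (ℕ.m∸n≤m c i)) lt) (Gᵢ i ν) ⟩
      _ ≡⟨ cong (λ v → ∑ (box B) (λ κ → ⟦ ∣ κ ∣ ≟ v + (c ∸ i) ⟧ · (⟦ κ ≽? ν ⟧ · schur n κ (Gᵢ i ν)))) (ℕ.+-identityʳ (ν₁ + ν₂)) ⟨
      ∑ (box B) (λ κ → ⟦ ∣ κ ∣ ≟ ∣ ν ∣ + (c ∸ i) ⟧ · (⟦ κ ≽? ν ⟧ · schur n κ (Gᵢ i ν)))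
        ≡⟨ ∑-cong (box B) (λ κ → trans (⟦⟧-*-congʳ (∣ κ ∣ ≟ ∣ ν ∣ + (c ∸ i)) (λ e → cong (⟦ κ ≽? ν ⟧ ·_)
             (schur-cong n κ (λ α → cong (λ z → G (α ∷ʳ z))
               (degree i _ ∣ κ ∣ i≤c (subst (_≤ μ₁ + μ₂) (sym (ℕ.+-identityʳ (ν₁ + ν₂))) (ℕ.+-mono-≤ p q)) e)))))
             (sym (ℤ.*-assoc ⟦ ∣ κ ∣ ≟ ∣ ν ∣ + (c ∸ i) ⟧ ⟦ κ ≽? ν ⟧ (Φ κ)))) ⟩
      _ ∎
      where
      ν : Shape
      ν = ν₁ , ν₂ , 0

-- Schur expansions of p_d[h_k]

sgn : ℕ → ℤ
sgn zero    = 1ℤ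
sgn (suc n) = -ℤ (sgn n)

-- For a partition λ of size divisible by 3, `ψ` of λ₂ - λ₃ compares the residues modulo 3 of λ₁ +
-- 2, λ₂ + 1, λ₃ with those of 2, 1, 0: it is the sign of the permutation relating them, and 0 if
-- the residues coincide. `ε₂` and `ε₃` are divisibility indicators, given by recursion so that
-- their periods hold definitionally.
ε₂ ε₃ ψ : ℕ → ℤ
ε₂ 0             = 1ℤ
ε₂ 1             = 0ℤ
ε₂ (suc (suc n)) = ε₂ n

ε₃ 0                   = 1ℤ
ε₃ 1                   = 0ℤ
ε₃ 2                   = 0ℤ
ε₃ (suc (suc (suc n))) = ε₃ n

ψ 0                   = 1ℤ
ψ 1                   = -1ℤ
ψ 2                   = 0ℤ
ψ (suc (suc (suc n))) = ψ n

⟦∣⟧-step : ∀ d m → ⟦ d ∣? d + m ⟧ ≡ ⟦ d ∣? m ⟧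
⟦∣⟧-step d m = ⟦⟧-⇔ (d ∣? d + m) (d ∣? m) (λ p → ∣m+n∣m⇒∣n p ∣-refl) (∣m∣n⇒∣m+n ∣-refl)

ε₂≡ : ∀ n → ε₂ n ≡ ⟦ 2 ∣? n ⟧
ε₂≡ 0             = refl
ε₂≡ 1             = refl
ε₂≡ (suc (suc n)) = trans (ε₂≡ n) (sym (⟦∣⟧-step 2 n))

ε₃≡ : ∀ n → ε₃ n ≡ ⟦ 3 ∣? n ⟧
ε₃≡ 0                   = refl
ε₃≡ 1                   = refl
ε₃≡ 2                   = refl
ε₃≡ (suc (suc (suc n))) = trans (ε₃≡ n) (sym (⟦∣⟧-step 3 n))

⟦∣⟧-complement : ∀ d m n → d ∣ m + n → ⟦ d ∣? m ⟧ ≡ ⟦ d ∣? n ⟧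
⟦∣⟧-complement d m n p = ⟦⟧-⇔ (d ∣? m) (d ∣? n) (∣m+n∣m⇒∣n p)
  (∣m+n∣m⇒∣n (subst (d ∣_) (ℕ.+-comm m n) p))

ε₃-complement : ∀ m n → 3 ∣ m + n → ε₃ m ≡ ε₃ n
ε₃-complement m n p = trans (ε₃≡ m) (trans (⟦∣⟧-complement 3 m n p) (sym (ε₃≡ n)))

ε₃-three : ∀ n → ε₃ n +ℤ (ε₃ (1 + n) +ℤ ε₃ (2 + n)) ≡ 1ℤ
ε₃-three 0                   = refl
ε₃-three 1                   = refl
ε₃-three 2                   = refl
ε₃-three (suc (suc (suc n))) = ε₃-three n

-- `ψ` is the discrete derivative of `ε₃`, with 2 + n in place of n - 1; this makes its sums over
-- intervals telescope.
ψ≡ : ∀ n → ψ n ≡ ε₃ n -ℤ ε₃ (2 + n)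
ψ≡ 0                   = refl
ψ≡ 1                   = refl
ψ≡ 2                   = refl
ψ≡ (suc (suc (suc n))) = ψ≡ n

ψ-3*+ : ∀ u n → ψ (3 * u + n) ≡ ψ n
ψ-3*+ zero    n = refl
ψ-3*+ (suc u) n = trans (cong ψ (shift u n)) (ψ-3*+ u n)
  where
  shift : ∀ u n → 3 * suc u + n ≡ 3 + (3 * u + n)
  shift = ℕSolver.solve-∀

∑-sgn : ∀ t → ∑< (suc t) sgn ≡ ε₂ t
∑-sgn zero          = ∑<-one sgn
∑-sgn (suc zero)    = trans (∑<-suc 1 sgn) (cong (1ℤ +ℤ_) (∑<-one (sgn ∘ suc)))
∑-sgn (suc (suc t)) = begin
  ∑< (3 + t) sgn ≡⟨ ∑<-suc (2 + t) sgn ⟩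
  1ℤ +ℤ ∑< (2 + t) (sgn ∘ suc) ≡⟨ cong (1ℤ +ℤ_) (∑<-suc (suc t) (sgn ∘ suc)) ⟩
  1ℤ +ℤ (-1ℤ +ℤ ∑< (suc t) (λ i → -ℤ (-ℤ (sgn i)))) ≡⟨ ℤ.+-assoc 1ℤ -1ℤ (∑< (suc t) (λ i → -ℤ (-ℤ (sgn i)))) ⟨
  0ℤ +ℤ ∑< (suc t) (λ i → -ℤ (-ℤ (sgn i))) ≡⟨ ℤ.+-identityˡ (∑< (suc t) (λ i → -ℤ (-ℤ (sgn i)))) ⟩
  ∑< (suc t) (λ i → -ℤ (-ℤ (sgn i))) ≡⟨ ∑-cong (upTo (suc t)) (λ i → ℤ.neg-involutive (sgn i)) ⟩
  ∑< (suc t) sgn ≡⟨ ∑-sgn t ⟩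
  ε₂ t ∎

sgn-+ : ∀ m n → sgn (m + n) ≡ sgn m · sgn n
sgn-+ zero    n = sym (ℤ.*-identityˡ (sgn n))
sgn-+ (suc m) n = trans (cong -ℤ_ (sgn-+ m n)) (ℤ.neg-distribˡ-* (sgn m) (sgn n))

∑-ψ : ∀ x t → ∑< (suc t) (λ v → ψ (x + v)) ≡ ε₃ (x + t) -ℤ ε₃ (2 + x)
∑-ψ x zero    = trans (∑<-one (λ v → ψ (x + v))) (trans (cong ψ (ℕ.+-identityʳ x))
  (trans (ψ≡ x) (cong (λ z → ε₃ z -ℤ ε₃ (2 + x)) (sym (ℕ.+-identityʳ x)))))
∑-ψ x (suc t) = begin
  ∑< (2 + t) (λ v → ψ (x + v)) ≡⟨ ∑<-snoc (suc t) (λ v → ψ (x + v)) ⟩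
  ∑< (suc t) (λ v → ψ (x + v)) +ℤ ψ (x + suc t)
    ≡⟨ cong₂ _+ℤ_ (∑-ψ x t) (trans (ψ≡ (x + suc t)) (cong (λ z → ε₃ (x + suc t) -ℤ ε₃ (2 + z)) (ℕ.+-suc x t))) ⟩
  (ε₃ (x + t) -ℤ ε₃ (2 + x)) +ℤ (ε₃ (x + suc t) -ℤ ε₃ (x + t))
    ≡⟨ telescope (ε₃ (x + t)) (ε₃ (2 + x)) (ε₃ (x + suc t)) ⟩
  ε₃ (x + suc t) -ℤ ε₃ (2 + x) ∎
  where
  telescope : ∀ a b c → (a -ℤ b) +ℤ (c -ℤ a) ≡ c -ℤ b
  telescope = ℤSolver.solve-∀

-- The double sum of ψ over {u ≤ e, v ≤ g, u + v ≤ W}: the sum over v telescopes to slice e W u,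
-- whichever of the two upper bounds for v is active, and slices have period 3 in e, W and u.
slice : ℕ → ℕ → ℕ → ℤ
slice e W u = ε₃ (u + (e + W)) -ℤ ε₃ (u + (e + e + 1))

ε₃-+3 : ∀ u m → ε₃ (u + (3 + m)) ≡ ε₃ (u + m)
ε₃-+3 u m = cong ε₃ (shift u m)
  where
  shift : ∀ u m → u + (3 + m) ≡ 3 + (u + m)
  shift = ℕSolver.solve-∀

slice-e : ∀ e W u → slice (3 + e) W u ≡ slice e W u
slice-e e W u = cong₂ _-ℤ_ (ε₃-+3 u (e + W))
  (trans (cong ε₃ (shift u e)) (trans (ε₃-+3 u (3 + (e + e + 1))) (ε₃-+3 u (e + e + 1))))
  where
  shift : ∀ u e → u + (3 + e + (3 + e) + 1) ≡ u + (3 + (3 + (e + e + 1)))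
  shift = ℕSolver.solve-∀

slice-W : ∀ e W u → slice e (3 + W) u ≡ slice e W u
slice-W e W u = cong (_-ℤ ε₃ (u + (e + e + 1))) (trans (cong (λ z → ε₃ (u + z)) (shift e W)) (ε₃-+3 u (e + W)))
  where
  shift : ∀ e W → e + (3 + W) ≡ 3 + (e + W)
  shift = ℕSolver.solve-∀

slices : ℕ → ℕ → ℕ → ℤ
slices e W t = ∑< (suc t) (slice e W)

-- Among three consecutive values of u each of the two indicators in `slice` is 1 exactly once, so
-- three consecutive slices cancel.
slices-3+ : ∀ e W t → slices e W (3 + t) ≡ slices e W t
slices-3+ e W t = begin
  ∑< (4 + t) h ≡⟨ ∑<-suc (3 + t) h ⟩
  h 0 +ℤ ∑< (3 + t) (h ∘ suc) ≡⟨ cong (h 0 +ℤ_) (trans (∑<-suc (2 + t) (h ∘ suc)) (cong (h 1 +ℤ_) (∑<-suc (suc t) (λ i → h (2 + i))))) ⟩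
  h 0 +ℤ (h 1 +ℤ (h 2 +ℤ ∑< (suc t) h))
    ≡⟨ collect (ε₃ a) (ε₃ (1 + a)) (ε₃ (2 + a)) (ε₃ b) (ε₃ (1 + b)) (ε₃ (2 + b)) _ ⟩
  ((ε₃ a +ℤ (ε₃ (1 + a) +ℤ ε₃ (2 + a))) -ℤ (ε₃ b +ℤ (ε₃ (1 + b) +ℤ ε₃ (2 + b)))) +ℤ ∑< (suc t) h
    ≡⟨ cong₂ (λ p q → (p -ℤ q) +ℤ ∑< (suc t) h) (ε₃-three a) (ε₃-three b) ⟩
  0ℤ +ℤ ∑< (suc t) h ≡⟨ ℤ.+-identityˡ _ ⟩
  ∑< (suc t) h ∎
  where
  h = slice e W
  a = e + W
  b = e + e + 1
  collect : ∀ a₀ a₁ a₂ b₀ b₁ b₂ s → (a₀ -ℤ b₀) +ℤ ((a₁ -ℤ b₁) +ℤ ((a₂ -ℤ b₂) +ℤ s)) ≡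
    ((a₀ +ℤ (a₁ +ℤ a₂)) -ℤ (b₀ +ℤ (b₁ +ℤ b₂))) +ℤ s
  collect = ℤSolver.solve-∀

opaque
  unfolding ∑

  -- Lowering e by 3 changes no slice but removes three consecutive terms, which cancel; lowering W
  -- by 3 changes nothing at all. Nine pairs of residues remain.
  slices-e : ∀ e W → slices e W e ≡ ε₃ W · ψ e
  slices-e (suc (suc (suc e))) W = trans (slices-3+ (3 + e) W e)
    (trans (∑-cong (upTo (suc e)) (slice-e e W)) (slices-e e W))
  slices-e e (suc (suc (suc W))) = trans (∑-cong (upTo (suc e)) (slice-W e W)) (slices-e e W)
  slices-e 0 0 = refl
  slices-e 0 1 = refl
  slices-e 0 2 = refl
  slices-e 1 0 = refl
  slices-e 1 1 = refl
  slices-e 1 2 = refl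
  slices-e 2 0 = refl
  slices-e 2 1 = refl
  slices-e 2 2 = refl

  slices-W : ∀ e W → slices e W W ≡ ε₃ W · ψ e
  slices-W (suc (suc (suc e))) W = trans (∑-cong (upTo (suc W)) (slice-e e W)) (slices-W e W)
  slices-W e (suc (suc (suc W))) = trans (slices-3+ e (3 + W) W)
    (trans (∑-cong (upTo (suc W)) (slice-W e W)) (slices-W e W))
  slices-W 0 0 = refl
  slices-W 0 1 = refl
  slices-W 0 2 = refl
  slices-W 1 0 = refl
  slices-W 1 1 = refl
  slices-W 1 2 = refl
  slices-W 2 0 = refl
  slices-W 2 1 = refl
  slices-W 2 2 = refl

∑<-truncate : ∀ g W (f : ℕ → ℤ) → ∑< (suc g) (λ v → ⟦ v ≤? W ⟧ · f v) ≡ ∑< (suc (g ⊓ W)) f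
∑<-truncate g W f = sym (trans (∑<-extend (suc g) (g ⊓ W) f (s≤s (ℕ.m⊓n≤m g W)))
  (∑<-cong (suc g) (λ { v (s≤s v≤g) → cong (_· f v) (⟦⟧-⇔ (v ≤? g ⊓ W) (v ≤? W)
    (λ p → ℕ.≤-trans p (ℕ.m⊓n≤n g W)) (ℕ.⊓-glb v≤g)) })))

-- For fixed u the variable v stops at g or at W - u. The hypothesis makes e + 2u + g and u + e + W
-- opposite modulo 3, and `ε₃` takes equal values on opposite residues, so both stops give the same
-- telescoped value.
∑-ψ-region : ∀ e g W → 3 ∣ W + g + 2 * e →
  ∑< (suc e) (λ u → ∑< (suc g) (λ v → ⟦ u + v ≤? W ⟧ · ψ (e + 2 * u + v))) ≡ ε₃ W · ψ e
∑-ψ-region e g W div = begin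
  _ ≡⟨ ∑-cong (upTo (suc e)) inner ⟩
  ∑< (suc e) (λ u → ⟦ u ≤? W ⟧ · slice e W u) ≡⟨ ∑<-truncate e W (slice e W) ⟩
  slices e W (e ⊓ W) ≡⟨ minimum (ℕ.⊓-sel e W) ⟩
  ε₃ W · ψ e ∎
  where
  minimum : e ⊓ W ≡ e ⊎ e ⊓ W ≡ W → slices e W (e ⊓ W) ≡ ε₃ W · ψ e
  minimum (inj₁ eq) = trans (cong (slices e W) eq) (slices-e e W)
  minimum (inj₂ eq) = trans (cong (slices e W) eq) (slices-W e W)
  lower : ∀ u → ε₃ (2 + (e + 2 * u)) ≡ ε₃ (u + (e + e + 1))
  lower u = ε₃-complement (2 + (e + 2 * u)) (u + (e + e + 1)) (divides (e + u + 1) (eq e u))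
    where
    eq : ∀ e u → 2 + (e + 2 * u) + (u + (e + e + 1)) ≡ (e + u + 1) * 3
    eq = ℕSolver.solve-∀
  upper : ∀ u → u ≤ W → g ⊓ (W ∸ u) ≡ g ⊎ g ⊓ (W ∸ u) ≡ W ∸ u → ε₃ (e + 2 * u + (g ⊓ (W ∸ u))) ≡ ε₃ (u + (e + W))
  upper u u≤W (inj₁ eq) = trans (cong (λ z → ε₃ (e + 2 * u + z)) eq)
    (ε₃-complement (e + 2 * u + g) (u + (e + W)) (subst (3 ∣_) (sym (eq' e u g W)) (∣m∣n⇒∣m+n div (m∣m*n u))))
    where
    eq' : ∀ e u g W → e + 2 * u + g + (u + (e + W)) ≡ W + g + 2 * e + 3 * u
    eq' = ℕSolver.solve-∀
  upper u u≤W (inj₂ eq) = cong ε₃ (begin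
    e + 2 * u + (g ⊓ (W ∸ u)) ≡⟨ cong (λ z → e + 2 * u + z) eq ⟩
    e + 2 * u + (W ∸ u) ≡⟨ eq' e u (W ∸ u) ⟩
    u + (e + (u + (W ∸ u))) ≡⟨ cong (λ z → u + (e + z)) (ℕ.m+[n∸m]≡n u≤W) ⟩
    u + (e + W) ∎)
    where
    eq' : ∀ e u w → e + 2 * u + w ≡ u + (e + (u + w))
    eq' = ℕSolver.solve-∀
  inner : ∀ u → ∑< (suc g) (λ v → ⟦ u + v ≤? W ⟧ · ψ (e + 2 * u + v)) ≡ ⟦ u ≤? W ⟧ · slice e W u
  inner u = begin
    _ ≡⟨ ∑-cong (upTo (suc g)) (λ v → sym (⟦⟧-merge (u ≤? W) (v ≤? W ∸ u) (u + v ≤? W)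
           (λ p q → subst (u + v ≤_) (ℕ.m+[n∸m]≡n p) (ℕ.+-monoʳ-≤ u q))
           (λ p → ℕ.≤-trans (ℕ.m≤m+n u v) p , subst (_≤ W ∸ u) (ℕ.m+n∸m≡n u v) (ℕ.∸-monoˡ-≤ u p)) (ψ (e + 2 * u + v)))) ⟩
    ∑< (suc g) (λ v → ⟦ u ≤? W ⟧ · (⟦ v ≤? W ∸ u ⟧ · ψ (e + 2 * u + v))) ≡⟨ ∑-*ˡ (upTo (suc g)) ⟦ u ≤? W ⟧ _ ⟨
    ⟦ u ≤? W ⟧ · ∑< (suc g) (λ v → ⟦ v ≤? W ∸ u ⟧ · ψ (e + 2 * u + v))
      ≡⟨ ⟦⟧-*-congʳ (u ≤? W) (λ u≤W → trans (∑<-truncate g (W ∸ u) (λ v → ψ (e + 2 * u + v)))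
           (trans (∑-ψ (e + 2 * u) (g ⊓ (W ∸ u))) (cong₂ _-ℤ_ (upper u u≤W (ℕ.⊓-sel g (W ∸ u))) (lower u)))) ⟩
    ⟦ u ≤? W ⟧ · slice e W u ∎

-- Compatibility of the coefficients with branching for d = 1, 2, 3

∑-multiples : ∀ d' k m → ∑< (suc k) (λ i → ⟦ m ≟ suc d' * (k ∸ i) ⟧) ≡ ⟦ (suc d' ∣? m) ×-dec (m ≤? suc d' * k) ⟧
∑-multiples d' k m = begin
  ∑< (suc k) (λ i → ⟦ m ≟ d * (k ∸ i) ⟧) ≡⟨ ∑<-reverse k (λ i → ⟦ m ≟ d * (k ∸ i) ⟧) ⟩
  ∑< (suc k) (λ i → ⟦ m ≟ d * (k ∸ (k ∸ i)) ⟧)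
    ≡⟨ ∑<-cong (suc k) (λ { i (s≤s i≤k) → trans (cong (λ z → ⟦ m ≟ d * z ⟧) (ℕ.m∸[m∸n]≡n i≤k)) (sym (ℤ.*-identityʳ ⟦ m ≟ d * i ⟧)) }) ⟩
  ∑< (suc k) (λ i → ⟦ m ≟ d * i ⟧ · 1ℤ)
    ≡⟨ ∑<-collapse (suc k) (λ i → m ≟ d * i) ((d ∣? m) ×-dec (m ≤? d * k)) (m / d) (λ _ → 1ℤ)
         (λ { i (s≤s i≤k) refl → sym (trans (cong (_/ d) (ℕ.*-comm d i)) (m*n/n≡m i d)) , m∣m*n i , ℕ.*-monoʳ-≤ d i≤k })
         (λ (p , _) → sym (trans (ℕ.*-comm d (m / d)) (m/n*n≡m p)))
         (λ (p , q) → s≤s (ℕ.*-cancelˡ-≤ d (subst (_≤ d * k) (sym (trans (ℕ.*-comm d (m / d)) (m/n*n≡m p))) q))) ⟩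
  ⟦ (d ∣? m) ×-dec (m ≤? d * k) ⟧ · 1ℤ ≡⟨ ℤ.*-identityʳ ⟦ (d ∣? m) ×-dec (m ≤? d * k) ⟧ ⟩
  ⟦ (d ∣? m) ×-dec (m ≤? d * k) ⟧ ∎
  where
  d : ℕ
  d = suc d'

-- The coefficients of s_(a,b,c) in p₁[h_k], p₂[h_k] and p₃[h_k].
coeff₁ coeff₂ coeff₃ : Shape → ℤ
coeff₁ (a , b , c) = ⟦ (b ≟ 0) ×-dec (c ≟ 0) ⟧
coeff₂ (a , b , c) = ⟦ (c ≟ 0) ×-dec (b ≤? a) ⟧ · sgn b
coeff₃ (a , b , c) = ⟦ (c ≤? b) ×-dec (b ≤? a) ⟧ · ψ (b ∸ c)

*-0ʳ : ∀ a {b} → b ≡ 0ℤ → a · b ≡ 0ℤ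
*-0ʳ a refl = ℤ.*-zeroʳ a

-- The size determines a, and p ≤ a becomes p + b + c ≤ m. A requirement b ≤ a on the partition is
-- implied by b ≤ p ≤ a, whence the passage from `V` to `V'`.
∑-largest-part : ∀ B m → m < B → ∀ p q r (w : ℕ → ℕ → ℤ) {V : ℕ → ℕ → ℕ → Set} (V? : ∀ a b c → Dec (V a b c))
  {V' : ℕ → ℕ → Set} (V'? : ∀ b c → Dec (V' b c)) →
  (∀ a b c → (a , b , c) ≽ (p , q , r) → V a b c → V' b c) →
  (∀ a b c → p ≤ a → b ≤ p → q ≤ b → V' b c → V a b c) →
  ∑ (box B) (λ (a , b , c) → ⟦ a + b + c ≟ m ⟧ · (⟦ (a , b , c) ≽? (p , q , r) ⟧ · (⟦ V? a b c ⟧ · w b c))) ≡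
  ∑< B (λ b → ⟦ b ∈[ q , p ]? ⟧ · ∑< B (λ c → ⟦ c ∈[ r , q ]? ⟧ · (⟦ p + b + c ≤? m ⟧ · (⟦ V'? b c ⟧ · w b c))))
∑-largest-part B m m<B p q r w {V} V? {V'} V'? V⇒V' V'⇒V = begin
  _ ≡⟨ ∑-box-rot B _ ⟩
  ∑< B (λ b → ∑< B (λ c → ∑< B (λ a → ⟦ a + b + c ≟ m ⟧ · (⟦ (a , b , c) ≽? (p , q , r) ⟧ · (⟦ V? a b c ⟧ · w b c)))))
    ≡⟨ ∑-cong (upTo B) (λ b → trans (∑-cong (upTo B) (largest b)) (sym (∑-*ˡ (upTo B) ⟦ b ∈[ q , p ]? ⟧ _))) ⟩
  _ ∎
  where
  P? : ∀ b c a → Dec (a + b + c ≡ m × (a , b , c) ≽ (p , q , r) × V a b c)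
  P? b c a = (a + b + c ≟ m) ×-dec (((a , b , c) ≽? (p , q , r)) ×-dec V? a b c)
  Q? : ∀ b c → Dec ((q ≤ b × b ≤ p) × (r ≤ c × c ≤ q) × p + b + c ≤ m × V' b c)
  Q? b c = (b ∈[ q , p ]?) ×-dec ((c ∈[ r , q ]?) ×-dec ((p + b + c ≤? m) ×-dec V'? b c))
  largest : ∀ b c → ∑< B (λ a → ⟦ a + b + c ≟ m ⟧ · (⟦ (a , b , c) ≽? (p , q , r) ⟧ · (⟦ V? a b c ⟧ · w b c))) ≡
    ⟦ b ∈[ q , p ]? ⟧ · (⟦ c ∈[ r , q ]? ⟧ · (⟦ p + b + c ≤? m ⟧ · (⟦ V'? b c ⟧ · w b c)))
  largest b c = begin
    _ ≡⟨ ∑-cong (upTo B) (λ a → trans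
           (cong (⟦ a + b + c ≟ m ⟧ ·_) (⟦⟧-nest ((a , b , c) ≽? (p , q , r)) (V? a b c) (w b c)))
           (⟦⟧-nest (a + b + c ≟ m) (((a , b , c) ≽? (p , q , r)) ×-dec V? a b c) (w b c))) ⟩
    ∑< B (λ a → ⟦ P? b c a ⟧ · w b c)
      ≡⟨ ∑<-collapse B (P? b c) (Q? b c) (m ∸ (b + c)) (λ _ → w b c)
           (λ { a _ (refl , D@((p₁ , p₂) , (p₃ , p₄) , p₅) , v) →
              sym (trans (cong (_∸ (b + c)) (ℕ.+-assoc a b c)) (ℕ.m+n∸n≡m a (b + c)))
              , (p₃ , p₂) , (p₅ , p₄) , ℕ.+-monoˡ-≤ c (ℕ.+-monoˡ-≤ b p₁) , V⇒V' a b c D v })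
           (λ ((q≤b , b≤p) , (r≤c , c≤q) , le , v) →
              let le' = subst (_≤ m) (ℕ.+-assoc p b c) le
                  bc≤m = ℕ.≤-trans (ℕ.m≤n+m (b + c) p) le'
                  p≤a = subst (_≤ m ∸ (b + c)) (ℕ.m+n∸n≡m p (b + c)) (ℕ.∸-monoˡ-≤ (b + c) le')
              in trans (ℕ.+-assoc (m ∸ (b + c)) b c) (ℕ.m∸n+n≡m bc≤m)
               , ((p≤a , b≤p) , (q≤b , c≤q) , r≤c) , V'⇒V _ b c p≤a b≤p q≤b v)
           (λ _ → ℕ.≤-<-trans (ℕ.m∸n≤m m (b + c)) m<B) ⟩
    ⟦ Q? b c ⟧ · w b c
      ≡⟨ ⟦⟧-nest (b ∈[ q , p ]?) ((c ∈[ r , q ]?) ×-dec ((p + b + c ≤? m) ×-dec V'? b c)) (w b c) ⟨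
    _ ≡⟨ cong (⟦ b ∈[ q , p ]? ⟧ ·_) (trans
           (⟦⟧-nest (c ∈[ r , q ]?) ((p + b + c ≤? m) ×-dec V'? b c) (w b c))
           refl) ⟨
    _ ≡⟨ cong (λ z → ⟦ b ∈[ q , p ]? ⟧ · (⟦ c ∈[ r , q ]? ⟧ · z))
           (⟦⟧-nest (p + b + c ≤? m) (V'? b c) (w b c)) ⟨
    _ ∎

compatible₁ : ∀ B → PowerSum.Compatible B 0 coeff₁ refl
compatible₁ B (p , q , r) k lt = begin
  ∑ (box B) (λ s → ⟦ ∣ s ∣ ≟ 1 * k ⟧ · (⟦ s ≽? t ⟧ · coeff₁ s))
    ≡⟨ ∑-cong (box B) (λ { s@(a , b , c) → trans (cong (⟦ ∣ s ∣ ≟ 1 * k ⟧ ·_) (sym (⟦⟧-× (s ≽? t) ((b ≟ 0) ×-dec (c ≟ 0)))))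
         (trans (sym (⟦⟧-× (∣ s ∣ ≟ 1 * k) ((s ≽? t) ×-dec ((b ≟ 0) ×-dec (c ≟ 0))))) (sym (ℤ.*-identityʳ _))) }) ⟩
  ∑ (box B) (λ s → ⟦ P? s ⟧ · 1ℤ)
    ≡⟨ ∑-box-collapse B P? ((q ≟ 0) ×-dec ((r ≟ 0) ×-dec (p ≤? 1 * k))) (1 * k) 0 0 (λ _ → 1ℤ)
         (λ { (a , b , c) (e , ((p₁ , p₂) , (p₃ , p₄) , p₅) , refl , refl) →
            cong (λ z → z , 0 , 0) (trans (sym (+0+0 a)) e)
            , ℕ.n≤0⇒n≡0 p₃ , ℕ.n≤0⇒n≡0 p₅ , subst (p ≤_) (trans (sym (+0+0 a)) e) p₁ })
         (λ { (refl , refl , le) → +0+0 (1 * k) , ((le , z≤n) , (z≤n , z≤n) , z≤n) , refl , refl })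
         (λ _ → lt , ℕ.≤-<-trans z≤n lt , ℕ.≤-<-trans z≤n lt) ⟩
  ⟦ (q ≟ 0) ×-dec ((r ≟ 0) ×-dec (p ≤? 1 * k)) ⟧ · 1ℤ ≡⟨ ℤ.*-identityʳ ⟦ (q ≟ 0) ×-dec ((r ≟ 0) ×-dec (p ≤? 1 * k)) ⟧ ⟩
  ⟦ (q ≟ 0) ×-dec ((r ≟ 0) ×-dec (p ≤? 1 * k)) ⟧
    ≡⟨ ⟦⟧-merge₂ ((1 ∣? ∣ t ∣) ×-dec (∣ t ∣ ≤? 1 * k)) ((q ≟ 0) ×-dec (r ≟ 0)) ((q ≟ 0) ×-dec ((r ≟ 0) ×-dec (p ≤? 1 * k)))
         (λ { (_ , le) (refl , refl) → refl , refl , subst (_≤ 1 * k) (+0+0 p) le })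
         (λ { (refl , refl , le) → (divides (p + 0 + 0) (sym (ℕ.*-identityʳ (p + 0 + 0))) , subst (_≤ 1 * k) (sym (+0+0 p)) le) , refl , refl }) ⟨
  ⟦ (1 ∣? ∣ t ∣) ×-dec (∣ t ∣ ≤? 1 * k) ⟧ · coeff₁ t ≡⟨ cong (_· coeff₁ t) (∑-multiples 0 k ∣ t ∣) ⟨
  _ ∎
  where
  t : Shape
  t = p , q , r
  P? : ∀ ((a , b , c) : Shape) → Dec (a + b + c ≡ 1 * k × (a , b , c) ≽ t × b ≡ 0 × c ≡ 0)
  P? (a , b , c) = (a + b + c ≟ 1 * k) ×-dec (((a , b , c) ≽? t) ×-dec ((b ≟ 0) ×-dec (c ≟ 0)))

-- For t = (p , q , 0) with |t| ≤ 2k, the shapes that count are (2k - b , b , 0) with b from q up to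
-- the smaller of p and 2k - p. The alternating sum over such an interval is `sgn q` or 0 according
-- to the parity of its length, and both p - q and 2k - p - q have the parity of |t|.
compatible₂ : ∀ B → PowerSum.Compatible B 1 coeff₂ refl
compatible₂ B (p , q , r) k lt = begin
  ∑ (box B) (λ s → ⟦ ∣ s ∣ ≟ 2 * k ⟧ · (⟦ s ≽? (p , q , r) ⟧ · coeff₂ s))
    ≡⟨ ∑-largest-part B (2 * k) lt p q r (λ b _ → sgn b) (λ a b c → (c ≟ 0) ×-dec (b ≤? a)) (λ b c → c ≟ 0)
         (λ _ _ _ _ → proj₁) (λ a b c p≤a b≤p _ v → v , ℕ.≤-trans b≤p p≤a) ⟩
  ∑< B (λ b → ⟦ b ∈[ q , p ]? ⟧ · ∑< B (λ c → ⟦ c ∈[ r , q ]? ⟧ · (⟦ p + b + c ≤? 2 * k ⟧ · (⟦ c ≟ 0 ⟧ · sgn b))))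
    ≡⟨ ∑-cong (upTo B) (λ b → cong (⟦ b ∈[ q , p ]? ⟧ ·_) (smallest b)) ⟩
  ∑< B (λ b → ⟦ b ∈[ q , p ]? ⟧ · (⟦ r ≟ 0 ⟧ · (⟦ p + b ≤? 2 * k ⟧ · sgn b)))
    ≡⟨ main (r ≟ 0) (q ≤? p) ⟩
  RHS ≡⟨ cong (_· coeff₂ (p , q , r)) (∑-multiples 1 k (p + q + r)) ⟨
  _ ∎
  where
  smallest : ∀ b → ∑< B (λ c → ⟦ c ∈[ r , q ]? ⟧ · (⟦ p + b + c ≤? 2 * k ⟧ · (⟦ c ≟ 0 ⟧ · sgn b))) ≡
    ⟦ r ≟ 0 ⟧ · (⟦ p + b ≤? 2 * k ⟧ · sgn b)
  smallest b = begin
    _ ≡⟨ ∑-cong (upTo B) (λ c → trans (swap ⟦ c ∈[ r , q ]? ⟧ ⟦ p + b + c ≤? 2 * k ⟧ ⟦ c ≟ 0 ⟧ (sgn b))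
           (⟦⟧-nest (c ≟ 0) (c ∈[ r , q ]?) (⟦ p + b + c ≤? 2 * k ⟧ · sgn b))) ⟩
    ∑< B (λ c → ⟦ (c ≟ 0) ×-dec (c ∈[ r , q ]?) ⟧ · (⟦ p + b + c ≤? 2 * k ⟧ · sgn b))
      ≡⟨ ∑<-collapse B (λ c → (c ≟ 0) ×-dec (c ∈[ r , q ]?)) (r ≟ 0) 0 (λ c → ⟦ p + b + c ≤? 2 * k ⟧ · sgn b)
           (λ { c _ (refl , le , _) → refl , ℕ.n≤0⇒n≡0 le }) (λ { refl → refl , z≤n , z≤n }) (λ _ → ℕ.≤-<-trans z≤n lt) ⟩
    _ ≡⟨ cong (λ z → ⟦ r ≟ 0 ⟧ · (⟦ z ≤? 2 * k ⟧ · sgn b)) (ℕ.+-identityʳ (p + b)) ⟩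
    _ ∎
    where
    swap : ∀ x y z w → x · (y · (z · w)) ≡ z · (x · (y · w))
    swap = ℤSolver.solve-∀
  RHS : ℤ
  RHS = ⟦ (2 ∣? p + q + r) ×-dec (p + q + r ≤? 2 * k) ⟧ · coeff₂ (p , q , r)
  RHS≡0 : ¬ (r ≡ 0 × q ≤ p) → RHS ≡ 0ℤ
  RHS≡0 ¬h = *-0ʳ ⟦ (2 ∣? p + q + r) ×-dec (p + q + r ≤? 2 * k) ⟧ (⟦⟧-no-* ((r ≟ 0) ×-dec (q ≤? p)) ¬h (sgn q))
  main : Dec (r ≡ 0) → Dec (q ≤ p) →
    ∑< B (λ b → ⟦ b ∈[ q , p ]? ⟧ · (⟦ r ≟ 0 ⟧ · (⟦ p + b ≤? 2 * k ⟧ · sgn b))) ≡ RHS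
  main (no r≢0) _ = trans
    (∑-0 (upTo B) (λ b → *-0ʳ ⟦ b ∈[ q , p ]? ⟧ (⟦⟧-no-* (r ≟ 0) r≢0 _)))
    (sym (RHS≡0 (λ (e , _) → r≢0 e)))
  main (yes _) (no q≰p) = trans
    (∑-0 (upTo B) (λ b → ⟦⟧-no-* (b ∈[ q , p ]?) (λ (l , h) → q≰p (ℕ.≤-trans l h)) _))
    (sym (RHS≡0 (λ (_ , e) → q≰p e)))
  main (yes refl) (yes q≤p) with ℕ.m≤n⇒∃[o]m+o≡n q≤p
  ... | g , refl = trans (size (q + g + q + 0 ≤? 2 * k))
    (cong (⟦ (2 ∣? q + g + q + 0) ×-dec (q + g + q + 0 ≤? 2 * k) ⟧ ·_) (sym (⟦⟧-yes-* ((0 ≟ 0) ×-dec (q ≤? q + g)) (refl , q≤p) (sgn q))))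
    where
    drop-0 : ∀ q g → q + g + q + 0 ≡ q + g + q
    drop-0 q g = ℕ.+-identityʳ (q + g + q)
    size : Dec (q + g + q + 0 ≤ 2 * k) →
      ∑< B (λ b → ⟦ b ∈[ q , q + g ]? ⟧ · (1ℤ · (⟦ q + g + b ≤? 2 * k ⟧ · sgn b))) ≡
      ⟦ (2 ∣? q + g + q + 0) ×-dec (q + g + q + 0 ≤? 2 * k) ⟧ · sgn q
    size (no ≰2k) = trans
      (∑-0 (upTo B) (λ b → trans (⟦⟧-*-congʳ (b ∈[ q , q + g ]?) {y = 0ℤ} (λ (q≤b , _) → trans (ℤ.*-identityˡ (⟦ q + g + b ≤? 2 * k ⟧ · sgn b))
        (⟦⟧-no-* (q + g + b ≤? 2 * k) (λ le → ≰2k (ℕ.≤-trans (ℕ.≤-trans (ℕ.≤-reflexive (drop-0 q g)) (ℕ.+-monoʳ-≤ (q + g) q≤b)) le)) (sgn b))))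
        (ℤ.*-zeroʳ ⟦ b ∈[ q , q + g ]? ⟧)))
      (sym (⟦⟧-no-* ((2 ∣? q + g + q + 0) ×-dec (q + g + q + 0 ≤? 2 * k)) (λ (_ , e) → ≰2k e) (sgn q)))
    size (yes ≤2k) with ℕ.m≤n⇒∃[o]m+o≡n ≤2k
    ... | W , t+W≡2k = begin
      _ ≡⟨ ∑<-interval B q g _ (ℕ.≤-<-trans (ℕ.≤-trans (ℕ.m≤m+n (q + g) (q + 0)) (ℕ.≤-trans (ℕ.≤-reflexive (sym (ℕ.+-assoc (q + g) q 0))) ≤2k)) lt) ⟩
      ∑< (suc g) (λ v → 1ℤ · (⟦ q + g + (q + v) ≤? 2 * k ⟧ · sgn (q + v)))
        ≡⟨ ∑-cong (upTo (suc g)) (λ v → trans (ℤ.*-identityˡ _) (trans (cong₂ _·_ (⟦⟧-⇔ (q + g + (q + v) ≤? 2 * k) (v ≤? W)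
             (λ le → ℕ.+-cancelˡ-≤ (q + g + q + 0) v W (subst₂ _≤_ (shift q g v) (sym t+W≡2k) le))
             (λ le → subst₂ _≤_ (sym (shift q g v)) t+W≡2k (ℕ.+-monoʳ-≤ (q + g + q + 0) le)))
             (sgn-+ q v)) (swap ⟦ v ≤? W ⟧ (sgn q) (sgn v)))) ⟩
      ∑< (suc g) (λ v → sgn q · (⟦ v ≤? W ⟧ · sgn v)) ≡⟨ ∑-*ˡ (upTo (suc g)) (sgn q) _ ⟨
      sgn q · ∑< (suc g) (λ v → ⟦ v ≤? W ⟧ · sgn v) ≡⟨ cong (sgn q ·_) (trans (∑<-truncate g W sgn) (∑-sgn (g ⊓ W))) ⟩
      sgn q · ε₂ (g ⊓ W) ≡⟨ ℤ.*-comm (sgn q) _ ⟩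
      ε₂ (g ⊓ W) · sgn q ≡⟨ cong (_· sgn q) (parity (ℕ.⊓-sel g W)) ⟩
      ⟦ 2 ∣? q + g + q + 0 ⟧ · sgn q
        ≡⟨ cong (_· sgn q) (⟦⟧-⇔ (2 ∣? q + g + q + 0) ((2 ∣? q + g + q + 0) ×-dec (q + g + q + 0 ≤? 2 * k)) (λ d → d , ≤2k) proj₁) ⟩
      _ ∎
      where
      swap : ∀ x y z → x · (y · z) ≡ y · (x · z)
      swap = ℤSolver.solve-∀
      shift : ∀ q g v → q + g + (q + v) ≡ q + g + q + 0 + v
      shift = ℕSolver.solve-∀
      double : ∀ q g → g + (q + g + q + 0) ≡ (q + g) * 2
      double = ℕSolver.solve-∀
      ε-g : ε₂ g ≡ ⟦ 2 ∣? q + g + q + 0 ⟧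
      ε-g = trans (ε₂≡ g) (⟦∣⟧-complement 2 g (q + g + q + 0) (divides (q + g) (double q g)))
      ε-W : ε₂ W ≡ ⟦ 2 ∣? q + g + q + 0 ⟧
      ε-W = trans (ε₂≡ W) (⟦∣⟧-complement 2 W (q + g + q + 0)
        (subst (2 ∣_) (trans (sym t+W≡2k) (ℕ.+-comm (q + g + q + 0) W)) (m∣m*n k)))
      parity : g ⊓ W ≡ g ⊎ g ⊓ W ≡ W → ε₂ (g ⊓ W) ≡ ⟦ 2 ∣? q + g + q + 0 ⟧
      parity (inj₁ e) = trans (cong ε₂ e) ε-g
      parity (inj₂ e) = trans (cong ε₂ e) ε-W

-- Put e = q - r, g = p - q, W = 3k - |t|, b = q + v and c = r + u. Then v ≤ g, u ≤ e, the bound p ≤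
-- a reads u + v ≤ W, and the argument of `ψ` is e + v - u: this is the sum of `∑-ψ-region`.
compatible₃ : ∀ B → PowerSum.Compatible B 2 coeff₃ refl
compatible₃ B (p , q , r) k lt = begin
  ∑ (box B) (λ s → ⟦ ∣ s ∣ ≟ 3 * k ⟧ · (⟦ s ≽? (p , q , r) ⟧ · coeff₃ s))
    ≡⟨ ∑-largest-part B (3 * k) lt p q r (λ b c → ψ (b ∸ c)) (λ a b c → (c ≤? b) ×-dec (b ≤? a)) (λ b c → c ≤? b)
         (λ _ _ _ _ → proj₁) (λ a b c p≤a b≤p _ v → v , ℕ.≤-trans b≤p p≤a) ⟩
  ∑< B (λ b → ⟦ b ∈[ q , p ]? ⟧ · ∑< B (λ c → ⟦ c ∈[ r , q ]? ⟧ · (⟦ p + b + c ≤? 3 * k ⟧ · (⟦ c ≤? b ⟧ · ψ (b ∸ c)))))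
    ≡⟨ ∑-cong (upTo B) (λ b → ⟦⟧-*-congʳ (b ∈[ q , p ]?) (λ (q≤b , _) → ∑-cong (upTo B) (λ c →
         ⟦⟧-*-congʳ (c ∈[ r , q ]?) (λ (_ , c≤q) → cong (⟦ p + b + c ≤? 3 * k ⟧ ·_) (⟦⟧-yes-* (c ≤? b) (ℕ.≤-trans c≤q q≤b) (ψ (b ∸ c))))))) ⟩
  LHS p q r
    ≡⟨ main (r ≤? q) (q ≤? p) ⟩
  RHS ≡⟨ cong (_· coeff₃ (p , q , r)) (∑-multiples 2 k (p + q + r)) ⟨
  _ ∎
  where
  LHS : ℕ → ℕ → ℕ → ℤ
  LHS p q r = ∑< B (λ b → ⟦ b ∈[ q , p ]? ⟧ · ∑< B (λ c → ⟦ c ∈[ r , q ]? ⟧ · (⟦ p + b + c ≤? 3 * k ⟧ · ψ (b ∸ c))))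
  RHS : ℤ
  RHS = ⟦ (3 ∣? p + q + r) ×-dec (p + q + r ≤? 3 * k) ⟧ · coeff₃ (p , q , r)
  RHS≡0 : ¬ (r ≤ q × q ≤ p) → RHS ≡ 0ℤ
  RHS≡0 ¬h = *-0ʳ ⟦ (3 ∣? p + q + r) ×-dec (p + q + r ≤? 3 * k) ⟧ (⟦⟧-no-* ((r ≤? q) ×-dec (q ≤? p)) ¬h (ψ (q ∸ r)))
  main : Dec (r ≤ q) → Dec (q ≤ p) → LHS p q r ≡ RHS
  main (no r≰q) _ = trans
    (∑-0 (upTo B) (λ b → *-0ʳ ⟦ b ∈[ q , p ]? ⟧ (∑-0 (upTo B) (λ c → ⟦⟧-no-* (c ∈[ r , q ]?) (λ (l , h) → r≰q (ℕ.≤-trans l h)) _))))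
    (sym (RHS≡0 (λ (e , _) → r≰q e)))
  main (yes _) (no q≰p) = trans
    (∑-0 (upTo B) (λ b → ⟦⟧-no-* (b ∈[ q , p ]?) (λ (l , h) → q≰p (ℕ.≤-trans l h)) _))
    (sym (RHS≡0 (λ (_ , e) → q≰p e)))
  main (yes r≤q) (yes q≤p) with ℕ.m≤n⇒∃[o]m+o≡n r≤q
  ... | e , refl with ℕ.m≤n⇒∃[o]m+o≡n q≤p
  ... | g , refl = trans (size (∣t∣ ≤? 3 * k))
    (cong (⟦ (3 ∣? ∣t∣) ×-dec (∣t∣ ≤? 3 * k) ⟧ ·_) (trans (cong ψ (sym (ℕ.m+n∸m≡n r e)))
      (sym (⟦⟧-yes-* ((r ≤? r + e) ×-dec (r + e ≤? r + e + g)) (r≤q , q≤p) (ψ (r + e ∸ r))))))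
    where
    ∣t∣ : ℕ
    ∣t∣ = r + e + g + (r + e) + r
    size : Dec (∣t∣ ≤ 3 * k) → LHS (r + e + g) (r + e) r ≡ ⟦ (3 ∣? ∣t∣) ×-dec (∣t∣ ≤? 3 * k) ⟧ · ψ e
    size (no ≰3k) = trans
      (∑-0 (upTo B) (λ b → trans (⟦⟧-*-congʳ (b ∈[ r + e , r + e + g ]?) {y = 0ℤ} (λ (q≤b , _) → ∑-0 (upTo B) (λ c →
        trans (⟦⟧-*-congʳ (c ∈[ r , r + e ]?) {y = 0ℤ} (λ (r≤c , _) →
          ⟦⟧-no-* (r + e + g + b + c ≤? 3 * k) (λ le → ≰3k (ℕ.≤-trans (ℕ.+-mono-≤ (ℕ.+-monoʳ-≤ (r + e + g) q≤b) r≤c) le)) (ψ (b ∸ c))))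
          (ℤ.*-zeroʳ ⟦ c ∈[ r , r + e ]? ⟧))))
        (ℤ.*-zeroʳ ⟦ b ∈[ r + e , r + e + g ]? ⟧)))
      (sym (⟦⟧-no-* ((3 ∣? ∣t∣) ×-dec (∣t∣ ≤? 3 * k)) (λ (_ , le) → ≰3k le) (ψ e)))
    size (yes ≤3k) with ℕ.m≤n⇒∃[o]m+o≡n ≤3k
    ... | W , t+W≡3k = begin
      _ ≡⟨ ∑<-interval B (r + e) g _ p<B ⟩
      _ ≡⟨ ∑-cong (upTo (suc g)) (λ v → ∑<-interval B r e _ (ℕ.≤-<-trans (ℕ.m≤m+n (r + e) g) p<B)) ⟩
      ∑< (suc g) (λ v → ∑< (suc e) (λ u → ⟦ r + e + g + (r + e + v) + (r + u) ≤? 3 * k ⟧ · ψ (r + e + v ∸ (r + u))))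
        ≡⟨ ∑-swap (upTo (suc g)) (upTo (suc e)) _ ⟩
      ∑< (suc e) (λ u → ∑< (suc g) (λ v → ⟦ r + e + g + (r + e + v) + (r + u) ≤? 3 * k ⟧ · ψ (r + e + v ∸ (r + u))))
        ≡⟨ ∑<-cong (suc e) (λ { u (s≤s u≤e) → ∑-cong (upTo (suc g)) (λ v → cong₂ _·_
             (⟦⟧-⇔ (r + e + g + (r + e + v) + (r + u) ≤? 3 * k) (u + v ≤? W)
               (λ le → ℕ.+-cancelˡ-≤ ∣t∣ (u + v) W (subst₂ _≤_ (shift r e g u v) (sym t+W≡3k) le))
               (λ le → subst₂ _≤_ (sym (shift r e g u v)) t+W≡3k (ℕ.+-monoʳ-≤ ∣t∣ le)))
             (residue u v u≤e)) }) ⟩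
      ∑< (suc e) (λ u → ∑< (suc g) (λ v → ⟦ u + v ≤? W ⟧ · ψ (e + 2 * u + v))) ≡⟨ ∑-ψ-region e g W div ⟩
      ε₃ W · ψ e ≡⟨ cong (_· ψ e) (trans (ε₃≡ W) (⟦∣⟧-complement 3 W ∣t∣
                      (subst (3 ∣_) (trans (sym t+W≡3k) (ℕ.+-comm ∣t∣ W)) (m∣m*n k)))) ⟩
      ⟦ 3 ∣? ∣t∣ ⟧ · ψ e ≡⟨ cong (_· ψ e) (⟦⟧-⇔ (3 ∣? ∣t∣) ((3 ∣? ∣t∣) ×-dec (∣t∣ ≤? 3 * k)) (λ d → d , ≤3k) proj₁) ⟩
      _ ∎
      where
      p<B : r + e + g < B
      p<B = ℕ.≤-<-trans (ℕ.≤-trans (ℕ.m≤m+n (r + e + g) (r + e)) (ℕ.≤-trans (ℕ.m≤m+n (r + e + g + (r + e)) r) ≤3k)) lt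
      shift : ∀ r e g u v → r + e + g + (r + e + v) + (r + u) ≡ r + e + g + (r + e) + r + (u + v)
      shift = ℕSolver.solve-∀
      triple : ∀ r e g W → r + e + g + (r + e) + r + W ≡ 3 * r + (W + g + 2 * e)
      triple = ℕSolver.solve-∀
      -- From |t| + W = 3k and |t| = 3r + 2e + g.
      div : 3 ∣ W + g + 2 * e
      div = ∣m+n∣m⇒∣n (subst (3 ∣_) (trans (sym t+W≡3k) (triple r e g W)) (m∣m*n k)) (m∣m*n r)
      -- Modulo 3 the term -u is replaced by 2u, which removes the truncated subtraction.
      residue : ∀ u v → u ≤ e → ψ (r + e + v ∸ (r + u)) ≡ ψ (e + 2 * u + v)
      residue u v u≤e with ℕ.m≤n⇒∃[o]m+o≡n u≤e
      ... | w , refl = begin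
        ψ (r + (u + w) + v ∸ (r + u)) ≡⟨ cong (λ z → ψ (z ∸ (r + u))) (assoc r u w v) ⟩
        ψ (r + u + (w + v) ∸ (r + u)) ≡⟨ cong ψ (ℕ.m+n∸m≡n (r + u) (w + v)) ⟩
        ψ (w + v) ≡⟨ ψ-3*+ u (w + v) ⟨
        ψ (3 * u + (w + v)) ≡⟨ cong ψ (assoc' u w v) ⟩
        ψ (u + w + 2 * u + v) ∎
        where
        assoc : ∀ r u w v → r + (u + w) + v ≡ r + u + (w + v)
        assoc = ℕSolver.solve-∀
        assoc' : ∀ u w v → 3 * u + (w + v) ≡ u + w + 2 * u + v
        assoc' = ℕSolver.solve-∀

-- Expansions of h_k³, p₂[h_k] h_k and p₃[h_k]

map-1* : ∀ {n} (β : Vec ℕ n) → Vec.map (1 *_) β ≡ β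
map-1* []      = refl
map-1* (x ∷ β) = cong₂ _∷_ (ℕ.*-identityˡ x) (map-1* β)

twoRow : ℕ → ℕ → Shape
twoRow k x = 2 * k ∸ x , x , 0

-- In size 2k, a horizontal strip over (k) and a partition with at most two rows are the same thing.
-- Keeping `V` general serves both h_k² and p₂[h_k], which thereby become sums over the same x.
∑-two-row : ∀ B k → 2 * k < B → {V : Shape → Set} (V? : ∀ s → Dec (V s)) →
  (∀ a b c → a + b + c ≡ 2 * k → V (a , b , c) → c ≡ 0 × b ≤ k) →
  (∀ x → x ≤ k → V (twoRow k x)) → ∀ (X : Shape → ℤ) →
  ∑ (box B) (λ s → ⟦ ∣ s ∣ ≟ 2 * k ⟧ · (⟦ V? s ⟧ · X s)) ≡ ∑< (suc k) (λ x → X (twoRow k x))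
∑-two-row B k lt {V} V? h₁ h₂ X = begin
  _ ≡⟨ ∑-box-rot B _ ⟩
  ∑< B (λ b → ∑< B (λ c → ∑< B (λ a → ⟦ a + b + c ≟ 2 * k ⟧ · (⟦ V? (a , b , c) ⟧ · X (a , b , c)))))
    ≡⟨ ∑-cong (upTo B) (λ b → trans (∑-cong (upTo B) (first b)) (third b)) ⟩
  ∑< B (λ b → ⟦ b ≤? k ⟧ · X (2 * k ∸ b , b , 0))
    ≡⟨ ∑<-extend B k (λ x → X (twoRow k x)) (ℕ.≤-<-trans (ℕ.m≤m+n k (k + 0)) lt) ⟨
  _ ∎
  where
  P? : ∀ b c a → Dec (a + b + c ≡ 2 * k × V (a , b , c))
  P? b c a = (a + b + c ≟ 2 * k) ×-dec V? (a , b , c)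
  drop : ∀ b → b ≤ k → 2 * k ∸ b + b + 0 ≡ 2 * k
  drop b b≤k = trans (ℕ.+-identityʳ _) (ℕ.m∸n+n≡m (ℕ.≤-trans b≤k (ℕ.m≤m+n k (k + 0))))
  first : ∀ b c → ∑< B (λ a → ⟦ a + b + c ≟ 2 * k ⟧ · (⟦ V? (a , b , c) ⟧ · X (a , b , c))) ≡
    ⟦ (c ≟ 0) ×-dec (b ≤? k) ⟧ · X (2 * k ∸ b , b , c)
  first b c = trans (∑-cong (upTo B) (λ a → ⟦⟧-nest (a + b + c ≟ 2 * k) (V? (a , b , c)) (X (a , b , c))))
    (∑<-collapse B (P? b c) ((c ≟ 0) ×-dec (b ≤? k)) (2 * k ∸ b) (λ a → X (a , b , c))
      (λ { a _ (e , v) → let (c≡0 , b≤k) = h₁ a b c e v in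
           sym (trans (cong (_∸ b) (trans (sym e) (trans (cong (λ z → a + b + z) c≡0) (ℕ.+-identityʳ (a + b))))) (ℕ.m+n∸n≡m a b)) , c≡0 , b≤k })
      (λ { (refl , b≤k) → drop b b≤k , h₂ b b≤k })
      (λ _ → ℕ.≤-<-trans (ℕ.m∸n≤m (2 * k) b) lt))
  third : ∀ b → ∑< B (λ c → ⟦ (c ≟ 0) ×-dec (b ≤? k) ⟧ · X (2 * k ∸ b , b , c)) ≡ ⟦ b ≤? k ⟧ · X (2 * k ∸ b , b , 0)
  third b = ∑<-collapse B (λ c → (c ≟ 0) ×-dec (b ≤? k)) (b ≤? k) 0 (λ c → X (2 * k ∸ b , b , c))
    (λ _ _ p → p) (refl ,_) (λ _ → ℕ.≤-<-trans z≤n lt)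

∑-row-k : ∀ B k → 2 * k < B → ∀ (X : Shape → ℤ) →
  ∑ (box B) (λ s → ⟦ ∣ s ∣ ≟ 2 * k ⟧ · (⟦ s ≽? (k , 0 , 0) ⟧ · X s)) ≡ ∑< (suc k) (λ x → X (twoRow k x))
∑-row-k B k lt = ∑-two-row B k lt (_≽? (k , 0 , 0)) (λ _ _ _ _ ((_ , b≤k) , (_ , c≤0) , _) → ℕ.n≤0⇒n≡0 c≤0 , b≤k)
  (λ x x≤k → (ℕ.m+n≤o⇒m≤o∸n k (ℕ.+-monoʳ-≤ k (subst (x ≤_) (sym (ℕ.+-identityʳ k)) x≤k)) , x≤k) , (z≤n , z≤n) , z≤n)

-- S ∈ SSYT_(k,k,k) of shape s is determined by the number x of 2's in its second row,
-- since its entries 1 and 2 occupy the shape (2k − x , x).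
multiplicity : ℕ → (ℕ → ℤ) → Shape → ℤ
multiplicity k w s = ∑< (suc k) (λ x → ⟦ s ≽? twoRow k x ⟧ · w x)

module Expansions (k n : ℕ) where

  B : ℕ
  B = suc (3 * k)

  1k<B : 1 * k < B
  1k<B = s≤s (ℕ.*-monoˡ-≤ k {1} {3} (s≤s z≤n))

  2k<B : 2 * k < B
  2k<B = s≤s (ℕ.*-monoˡ-≤ k {2} {3} (s≤s (s≤s z≤n)))

  -- The case d = 1 of the power sum expansion, as p₁[h_k] = h_k; it identifies the sum over all
  -- monomials with the one-row Schur function, to which `pieri` applies.
  h : (G : Vec ℕ n → ℤ) → ∑ (monomials n k) G ≡ schur n (k , 0 , 0) G
  h G = begin
    ∑ (monomials n k) G ≡⟨ ∑-cong (monomials n k) (λ β → cong G (sym (map-1* β))) ⟩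
    ∑ (monomials n k) (λ β → G (Vec.map (1 *_) β)) ≡⟨ PowerSum.expansion B 0 coeff₁ refl (compatible₁ B) n k 1k<B G ⟩
    ∑ (box B) (λ s → ⟦ ∣ s ∣ ≟ 1 * k ⟧ · (coeff₁ s · schur n s G))
      ≡⟨ ∑-cong (box B) (λ { s@(a , b , c) → ⟦⟧-nest (∣ s ∣ ≟ 1 * k) ((b ≟ 0) ×-dec (c ≟ 0)) (schur n s G) }) ⟩
    ∑ (box B) (λ s → ⟦ P? s ⟧ · schur n s G)
      ≡⟨ ∑-box-collapse B P? (0 ≟ 0) k 0 0 (λ s → schur n s G)
           (λ { (a , _ , _) (e , refl , refl) → cong (_, 0 , 0) (trans (sym (+0+0 a)) (trans e (ℕ.*-identityˡ k))) , refl })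
           (λ _ → trans (+0+0 k) (sym (ℕ.*-identityˡ k)) , refl , refl)
           (λ _ → subst (_< B) (ℕ.*-identityˡ k) 1k<B , s≤s z≤n , s≤s z≤n) ⟩
    1ℤ · schur n (k , 0 , 0) G ≡⟨ ℤ.*-identityˡ (schur n (k , 0 , 0) G) ⟩
    schur n (k , 0 , 0) G ∎
    where
    P? : ∀ ((a , b , c) : Shape) → Dec (a + b + c ≡ 1 * k × b ≡ 0 × c ≡ 0)
    P? (a , b , c) = (a + b + c ≟ 1 * k) ×-dec ((b ≟ 0) ×-dec (c ≟ 0))

  hh : (G : Vec ℕ n → ℤ) → ∑ (monomials n k) (λ γ → ∑ (monomials n k) (λ β → G (β ⊕ γ))) ≡
    ∑< (suc k) (λ x → 1ℤ · schur n (twoRow k x) G)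
  hh G = begin
    _ ≡⟨ ∑-cong (monomials n k) (λ γ → h (λ β → G (β ⊕ γ))) ⟩
    ∑ (monomials n k) (λ γ → schur n (k , 0 , 0) (λ β → G (β ⊕ γ)))
      ≡⟨ pieri B n k 0 k (subst (_< B) (sym two) 2k<B) G ⟩
    ∑ (box B) (λ s → ⟦ ∣ s ∣ ≟ k + 0 + k ⟧ · (⟦ s ≽? (k , 0 , 0) ⟧ · schur n s G))
      ≡⟨ cong (λ z → ∑ (box B) (λ s → ⟦ ∣ s ∣ ≟ z ⟧ · (⟦ s ≽? (k , 0 , 0) ⟧ · schur n s G))) two ⟩
    ∑ (box B) (λ s → ⟦ ∣ s ∣ ≟ 2 * k ⟧ · (⟦ s ≽? (k , 0 , 0) ⟧ · schur n s G))
      ≡⟨ ∑-row-k B k 2k<B (λ s → schur n s G) ⟩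
    ∑< (suc k) (λ x → schur n (twoRow k x) G) ≡⟨ ∑-cong (upTo (suc k)) (λ x → sym (ℤ.*-identityˡ (schur n (twoRow k x) G))) ⟩
    _ ∎
    where
    two : k + 0 + k ≡ 2 * k
    two = trans (cong (_+ k) (ℕ.+-identityʳ k)) (cong (λ z → k + z) (sym (ℕ.+-identityʳ k)))

  p₂ : (G : Vec ℕ n → ℤ) → ∑ (monomials n k) (λ β → G (Vec.map (2 *_) β)) ≡
    ∑< (suc k) (λ x → sgn x · schur n (twoRow k x) G)
  p₂ G = begin
    _ ≡⟨ PowerSum.expansion B 1 coeff₂ refl (compatible₂ B) n k 2k<B G ⟩
    ∑ (box B) (λ s → ⟦ ∣ s ∣ ≟ 2 * k ⟧ · (coeff₂ s · schur n s G))
      ≡⟨ ∑-cong (box B) (λ { s@(a , b , c) → cong (⟦ ∣ s ∣ ≟ 2 * k ⟧ ·_) (ℤ.*-assoc ⟦ (c ≟ 0) ×-dec (b ≤? a) ⟧ (sgn b) (schur n s G)) }) ⟩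
    ∑ (box B) (λ s → ⟦ ∣ s ∣ ≟ 2 * k ⟧ · (⟦ V? s ⟧ · X s))
      ≡⟨ ∑-two-row B k 2k<B V?
           (λ { a b c e (refl , b≤a) → refl , half a b (trans (sym (ℕ.+-identityʳ (a + b))) e) b≤a })
           (λ x x≤k → refl , ℕ.m+n≤o⇒m≤o∸n x (ℕ.+-mono-≤ x≤k (subst (x ≤_) (sym (ℕ.+-identityʳ k)) x≤k))) X ⟩
    _ ∎
    where
    V? : ∀ ((a , b , c) : Shape) → Dec (c ≡ 0 × b ≤ a)
    V? (a , b , c) = (c ≟ 0) ×-dec (b ≤? a)
    X : Shape → ℤ
    X (a , b , c) = sgn b · schur n (a , b , c) G
    half : ∀ a b → a + b ≡ 2 * k → b ≤ a → b ≤ k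
    half a b e b≤a = ℕ.*-cancelˡ-≤ 2 (subst (2 * b ≤_) e (ℕ.+-mono-≤ b≤a (ℕ.≤-reflexive (ℕ.+-identityʳ b))))

  -- By the Pieri rule the last factor h_k contributes the strip of 3's, so the coefficient of s_s
  -- becomes a weighted count of the tableaux of shape s in SSYT_(k,k,k).
  times-h : ∀ w (G : Vec ℕ n → ℤ) →
    ∑ (monomials n k) (λ γ → ∑< (suc k) (λ x → w x · schur n (twoRow k x) (λ α → G (α ⊕ γ)))) ≡
    ∑ (box B) (λ s → ⟦ ∣ s ∣ ≟ 3 * k ⟧ · (multiplicity k w s · schur n s G))
  times-h w G = begin
    _ ≡⟨ ∑-∑-*ˡ (monomials n k) (upTo (suc k)) w _ ⟩
    ∑< (suc k) (λ x → w x · ∑ (monomials n k) (λ γ → schur n (twoRow k x) (λ α → G (α ⊕ γ))))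
      ≡⟨ ∑<-cong (suc k) (λ { x (s≤s x≤k) → cong (w x ·_) (trans
           (pieri B n (2 * k ∸ x) x k (subst (_< B) (sym (three x x≤k)) ℕ.≤-refl) G)
           (cong (λ z → ∑ (box B) (λ s → ⟦ ∣ s ∣ ≟ z ⟧ · (⟦ s ≽? twoRow k x ⟧ · schur n s G))) (three x x≤k))) }) ⟩
    ∑< (suc k) (λ x → w x · ∑ (box B) (λ s → ⟦ ∣ s ∣ ≟ 3 * k ⟧ · (⟦ s ≽? twoRow k x ⟧ · schur n s G)))
      ≡⟨ trans (∑-cong (upTo (suc k)) (λ x → ∑-*ˡ (box B) (w x) _)) (∑-swap (upTo (suc k)) (box B) _) ⟩
    ∑ (box B) (λ s → ∑< (suc k) (λ x → w x · (⟦ ∣ s ∣ ≟ 3 * k ⟧ · (⟦ s ≽? twoRow k x ⟧ · schur n s G))))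
      ≡⟨ ∑-cong (box B) (λ s → trans (∑-cong (upTo (suc k)) (λ x → shuffle (w x) ⟦ ∣ s ∣ ≟ 3 * k ⟧ ⟦ s ≽? twoRow k x ⟧ (schur n s G)))
           (trans (sym (∑-*ˡ (upTo (suc k)) ⟦ ∣ s ∣ ≟ 3 * k ⟧ _)) (cong (⟦ ∣ s ∣ ≟ 3 * k ⟧ ·_) (sym (∑-*ʳ (upTo (suc k)) _ (schur n s G)))))) ⟩
    _ ∎
    where
    shuffle : ∀ p q r x → p · (q · (r · x)) ≡ q · ((r · p) · x)
    shuffle = ℤSolver.solve-∀
    three : ∀ x → x ≤ k → 2 * k ∸ x + x + k ≡ 3 * k
    three x x≤k = trans (cong (_+ k) (ℕ.m∸n+n≡m (ℕ.≤-trans x≤k (ℕ.m≤m+n k (k + 0))))) (ℕ.+-comm (2 * k) k)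

  hhh : (G : Vec ℕ n → ℤ) →
    ∑ (monomials n k) (λ δ → ∑ (monomials n k) (λ γ → ∑ (monomials n k) (λ β → G (β ⊕ γ ⊕ δ)))) ≡
    ∑ (box B) (λ s → ⟦ ∣ s ∣ ≟ 3 * k ⟧ · (multiplicity k (λ _ → 1ℤ) s · schur n s G))
  hhh G = trans (∑-cong (monomials n k) (λ δ → hh (λ α → G (α ⊕ δ)))) (times-h (λ _ → 1ℤ) G)

  p₂h : (G : Vec ℕ n → ℤ) →
    ∑ (monomials n k) (λ γ → ∑ (monomials n k) (λ β → G (Vec.map (2 *_) β ⊕ γ))) ≡
    ∑ (box B) (λ s → ⟦ ∣ s ∣ ≟ 3 * k ⟧ · (multiplicity k sgn s · schur n s G))
  p₂h G = trans (∑-cong (monomials n k) (λ γ → p₂ (λ α → G (α ⊕ γ)))) (times-h sgn G)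

  p₃ : (G : Vec ℕ n → ℤ) → ∑ (monomials n k) (λ β → G (Vec.map (3 *_) β)) ≡
    ∑ (box B) (λ s → ⟦ ∣ s ∣ ≟ 3 * k ⟧ · (coeff₃ s · schur n s G))
  p₃ G = PowerSum.expansion B 2 coeff₃ refl (compatible₃ B) n k ℕ.≤-refl G

-- Sums over triples of letters

[≤ᵇ]+[<ᵇ] : ∀ m n → [ m ≤ᵇ n ]ᵇ +ℤ [ n <ᵇ m ]ᵇ ≡ 1ℤ
[≤ᵇ]+[<ᵇ] zero    zero    = refl
[≤ᵇ]+[<ᵇ] zero    (suc n) = refl
[≤ᵇ]+[<ᵇ] (suc m) zero    = refl
[≤ᵇ]+[<ᵇ] (suc zero)    (suc n) = refl
[≤ᵇ]+[<ᵇ] (suc (suc m)) (suc n) = [≤ᵇ]+[<ᵇ] (suc m) n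

[≤ᵇ]≡[<ᵇ]+[≡ᵇ] : ∀ m n → [ m ≤ᵇ n ]ᵇ ≡ [ m <ᵇ n ]ᵇ +ℤ [ m ≡ᵇ n ]ᵇ
[≤ᵇ]≡[<ᵇ]+[≡ᵇ] zero    zero    = refl
[≤ᵇ]≡[<ᵇ]+[≡ᵇ] zero    (suc n) = refl
[≤ᵇ]≡[<ᵇ]+[≡ᵇ] (suc m) zero    = refl
[≤ᵇ]≡[<ᵇ]+[≡ᵇ] (suc zero)    (suc zero)    = refl
[≤ᵇ]≡[<ᵇ]+[≡ᵇ] (suc zero)    (suc (suc n)) = refl
[≤ᵇ]≡[<ᵇ]+[≡ᵇ] (suc (suc m)) (suc n) = [≤ᵇ]≡[<ᵇ]+[≡ᵇ] (suc m) n

-- Exactly one of the three rotations of (i , j , l) satisfies x ≤ y, x < z, unless i = j = l.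
rotations : ∀ i j l →
  ([ i ≤ᵇ j ]ᵇ · [ i <ᵇ l ]ᵇ +ℤ ([ j ≤ᵇ l ]ᵇ · [ j <ᵇ i ]ᵇ +ℤ [ l ≤ᵇ i ]ᵇ · [ l <ᵇ j ]ᵇ))
    +ℤ [ i ≡ᵇ j ]ᵇ · [ j ≡ᵇ l ]ᵇ ≡ 1ℤ
rotations zero    zero    zero    = refl
rotations zero    zero    (suc l) = refl
rotations zero    (suc j) zero    = refl
rotations (suc i) zero    zero    = refl
rotations zero    (suc j) (suc l) rewrite ℤ.*-zeroʳ [ j <ᵇ suc l ]ᵇ = refl
rotations (suc i) zero    (suc l) rewrite ℤ.*-zeroʳ [ l <ᵇ suc i ]ᵇ = refl
rotations (suc i) (suc j) zero    rewrite ℤ.*-zeroʳ [ i <ᵇ suc j ]ᵇ | ℤ.*-zeroʳ [ i ≡ᵇ j ]ᵇ = refl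
rotations (suc i) (suc j) (suc l) = trans
  (cong₂ _+ℤ_ (cong₂ _+ℤ_ (cong (_· [ i <ᵇ l ]ᵇ) (cong [_]ᵇ (≤ᵇ-suc i j)))
    (cong₂ _+ℤ_ (cong (_· [ j <ᵇ i ]ᵇ) (cong [_]ᵇ (≤ᵇ-suc j l))) (cong (_· [ l <ᵇ j ]ᵇ) (cong [_]ᵇ (≤ᵇ-suc l i))))) refl)
  (rotations i j l)

∑-allFin-collapse : ∀ N (i : Fin N) (f : Fin N → ℤ) → ∑ (allFin N) (λ j → [ toℕ i ≡ᵇ toℕ j ]ᵇ · f j) ≡ f i
∑-allFin-collapse (suc N) fzero f = trans (∑-∷ fzero (List.tabulate fsuc) _) (trans (cong₂ _+ℤ_ (ℤ.*-identityˡ (f fzero))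
  (trans (∑-tabulate fsuc _) (∑-0 (allFin N) (λ _ → refl)))) (ℤ.+-identityʳ (f fzero)))
∑-allFin-collapse (suc N) (fsuc i) f = trans (∑-∷ fzero (List.tabulate fsuc) _) (trans (ℤ.+-identityˡ _)
  (trans (∑-tabulate fsuc _) (∑-allFin-collapse N i (f ∘ fsuc))))

module SymmetricTriples (N : ℕ) (F : Fin N → Fin N → Fin N → ℤ)
  (F-swap₁ : ∀ i j l → F i j l ≡ F j i l) (F-swap₂ : ∀ i j l → F i j l ≡ F i l j) where

  ∑³ : (Fin N → Fin N → Fin N → ℤ) → ℤ
  ∑³ f = ∑ (allFin N) λ i → ∑ (allFin N) λ j → ∑ (allFin N) λ l → f i j l

  ∑³-cong : ∀ {f g : Fin N → Fin N → Fin N → ℤ} → (∀ i j l → f i j l ≡ g i j l) → ∑³ f ≡ ∑³ g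
  ∑³-cong h = ∑-cong (allFin N) λ i → ∑-cong (allFin N) λ j → ∑-cong (allFin N) λ l → h i j l

  ∑³-+ : ∀ f g → ∑³ (λ i j l → f i j l +ℤ g i j l) ≡ ∑³ f +ℤ ∑³ g
  ∑³-+ f g = trans (∑-cong (allFin N) λ i → trans (∑-cong (allFin N) λ j → ∑-+ (allFin N) (f i j) (g i j))
    (∑-+ (allFin N) _ _)) (∑-+ (allFin N) _ _)

  ∑³-swap₁ : ∀ f → ∑³ f ≡ ∑³ (λ i j l → f j i l)
  ∑³-swap₁ f = ∑-swap (allFin N) (allFin N) _

  ∑³-swap₂ : ∀ f → ∑³ f ≡ ∑³ (λ i j l → f i l j)
  ∑³-swap₂ f = ∑-cong (allFin N) λ i → ∑-swap (allFin N) (allFin N) _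

  ∑³-rotate : ∀ f → ∑³ f ≡ ∑³ (λ i j l → f l i j)
  ∑³-rotate f = trans (∑³-swap₁ f) (∑³-swap₂ (λ i j l → f j i l))

  F-rotate : ∀ i j l → F l i j ≡ F i j l
  F-rotate i j l = trans (F-swap₁ l i j) (F-swap₂ i l j)

  _≤′_ _<′_ _≡′_ : Fin N → Fin N → ℤ
  i ≤′ j = [ toℕ i ≤ᵇ toℕ j ]ᵇ
  i <′ j = [ toℕ i <ᵇ toℕ j ]ᵇ
  i ≡′ j = [ toℕ i ≡ᵇ toℕ j ]ᵇ

  -- The first three sum over fillings of the shapes (3), (2,1) and (1,1,1); in the hook, i and j
  -- form the first row and l stands below i. The others are the corresponding values of p₁³, p₂ p₁
  -- and p₃.
  row hook column all diagonal total : ℤ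
  row      = ∑³ (λ i j l → (i ≤′ j · j ≤′ l) · F i j l)
  hook     = ∑³ (λ i j l → (i ≤′ j · i <′ l) · F i j l)
  column   = ∑³ (λ i j l → (i <′ j · j <′ l) · F i j l)
  all      = ∑³ F
  diagonal = ∑ (allFin N) λ i → ∑ (allFin N) λ l → F i i l
  total    = ∑ (allFin N) λ i → F i i i

  rotated : ∀ (p : Fin N → Fin N → Fin N → ℤ) → ∑³ (λ i j l → p i j l · F i j l) ≡ ∑³ (λ i j l → p l i j · F i j l)
  rotated p = trans (∑³-rotate (λ i j l → p i j l · F i j l)) (∑³-cong (λ i j l → cong (p l i j ·_) (F-rotate i j l)))

  swapped₂ : ∀ (p : Fin N → Fin N → Fin N → ℤ) → ∑³ (λ i j l → p i j l · F i j l) ≡ ∑³ (λ i j l → p i l j · F i j l)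
  swapped₂ p = trans (∑³-swap₂ (λ i j l → p i j l · F i j l)) (∑³-cong (λ i j l → cong (p i l j ·_) (sym (F-swap₂ i j l))))

  swapped₁ : ∀ (p : Fin N → Fin N → Fin N → ℤ) → ∑³ (λ i j l → p i j l · F i j l) ≡ ∑³ (λ i j l → p j i l · F i j l)
  swapped₁ p = trans (∑³-swap₁ (λ i j l → p i j l · F i j l)) (∑³-cong (λ i j l → cong (p j i l ·_) (sym (F-swap₁ i j l))))

  merged : ∀ (p q r : Fin N → Fin N → Fin N → ℤ) → (∀ i j l → p i j l +ℤ q i j l ≡ r i j l) →
    ∑³ (λ i j l → p i j l · F i j l) +ℤ ∑³ (λ i j l → q i j l · F i j l) ≡ ∑³ (λ i j l → r i j l · F i j l)
  merged p q r h = trans (sym (∑³-+ _ _)) (∑³-cong (λ i j l →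
    trans (sym (ℤ.*-distribʳ-+ (F i j l) (p i j l) (q i j l))) (cong (_· F i j l) (h i j l))))

  factor : ∀ a b c → b +ℤ c ≡ 1ℤ → a · b +ℤ a · c ≡ a
  factor a b c e = trans (sym (ℤ.*-distribˡ-+ a b c)) (trans (cong (a ·_) e) (ℤ.*-identityʳ a))

  -- This is s_(3) + s_(2,1) = h₂ p₁. By symmetry of F the row condition can be rotated to l ≤ i ≤
  -- j, the complement of i < l among the triples with i ≤ j.
  row+hook : row +ℤ hook ≡ ∑³ (λ i j l → i ≤′ j · F i j l)
  row+hook = trans (cong (_+ℤ hook) (rotated (λ i j l → i ≤′ j · j ≤′ l)))
    (merged (λ i j l → l ≤′ i · i ≤′ j) (λ i j l → i ≤′ j · i <′ l) (λ i j l → i ≤′ j)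
      (λ i j l → trans (cong (_+ℤ i ≤′ j · i <′ l) (ℤ.*-comm (l ≤′ i) (i ≤′ j)))
        (factor (i ≤′ j) (l ≤′ i) (i <′ l) ([≤ᵇ]+[<ᵇ] (toℕ l) (toℕ i)))))

  -- This is s_(2,1) + s_(1,1,1) = e₂ p₁: after permuting letters, i < j splits into the cases i ≤ l
  -- and l < i.
  hook+column : hook +ℤ column ≡ ∑³ (λ i j l → i <′ j · F i j l)
  hook+column = trans (cong₂ _+ℤ_ (swapped₂ (λ i j l → i ≤′ j · i <′ l)) (rotated (λ i j l → i <′ j · j <′ l)))
    (merged (λ i j l → i ≤′ l · i <′ j) (λ i j l → l <′ i · i <′ j) (λ i j l → i <′ j)
      (λ i j l → trans (cong₂ _+ℤ_ (ℤ.*-comm (i ≤′ l) (i <′ j)) (ℤ.*-comm (l <′ i) (i <′ j)))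
        (factor (i <′ j) (i ≤′ l) (l <′ i) ([≤ᵇ]+[<ᵇ] (toℕ i) (toℕ l)))))

  p₁³ : (row +ℤ hook) +ℤ (hook +ℤ column) ≡ all
  p₁³ = begin
    (row +ℤ hook) +ℤ (hook +ℤ column) ≡⟨ cong₂ _+ℤ_ row+hook (trans hook+column (swapped₁ (λ i j l → i <′ j))) ⟩
    ∑³ (λ i j l → i ≤′ j · F i j l) +ℤ ∑³ (λ i j l → j <′ i · F i j l)
      ≡⟨ merged (λ i j l → i ≤′ j) (λ i j l → j <′ i) (λ _ _ _ → 1ℤ) (λ i j l → [≤ᵇ]+[<ᵇ] (toℕ i) (toℕ j)) ⟩
    ∑³ (λ i j l → 1ℤ · F i j l) ≡⟨ ∑³-cong (λ i j l → ℤ.*-identityˡ (F i j l)) ⟩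
    all ∎

  p₂p₁ : (row +ℤ hook) -ℤ (hook +ℤ column) ≡ diagonal
  p₂p₁ = begin
    (row +ℤ hook) -ℤ (hook +ℤ column) ≡⟨ cong₂ _-ℤ_ row+hook hook+column ⟩
    ∑³ (λ i j l → i ≤′ j · F i j l) -ℤ ∑³ (λ i j l → i <′ j · F i j l)
      ≡⟨ cong (_-ℤ ∑³ (λ i j l → i <′ j · F i j l)) (merged (λ i j l → i <′ j) (λ i j l → i ≡′ j) (λ i j l → i ≤′ j)
           (λ i j l → sym ([≤ᵇ]≡[<ᵇ]+[≡ᵇ] (toℕ i) (toℕ j)))) ⟨
    (∑³ (λ i j l → i <′ j · F i j l) +ℤ ∑³ (λ i j l → i ≡′ j · F i j l)) -ℤ ∑³ (λ i j l → i <′ j · F i j l)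
      ≡⟨ cancel (∑³ (λ i j l → i <′ j · F i j l)) (∑³ (λ i j l → i ≡′ j · F i j l)) ⟩
    ∑³ (λ i j l → i ≡′ j · F i j l)
      ≡⟨ ∑-cong (allFin N) (λ i → trans (∑-cong (allFin N) (λ j → sym (∑-*ˡ (allFin N) (i ≡′ j) (F i j))))
           (∑-allFin-collapse N i (λ j → ∑ (allFin N) (F i j)))) ⟩
    diagonal ∎
    where
    cancel : ∀ a b → (a +ℤ b) -ℤ a ≡ b
    cancel = ℤSolver.solve-∀

  -- The relation 3 s_(2,1) = p₁³ - p₃ isolates the hook at once: its three rotated conditions cover
  -- every nonconstant triple exactly once.
  p₁³-p₃ : (hook +ℤ (hook +ℤ hook)) +ℤ total ≡ all
  p₁³-p₃ = begin
    (hook +ℤ (hook +ℤ hook)) +ℤ total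
      ≡⟨ cong₂ _+ℤ_ (cong (hook +ℤ_) (cong₂ _+ℤ_
           (trans (rotated C) (rotated (λ i j l → C l i j))) (rotated C))) (sym total≡) ⟩
    (hook +ℤ (∑³ (λ i j l → C j l i · F i j l) +ℤ ∑³ (λ i j l → C l i j · F i j l))) +ℤ ∑³ (λ i j l → (i ≡′ j · j ≡′ l) · F i j l)
      ≡⟨ cong (_+ℤ ∑³ (λ i j l → (i ≡′ j · j ≡′ l) · F i j l)) (trans
           (cong (hook +ℤ_) (merged (λ i j l → C j l i) (λ i j l → C l i j) (λ i j l → C j l i +ℤ C l i j) (λ _ _ _ → refl)))
           (merged C (λ i j l → C j l i +ℤ C l i j) (λ i j l → C i j l +ℤ (C j l i +ℤ C l i j)) (λ _ _ _ → refl))) ⟩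
    _ ≡⟨ merged (λ i j l → C i j l +ℤ (C j l i +ℤ C l i j)) (λ i j l → i ≡′ j · j ≡′ l) (λ _ _ _ → 1ℤ)
           (λ i j l → rotations (toℕ i) (toℕ j) (toℕ l)) ⟩
    ∑³ (λ i j l → 1ℤ · F i j l) ≡⟨ ∑³-cong (λ i j l → ℤ.*-identityˡ (F i j l)) ⟩
    all ∎
    where
    C : Fin N → Fin N → Fin N → ℤ
    C i j l = i ≤′ j · i <′ l
    total≡ : ∑³ (λ i j l → (i ≡′ j · j ≡′ l) · F i j l) ≡ total
    total≡ = ∑-cong (allFin N) (λ i → trans (∑-cong (allFin N) (λ j → trans
        (∑-cong (allFin N) (λ l → ℤ.*-assoc (i ≡′ j) (j ≡′ l) (F i j l)))
        (trans (sym (∑-*ˡ (allFin N) (i ≡′ j) _)) (cong (i ≡′ j ·_) (∑-allFin-collapse N j (F i j))))))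
      (∑-allFin-collapse N i (λ j → F i j j)))

-- Plethysms with shapes of size 3 as sums over triples of monomials

∑-lookup : ∀ {A : Set} (xs : List A) (f : A → ℤ) → ∑ (allFin (length xs)) (λ i → f (List.lookup xs i)) ≡ ∑ xs f
∑-lookup xs f = trans (sym (∑-tabulate (List.lookup xs) f)) (cong (λ ys → ∑ ys f) (List.tabulate-lookup xs))

[]ᵇ-∧-∧ : ∀ a b c → [ (a ∧ b) ∧ c ]ᵇ ≡ ([ a ]ᵇ · [ b ]ᵇ) · [ c ]ᵇ
[]ᵇ-∧-∧ a b c = trans ([]ᵇ-∧ (a ∧ b) c) (cong (_· [ c ]ᵇ) ([]ᵇ-∧ a b))

module ThreeBoxes {n : ℕ} (ms : List (Vec ℕ n)) (α : Vec ℕ n) where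

  N : ℕ
  N = length ms

  w : Fin N → Vec ℕ n
  w = List.lookup ms

  E : Fin N → Fin N → Fin N → Bool
  E i j l = vecEqᵇ (w i ⊕ (w j ⊕ (w l ⊕ Vec.replicate n 0))) α

  F : Fin N → Fin N → Fin N → ℤ
  F i j l = [ E i j l ]ᵇ

  ⊕-swap : ∀ {n} (x y z : Vec ℕ n) → x ⊕ (y ⊕ z) ≡ y ⊕ (x ⊕ z)
  ⊕-swap []      []      []      = refl
  ⊕-swap (a ∷ x) (b ∷ y) (c ∷ z) = cong₂ _∷_ (swap a b c) (⊕-swap x y z)
    where
    swap : ∀ a b c → a + (b + c) ≡ b + (a + c)
    swap = ℕSolver.solve-∀

  open SymmetricTriples N F
    (λ i j l → cong (λ v → [ vecEqᵇ v α ]ᵇ) (⊕-swap (w i) (w j) _))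
    (λ i j l → cong (λ v → [ vecEqᵇ (w i ⊕ v) α ]ᵇ) (⊕-swap (w j) (w l) _)) public

  words-3 : ∀ (f : List (Fin N) → ℤ) → ∑ (words N 3) f ≡ ∑³ (λ i j l → f (i ∷ j ∷ l ∷ []))
  words-3 f = trans (∑-words-suc N 2 f) (∑-cong (allFin N) λ i → trans (∑-words-suc N 1 _)
    (∑-cong (allFin N) λ j → trans (∑-words-suc N 0 _) (∑-cong (allFin N) λ l → ∑-words-zero N _)))

  words-2 : ∀ (f : List (Fin N) → ℤ) → ∑ (words N 2) f ≡ ∑ (allFin N) λ i → ∑ (allFin N) λ j → f (i ∷ j ∷ [])
  words-2 f = trans (∑-words-suc N 1 f) (∑-cong (allFin N) λ i → trans (∑-words-suc N 0 _)
    (∑-cong (allFin N) λ j → ∑-words-zero N _))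

  words-1 : ∀ (f : List (Fin N) → ℤ) → ∑ (words N 1) f ≡ ∑ (allFin N) λ i → f (i ∷ [])
  words-1 f = trans (∑-words-suc N 0 f) (∑-cong (allFin N) λ i → ∑-words-zero N _)

  tableau-row : + schurSubstCoeff N w (3 ∷ []) α ≡ row
  tableau-row = trans (length-filterᵇ-∑ _ (fillings N (3 ∷ []))) (trans (∑-fillings-∷ N 3 [] _)
    (trans (∑-cong (words N 3) (λ r → ∑-fillings-[] N _)) (trans (words-3 _)
      (∑³-cong (λ i j l → trans (cong (λ b → [ b ∧ E i j l ]ᵇ) (cong ((toℕ i ≤ᵇ toℕ j) ∧_) (Bool.∧-identityʳ (toℕ j ≤ᵇ toℕ l))))
        ([]ᵇ-∧-∧ (toℕ i ≤ᵇ toℕ j) (toℕ j ≤ᵇ toℕ l) (E i j l)))))))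

  tableau-hook : + schurSubstCoeff N w (2 ∷ 1 ∷ []) α ≡ hook
  tableau-hook = trans (length-filterᵇ-∑ _ (fillings N (2 ∷ 1 ∷ []))) (trans (∑-fillings-∷ N 2 (1 ∷ []) _)
    (trans (∑-cong (words N 2) (λ r → trans (∑-fillings-∷ N 1 [] _) (∑-cong (words N 1) (λ r' → ∑-fillings-[] N _))))
      (trans (words-2 _) (trans (∑-cong (allFin N) λ i → ∑-cong (allFin N) λ j → words-1 _)
        (∑³-cong (λ i j l → trans (cong (λ b → [ b ∧ E i j l ]ᵇ) (simplify (toℕ i ≤ᵇ toℕ j) (toℕ i <ᵇ toℕ l)))
          ([]ᵇ-∧-∧ (toℕ i ≤ᵇ toℕ j) (toℕ i <ᵇ toℕ l) (E i j l))))))))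
    where
    simplify : ∀ a b → (a ∧ true) ∧ ((b ∧ true) ∧ true) ≡ a ∧ b
    simplify a b = cong₂ _∧_ (Bool.∧-identityʳ a) (trans (Bool.∧-identityʳ (b ∧ true)) (Bool.∧-identityʳ b))

  tableau-column : + schurSubstCoeff N w (1 ∷ 1 ∷ 1 ∷ []) α ≡ column
  tableau-column = trans (length-filterᵇ-∑ _ (fillings N (1 ∷ 1 ∷ 1 ∷ []))) (trans (∑-fillings-∷ N 1 (1 ∷ 1 ∷ []) _)
    (trans (∑-cong (words N 1) (λ r → trans (∑-fillings-∷ N 1 (1 ∷ []) _) (∑-cong (words N 1) (λ r' →
        trans (∑-fillings-∷ N 1 [] _) (∑-cong (words N 1) (λ r'' → ∑-fillings-[] N _))))))
      (trans (words-1 _) (trans (∑-cong (allFin N) λ i → trans (words-1 _) (∑-cong (allFin N) λ j → words-1 _))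
        (∑³-cong (λ i j l → trans (cong (λ b → [ b ∧ E i j l ]ᵇ) (simplify (toℕ i <ᵇ toℕ j) (toℕ j <ᵇ toℕ l)))
          ([]ᵇ-∧-∧ (toℕ i <ᵇ toℕ j) (toℕ j <ᵇ toℕ l) (E i j l))))))))
    where
    simplify : ∀ a b → (a ∧ true) ∧ ((b ∧ true) ∧ true) ≡ a ∧ b
    simplify a b = cong₂ _∧_ (Bool.∧-identityʳ a) (trans (Bool.∧-identityʳ (b ∧ true)) (Bool.∧-identityʳ b))

  G : Vec ℕ n → ℤ
  G β = [ vecEqᵇ β α ]ᵇ

  all≡ : all ≡ ∑ ms (λ δ → ∑ ms (λ γ → ∑ ms (λ β → G (β ⊕ γ ⊕ δ))))
  all≡ = trans (∑³-cong (λ i j l → cong G (reorder (w i) (w j) (w l))))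
    (trans (∑-cong (allFin N) λ i → trans (∑-cong (allFin N) λ j → ∑-lookup ms (λ β → G (β ⊕ w j ⊕ w i)))
      (∑-lookup ms (λ γ → ∑ ms (λ β → G (β ⊕ γ ⊕ w i)))))
    (∑-lookup ms (λ δ → ∑ ms (λ γ → ∑ ms (λ β → G (β ⊕ γ ⊕ δ))))))
    where
    reorder : ∀ {n} (x y z : Vec ℕ n) → x ⊕ (y ⊕ (z ⊕ Vec.replicate n 0)) ≡ z ⊕ y ⊕ x
    reorder []      []      []      = refl
    reorder (a ∷ x) (b ∷ y) (c ∷ z) = cong₂ _∷_ (swap a b c) (reorder x y z)
      where
      swap : ∀ a b c → a + (b + (c + 0)) ≡ (c + b) + a
      swap = ℕSolver.solve-∀

  diagonal≡ : diagonal ≡ ∑ ms (λ γ → ∑ ms (λ β → G (Vec.map (2 *_) β ⊕ γ)))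
  diagonal≡ = trans (∑-swap (allFin N) (allFin N) _) (trans (∑-cong (allFin N) λ l → ∑-cong (allFin N) λ i → cong G (double (w i) (w l)))
    (trans (∑-cong (allFin N) λ l → ∑-lookup ms (λ β → G (Vec.map (2 *_) β ⊕ w l)))
      (∑-lookup ms (λ γ → ∑ ms (λ β → G (Vec.map (2 *_) β ⊕ γ))))))
    where
    double : ∀ {n} (x z : Vec ℕ n) → x ⊕ (x ⊕ (z ⊕ Vec.replicate n 0)) ≡ Vec.map (2 *_) x ⊕ z
    double []      []      = refl
    double (a ∷ x) (c ∷ z) = cong₂ _∷_ (swap a c) (double x z)
      where
      swap : ∀ a c → a + (a + (c + 0)) ≡ 2 * a + c
      swap = ℕSolver.solve-∀

  total≡ : total ≡ ∑ ms (λ β → G (Vec.map (3 *_) β))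
  total≡ = trans (∑-cong (allFin N) λ i → cong G (triple (w i))) (∑-lookup ms (λ β → G (Vec.map (3 *_) β)))
    where
    triple : ∀ {n} (x : Vec ℕ n) → x ⊕ (x ⊕ (x ⊕ Vec.replicate n 0)) ≡ Vec.map (3 *_) x
    triple []      = refl
    triple (a ∷ x) = cong (_ ∷_) (triple x)

-- Counting types

chooseType : Bool → Bool → Std3
chooseType big even = if big then (if even then Ta else Td) else (if even then Tb else Tc)

fewRowsType : ℕ → ℕ → Std3
fewRowsType i j = chooseType ((2 * i ≤ᵇ j) ∧ not (j ≡ᵇ 2 * i + 1)) (i % 2 ≡ᵇ 0)

-- Type of a tableau with c columns of length 3, after whose removal row 2 has i 2's and j 3's.
shiftedType : ℕ → ℕ → ℕ → Std3
shiftedType zero    i j = fewRowsType i j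
shiftedType (suc c) i j = transpose3 (shiftedType c i j)

parity-suc : ∀ i → (suc i % 2 ≡ᵇ 0) ≡ not (i % 2 ≡ᵇ 0)
parity-suc zero          = refl
parity-suc (suc zero)    = refl
parity-suc (suc (suc i)) = parity-suc i

-- Both 2i ≤ j and the exceptional line j = 2i + 1 are invariant under this shift, while the parity
-- of i changes; and changing only the parity is transposition.
fewRowsType-suc : ∀ i j → fewRowsType (suc i) (2 + j) ≡ transpose3 (fewRowsType i j)
fewRowsType-suc i j = trans
  (cong₂ chooseType
    (trans (cong (λ z → (z ≤ᵇ 2 + j) ∧ not (2 + j ≡ᵇ z + 1)) (ℕ.*-suc 2 i))
      (cong (_∧ not (j ≡ᵇ 2 * i + 1)) (trans (≤ᵇ-suc (suc (2 * i)) (suc j)) (≤ᵇ-suc (2 * i) j))))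
    (parity-suc i))
  (choose-not ((2 * i ≤ᵇ j) ∧ not (j ≡ᵇ 2 * i + 1)) (i % 2 ≡ᵇ 0))
  where
  choose-not : ∀ big even → chooseType big (not even) ≡ transpose3 (chooseType big even)
  choose-not true  true  = refl
  choose-not true  false = refl
  choose-not false true  = refl
  choose-not false false = refl

-- Shifting by (1 , 2) transposes just as one more column of length 3 does, so e shifts can be
-- traded for e columns.
shiftedType-+ : ∀ c e i j → shiftedType c (e + i) (2 * e + j) ≡ shiftedType (c + e) i j
shiftedType-+ c zero    i j = cong (λ z → shiftedType z i j) (sym (ℕ.+-identityʳ c))
shiftedType-+ c (suc e) i j = trans (cong (λ z → shiftedType c (suc (e + i)) (z + j)) (ℕ.*-suc 2 e))
  (trans (step c (e + i) (2 * e + j)) (trans (cong transpose3 (shiftedType-+ c e i j))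
    (cong (λ z → shiftedType z i j) (sym (ℕ.+-suc c e)))))
  where
  step : ∀ c i j → shiftedType c (suc i) (2 + j) ≡ transpose3 (shiftedType c i j)
  step zero    i j = fewRowsType-suc i j
  step (suc c) i j = cong transpose3 (step c i j)

is : Std3 → Std3 → ℤ
is T U = [ std3Eqᵇ U T ]ᵇ

-- The first must sum to 0, because `Tb` and `Tc` label the same plethysm; the second is the
-- counterpart of s_(3) - s_(2,1) + s_(1,1,1) = p₃. Their span is stable under transposition, which
-- allows both sums to be computed by the transposing recursion.
bc adb : Std3 → ℤ
bc  U = is Tb U -ℤ is Tc U
adb U = (is Ta U +ℤ is Td U) -ℤ is Tb U

bc-transpose3 : ∀ U → bc (transpose3 U) ≡ -ℤ (bc U)
bc-transpose3 Ta = refl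
bc-transpose3 Tb = refl
bc-transpose3 Tc = refl
bc-transpose3 Td = refl

adb-transpose3 : ∀ U → adb (transpose3 U) ≡ adb U +ℤ bc U
adb-transpose3 Ta = refl
adb-transpose3 Tb = refl
adb-transpose3 Tc = refl
adb-transpose3 Td = refl

is-total : ∀ U → (is Ta U +ℤ is Tb U) +ℤ (is Tc U +ℤ is Td U) ≡ 1ℤ
is-total Ta = refl
is-total Tb = refl
is-total Tc = refl
is-total Td = refl

sign : Std3 → ℤ
sign U = (is Ta U +ℤ is Tb U) -ℤ (is Tc U +ℤ is Td U)

sign-transpose3 : ∀ U → sign (transpose3 U) ≡ -ℤ (sign U)
sign-transpose3 Ta = refl
sign-transpose3 Tb = refl
sign-transpose3 Tc = refl
sign-transpose3 Td = refl

sgn-parity : ∀ i → sgn i ≡ (if i % 2 ≡ᵇ 0 then 1ℤ else -1ℤ)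
sgn-parity zero          = refl
sgn-parity (suc zero)    = refl
sgn-parity (suc (suc i)) = trans (ℤ.neg-involutive (sgn i)) (sgn-parity i)

sign-fewRowsType : ∀ i j → sign (fewRowsType i j) ≡ sgn i
sign-fewRowsType i j = trans (sign-choose ((2 * i ≤ᵇ j) ∧ not (j ≡ᵇ 2 * i + 1)) (i % 2 ≡ᵇ 0)) (sym (sgn-parity i))
  where
  sign-choose : ∀ big even → sign (chooseType big even) ≡ (if even then 1ℤ else -1ℤ)
  sign-choose true  true  = refl
  sign-choose true  false = refl
  sign-choose false true  = refl
  sign-choose false false = refl

-- Every removed column takes one 2 out of row 2 and transposes the type, and both change the sign.
-- Here c + i is the number of 2's in row 2 of the original tableau.
sign-shiftedType : ∀ c i j → sign (shiftedType c i j) ≡ sgn (c + i)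
sign-shiftedType zero    i j = sign-fewRowsType i j
sign-shiftedType (suc c) i j = trans (sign-transpose3 (shiftedType c i j)) (cong -ℤ_ (sign-shiftedType c i j))

fewRowsType-small : ∀ i j → j < 2 * i → fewRowsType i j ≡ (if i % 2 ≡ᵇ 0 then Tb else Tc)
fewRowsType-small i j lt = cong (λ b → chooseType (b ∧ not (j ≡ᵇ 2 * i + 1)) (i % 2 ≡ᵇ 0)) (≰⇒≤ᵇ-false (ℕ.<⇒≱ lt))

-- On the diagonal i + j = f + 3 the point i = 0 has type `Ta`, as j ≥ 3 avoids the exception. The
-- two points with j ≤ 1 have j < 2i and consecutive i, giving `Tb` and `Tc` in some order. The
-- remaining points are the diagonal f shifted by (1 , 2).
∑-diagonal : ∀ (g : Std3 → ℤ) f →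
  ∑< (4 + f) (λ i → g (fewRowsType i (3 + f ∸ i))) ≡
  g Ta +ℤ (∑< (suc f) (λ i → g (transpose3 (fewRowsType i (f ∸ i)))) +ℤ (g Tb +ℤ g Tc))
∑-diagonal g f = begin
  _ ≡⟨ ∑<-suc (3 + f) _ ⟩
  g (fewRowsType 0 (3 + f)) +ℤ ∑< (3 + f) (λ i → g (fewRowsType (suc i) (2 + f ∸ i)))
    ≡⟨ cong (g Ta +ℤ_) (trans (∑<-snoc (2 + f) _) (cong (_+ℤ last₂) (∑<-snoc (suc f) _))) ⟩
  g Ta +ℤ ((∑< (suc f) (λ i → g (fewRowsType (suc i) (2 + f ∸ i))) +ℤ last₁) +ℤ last₂)
    ≡⟨ cong (g Ta +ℤ_) (trans (ℤ.+-assoc (∑< (suc f) (λ i → g (fewRowsType (suc i) (2 + f ∸ i)))) last₁ last₂) (cong₂ _+ℤ_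
         (∑<-cong (suc f) (λ { i (s≤s i≤f) → cong g (trans (cong (fewRowsType (suc i)) (ℕ.+-∸-assoc 2 i≤f)) (fewRowsType-suc i (f ∸ i))) }))
         lasts)) ⟩
  _ ∎
  where
  last₁ last₂ : ℤ
  last₁ = g (fewRowsType (2 + f) (2 + f ∸ suc f))
  last₂ = g (fewRowsType (3 + f) (2 + f ∸ (2 + f)))
  last₁≡ : last₁ ≡ g (if f % 2 ≡ᵇ 0 then Tb else Tc)
  last₁≡ = cong g (trans (cong (fewRowsType (2 + f)) (ℕ.m+n∸n≡m 1 f))
    (fewRowsType-small (2 + f) 1 (s≤s (s≤s z≤n))))
  last₂≡ : last₂ ≡ g (if not (f % 2 ≡ᵇ 0) then Tb else Tc)
  last₂≡ = cong g (trans (cong (fewRowsType (3 + f)) (ℕ.n∸n≡0 f))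
    (trans (fewRowsType-small (3 + f) 0 (s≤s z≤n)) (cong (if_then Tb else Tc) (parity-suc f))))
  lasts : last₁ +ℤ last₂ ≡ g Tb +ℤ g Tc
  lasts = trans (cong₂ _+ℤ_ last₁≡ last₂≡) (both (f % 2 ≡ᵇ 0))
    where
    both : ∀ b → g (if b then Tb else Tc) +ℤ g (if not b then Tb else Tc) ≡ g Tb +ℤ g Tc
    both true  = refl
    both false = ℤ.+-comm (g Tc) (g Tb)

BcSum AdbSum : ℕ → Set
BcSum f  = ∑< (suc f) (λ i → bc (fewRowsType i (f ∸ i))) ≡ 0ℤ
AdbSum f = ∑< (suc f) (λ i → adb (fewRowsType i (f ∸ i))) ≡ ψ f

opaque
  unfolding ∑

  -- For f = 1 the pairs are (0 , 1) and (1 , 0). The exceptional condition gives (0 , 1) the type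
  -- `Tb` instead of `Ta`, and this cancels the `Tc` of (1 , 0).
  ∑-bc-base : BcSum 0 × BcSum 1 × BcSum 2
  ∑-bc-base = refl , refl , refl

  ∑-adb-base : AdbSum 0 × AdbSum 1 × AdbSum 2
  ∑-adb-base = refl , refl , refl

∑-bc : ∀ f → BcSum f
∑-bc 0 = proj₁ ∑-bc-base
∑-bc 1 = proj₁ (proj₂ ∑-bc-base)
∑-bc 2 = proj₂ (proj₂ ∑-bc-base)
∑-bc (suc (suc (suc f))) = begin
  ∑< (4 + f) (λ i → bc (fewRowsType i (3 + f ∸ i))) ≡⟨ ∑-diagonal bc f ⟩
  0ℤ +ℤ (∑< (suc f) (λ i → bc (transpose3 (fewRowsType i (f ∸ i)))) +ℤ 0ℤ)
    ≡⟨ trans (ℤ.+-identityˡ _) (ℤ.+-identityʳ _) ⟩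
  ∑< (suc f) (λ i → bc (transpose3 (fewRowsType i (f ∸ i))))
    ≡⟨ ∑-cong (upTo (suc f)) (λ i → trans (bc-transpose3 (fewRowsType i (f ∸ i))) (sym (ℤ.-1*i≡-i (bc (fewRowsType i (f ∸ i)))))) ⟩
  ∑< (suc f) (λ i → -1ℤ · bc (fewRowsType i (f ∸ i))) ≡⟨ ∑-*ˡ (upTo (suc f)) -1ℤ (λ i → bc (fewRowsType i (f ∸ i))) ⟨
  -1ℤ · ∑< (suc f) (λ i → bc (fewRowsType i (f ∸ i))) ≡⟨ cong (-1ℤ ·_) (∑-bc f) ⟩
  0ℤ ∎

∑-adb : ∀ f → AdbSum f
∑-adb 0 = proj₁ ∑-adb-base
∑-adb 1 = proj₁ (proj₂ ∑-adb-base)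
∑-adb 2 = proj₂ (proj₂ ∑-adb-base)
∑-adb (suc (suc (suc f))) = begin
  ∑< (4 + f) (λ i → adb (fewRowsType i (3 + f ∸ i))) ≡⟨ ∑-diagonal adb f ⟩
  1ℤ +ℤ (∑< (suc f) (λ i → adb (transpose3 (fewRowsType i (f ∸ i)))) +ℤ -1ℤ) ≡⟨ simplify (∑< (suc f) (λ i → adb (transpose3 (fewRowsType i (f ∸ i))))) ⟩
  ∑< (suc f) (λ i → adb (transpose3 (fewRowsType i (f ∸ i))))
    ≡⟨ ∑-cong (upTo (suc f)) (λ i → adb-transpose3 (fewRowsType i (f ∸ i))) ⟩
  ∑< (suc f) (λ i → adb (fewRowsType i (f ∸ i)) +ℤ bc (fewRowsType i (f ∸ i)))
    ≡⟨ ∑-+ (upTo (suc f)) (λ i → adb (fewRowsType i (f ∸ i))) (λ i → bc (fewRowsType i (f ∸ i))) ⟩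
  ∑< (suc f) (λ i → adb (fewRowsType i (f ∸ i))) +ℤ ∑< (suc f) (λ i → bc (fewRowsType i (f ∸ i)))
    ≡⟨ cong₂ _+ℤ_ (∑-adb f) (∑-bc f) ⟩
  ψ f +ℤ 0ℤ ≡⟨ ℤ.+-identityʳ (ψ f) ⟩
  ψ f ∎
  where
  simplify : ∀ s → 1ℤ +ℤ (s +ℤ -1ℤ) ≡ s
  simplify = ℤSolver.solve-∀

∑-bc-shifted : ∀ c f → ∑< (suc f) (λ i → bc (shiftedType c i (f ∸ i))) ≡ 0ℤ
∑-bc-shifted zero    f = ∑-bc f
∑-bc-shifted (suc c) f = begin
  ∑< (suc f) (λ i → bc (transpose3 (shiftedType c i (f ∸ i))))
    ≡⟨ ∑-cong (upTo (suc f)) (λ i → trans (bc-transpose3 (shiftedType c i (f ∸ i))) (sym (ℤ.-1*i≡-i (bc (shiftedType c i (f ∸ i)))))) ⟩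
  ∑< (suc f) (λ i → -1ℤ · bc (shiftedType c i (f ∸ i))) ≡⟨ ∑-*ˡ (upTo (suc f)) -1ℤ (λ i → bc (shiftedType c i (f ∸ i))) ⟨
  -1ℤ · ∑< (suc f) (λ i → bc (shiftedType c i (f ∸ i))) ≡⟨ cong (-1ℤ ·_) (∑-bc-shifted c f) ⟩
  0ℤ ∎

-- Transposition changes `adb` by `bc`, whose sum over the diagonal vanishes, so the value does not
-- depend on c.
∑-adb-shifted : ∀ c f → ∑< (suc f) (λ i → adb (shiftedType c i (f ∸ i))) ≡ ψ f
∑-adb-shifted zero    f = ∑-adb f
∑-adb-shifted (suc c) f = begin
  ∑< (suc f) (λ i → adb (transpose3 (shiftedType c i (f ∸ i))))
    ≡⟨ ∑-cong (upTo (suc f)) (λ i → adb-transpose3 (shiftedType c i (f ∸ i))) ⟩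
  ∑< (suc f) (λ i → adb (shiftedType c i (f ∸ i)) +ℤ bc (shiftedType c i (f ∸ i)))
    ≡⟨ ∑-+ (upTo (suc f)) (λ i → adb (shiftedType c i (f ∸ i))) (λ i → bc (shiftedType c i (f ∸ i))) ⟩
  ∑< (suc f) (λ i → adb (shiftedType c i (f ∸ i))) +ℤ ∑< (suc f) (λ i → bc (shiftedType c i (f ∸ i)))
    ≡⟨ cong₂ _+ℤ_ (∑-adb-shifted c f) (∑-bc-shifted c f) ⟩
  ψ f +ℤ 0ℤ ≡⟨ ℤ.+-identityʳ (ψ f) ⟩
  ψ f ∎

-- The numbers x of 2's in row 2 of the tableaux in SSYT_(k,k,k) of shape (a , b , c);
-- e is the excess of b over k (0 if b ≤ k).
record Range (a b c k : ℕ) : Set where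
  field
    e f     : ℕ
    b≡      : b ≡ c + (3 * e + f)
    bounded : c + e + f ≤ k
    to      : ∀ x → x ≤ k → (a , b , c) ≽ twoRow k x → c + e ≤ x × x ≤ c + e + f
    from    : ∀ x → c + e ≤ x × x ≤ c + e + f → (a , b , c) ≽ twoRow k x

-- Interlacing with (2k - x , x , 0) says that x is at least c and b + c - k, and at most b and 2k -
-- b. For b ≤ k the bounds c and b are the active ones; for b = k + e they are c + e and k - e. In
-- both cases b - c and f agree modulo 3.
range : ∀ a b c k → c ≤ b → b ≤ a → a + b + c ≡ 3 * k → Range a b c k
range a b c k c≤b b≤a sum = main (b ≤? k)
  where
  x≤2k : ∀ x → x ≤ k → x ≤ 2 * k
  x≤2k x x≤k = ℕ.≤-trans x≤k (ℕ.m≤m+n k (k + 0))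
  sum' : a + (b + c) ≡ 2 * k + k
  sum' = trans (sym (ℕ.+-assoc a b c)) (trans sum (ℕ.+-comm k (2 * k)))
  swap-a : ∀ x → b + c ≤ k + x → 2 * k ≤ a + x
  swap-a x = ≤-balance (trans (sh₁ k x) (trans (cong (_+ x) (sym sum')) (sh₂ a (b + c) x)))
    where
    sh₁ : ∀ k x → 2 * k + (k + x) ≡ 2 * k + k + x
    sh₁ = ℕSolver.solve-∀
    sh₂ : ∀ a y x → a + y + x ≡ y + (a + x)
    sh₂ = ℕSolver.solve-∀
  swap-a' : ∀ x → 2 * k ≤ a + x → b + c ≤ k + x
  swap-a' x = ≤-balance (trans (sh₂ a (b + c) x) (trans (cong (_+ x) sum') (sh₁ k x)))
    where
    sh₁ : ∀ k x → 2 * k + k + x ≡ 2 * k + (k + x)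
    sh₁ = ℕSolver.solve-∀
    sh₂ : ∀ a y x → y + (a + x) ≡ a + y + x
    sh₂ = ℕSolver.solve-∀
  rows≽ : ∀ x → x ≤ k → b + c ≤ k + x → b + x ≤ 2 * k → x ≤ b → c ≤ x → (a , b , c) ≽ twoRow k x
  rows≽ x x≤k h₁ h₂ x≤b c≤x =
    (ℕ.m≤n+o⇒m∸n≤o (2 * k) x (subst (2 * k ≤_) (ℕ.+-comm a x) (swap-a x h₁)) , ℕ.m+n≤o⇒m≤o∸n b h₂) , (x≤b , c≤x) , z≤n
  ≽rows : ∀ x → x ≤ k → (a , b , c) ≽ twoRow k x → b + c ≤ k + x × b + x ≤ 2 * k × x ≤ b × c ≤ x
  ≽rows x x≤k ((h₁ , h₂) , (x≤b , c≤x) , _) =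
    swap-a' x (subst (_≤ a + x) (ℕ.m∸n+n≡m (x≤2k x x≤k)) (ℕ.+-monoˡ-≤ x h₁))
    , subst (b + x ≤_) (ℕ.m∸n+n≡m (x≤2k x x≤k)) (ℕ.+-monoˡ-≤ x h₂) , x≤b , c≤x
  main : Dec (b ≤ k) → Range a b c k
  main (yes b≤k) with ℕ.m≤n⇒∃[o]m+o≡n c≤b
  ... | f , refl = record
    { e = 0 ; f = f ; b≡ = refl ; bounded = subst (λ z → z + f ≤ k) (sym (ℕ.+-identityʳ c)) b≤k
    ; to = λ x x≤k D → let (_ , _ , x≤b , c≤x) = ≽rows x x≤k D in
        subst (_≤ x) (sym (ℕ.+-identityʳ c)) c≤x , subst (λ z → x ≤ z + f) (sym (ℕ.+-identityʳ c)) x≤b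
    ; from = λ x (l , h) → let c≤x = subst (_≤ x) (ℕ.+-identityʳ c) l
                               x≤b = subst (λ z → x ≤ z + f) (ℕ.+-identityʳ c) h
                               x≤k = ℕ.≤-trans x≤b b≤k in
        rows≽ x x≤k (ℕ.+-mono-≤ b≤k c≤x)
          (subst (c + f + x ≤_) (cong (λ z → k + z) (sym (ℕ.+-identityʳ k))) (ℕ.+-mono-≤ b≤k x≤k)) x≤b c≤x }
  main (no b≰k) with ℕ.m≤n⇒∃[o]m+o≡n (ℕ.<⇒≤ (ℕ.≰⇒> b≰k))
  -- The interval from c + e to k - e has length f = k - c - 2e, which is nonnegative because 2b + c
  -- ≤ a + b + c = 3k.
  ... | e , refl with ℕ.m≤n⇒∃[o]m+o≡n c+2e≤k
    where
    c+2e≤k : c + 2 * e ≤ k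
    c+2e≤k = ℕ.+-cancelˡ-≤ (2 * k) (c + 2 * e) k (subst₂ _≤_ (sym (sh k c e)) (trans sum (ℕ.+-comm k (2 * k)))
      (ℕ.+-monoˡ-≤ c (ℕ.+-monoˡ-≤ (k + e) b≤a)))
      where
      sh : ∀ k c e → 2 * k + (c + 2 * e) ≡ (k + e) + (k + e) + c
      sh = ℕSolver.solve-∀
  ... | f , refl = record
    { e = e ; f = f ; b≡ = sh₁ c e f ; bounded = subst (c + e + f ≤_) (sh₂ c e f) (ℕ.m≤m+n (c + e + f) e)
    ; to = λ x x≤k D → let (h₁ , h₂ , _ , _) = ≽rows x x≤k D in
        ℕ.+-cancelˡ-≤ K (c + e) x (subst (_≤ K + x) (sh₃ K e c) h₁)
        , ℕ.+-cancelˡ-≤ (K + e) x (c + e + f) (subst (K + e + x ≤_) (sh₄ c e f) h₂)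
    ; from = λ x (l , h) → let x≤k = ℕ.≤-trans h (subst (c + e + f ≤_) (sh₂ c e f) (ℕ.m≤m+n (c + e + f) e)) in
        rows≽ x x≤k (subst (_≤ K + x) (sym (sh₃ K e c)) (ℕ.+-monoʳ-≤ K l))
          (subst (K + e + x ≤_) (sym (sh₄ c e f)) (ℕ.+-monoʳ-≤ (K + e) h))
          (ℕ.≤-trans x≤k (ℕ.m≤m+n K e)) (ℕ.≤-trans (ℕ.m≤m+n c e) l) }
    where
    K : ℕ
    K = c + 2 * e + f
    sh₁ : ∀ c e f → c + 2 * e + f + e ≡ c + (3 * e + f)
    sh₁ = ℕSolver.solve-∀
    sh₂ : ∀ c e f → c + e + f + e ≡ c + 2 * e + f
    sh₂ = ℕSolver.solve-∀
    sh₃ : ∀ K e c → K + e + c ≡ K + (c + e)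
    sh₃ = ℕSolver.solve-∀
    sh₄ : ∀ c e f → 2 * (c + 2 * e + f) ≡ c + 2 * e + f + e + (c + e + f)
    sh₄ = ℕSolver.solve-∀

-- With x = c + e + i the counts in row 2 after removing the c columns are e + i and 2e + (f - i),
-- so `shiftedType-+` absorbs the excess e and a full diagonal i + j = f is left.
∑-types : ∀ (g : Std3 → ℤ) {a b c k} (r : Range a b c k) → let open Range r in
  multiplicity k (λ x → g (shiftedType c (x ∸ c) (b ∸ x))) (a , b , c) ≡
  ∑< (suc f) (λ i → g (shiftedType (c + e) i (f ∸ i)))
∑-types g {a} {b} {c} {k} r = begin
  _ ≡⟨ ∑<-cong (suc k) (λ { x (s≤s x≤k) → cong (_· g (shiftedType c (x ∸ c) (b ∸ x)))
         (⟦⟧-⇔ ((a , b , c) ≽? twoRow k x) (x ∈[ c + e , c + e + f ]?) (to x x≤k) (from x)) }) ⟩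
  ∑< (suc k) (λ x → ⟦ x ∈[ c + e , c + e + f ]? ⟧ · g (shiftedType c (x ∸ c) (b ∸ x)))
    ≡⟨ ∑<-interval (suc k) (c + e) f _ (s≤s bounded) ⟩
  ∑< (suc f) (λ i → g (shiftedType c (c + e + i ∸ c) (b ∸ (c + e + i))))
    ≡⟨ ∑<-cong (suc f) (λ { i (s≤s i≤f) → cong g (trans
         (cong₂ (shiftedType c) (trans (cong (_∸ c) (ℕ.+-assoc c e i)) (ℕ.m+n∸m≡n c (e + i))) (rest i i≤f))
         (shiftedType-+ c e i (f ∸ i))) }) ⟩
  _ ∎
  where
  open Range r
  rest : ∀ i → i ≤ f → b ∸ (c + e + i) ≡ 2 * e + (f ∸ i)
  rest i i≤f with ℕ.m≤n⇒∃[o]m+o≡n i≤f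
  ... | o , i+o≡f = begin
    b ∸ (c + e + i) ≡⟨ cong (_∸ (c + e + i)) (trans b≡ (trans (cong (λ z → c + (3 * e + z)) (sym i+o≡f)) (sh c e i o))) ⟩
    c + e + i + (2 * e + o) ∸ (c + e + i) ≡⟨ ℕ.m+n∸m≡n (c + e + i) (2 * e + o) ⟩
    2 * e + o ≡⟨ cong (λ z → 2 * e + z) (trans (cong (_∸ i) (sym i+o≡f)) (ℕ.m+n∸m≡n i o)) ⟨
    2 * e + (f ∸ i) ∎
    where
    sh : ∀ c e i o → c + (3 * e + (i + o)) ≡ c + e + i + (2 * e + o)
    sh = ℕSolver.solve-∀

-- Tableaux of content (k , k , k)

tableau : ∀ {N} → List (Fin N) → List (Fin N) → List (Fin N) → Tableau N
tableau u v w = dropEmpty (u ∷ v ∷ w ∷ [])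

∑-fillings-cong : ∀ N sh {f g : Tableau N → ℤ} → (∀ t → shapeOf t ≡ sh → f t ≡ g t) →
  ∑ (fillings N sh) f ≡ ∑ (fillings N sh) g
∑-fillings-cong N []       {f} {g} h = trans (∑-fillings-[] N f) (trans (h [] refl) (sym (∑-fillings-[] N g)))
∑-fillings-cong N (r ∷ sh) {f} {g} h = trans (∑-fillings-∷ N r sh f) (trans
  (∑-words-cong N r (λ w e → ∑-fillings-cong N sh (λ t e' → h (w ∷ t) (cong₂ _∷_ e e'))))
  (sym (∑-fillings-∷ N r sh g)))

∑-fillings-dropZeros : ∀ N sh (f : Tableau N → ℤ) →
  ∑ (fillings N (dropZeros sh)) f ≡ ∑ (fillings N sh) (f ∘ dropEmpty)
∑-fillings-dropZeros N []           f = trans (∑-fillings-[] N f) (sym (∑-fillings-[] N (f ∘ dropEmpty)))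
∑-fillings-dropZeros N (zero ∷ sh)  f = trans (∑-fillings-dropZeros N sh f)
  (sym (trans (∑-fillings-∷ N 0 sh (f ∘ dropEmpty)) (∑-words-zero N _)))
∑-fillings-dropZeros N (suc r ∷ sh) f = begin
  ∑ (fillings N (suc r ∷ dropZeros sh)) f ≡⟨ ∑-fillings-∷ N (suc r) (dropZeros sh) f ⟩
  ∑ (words N (suc r)) (λ w → ∑ (fillings N (dropZeros sh)) (λ t → f (w ∷ t)))
    ≡⟨ ∑-cong (words N (suc r)) (λ w → ∑-fillings-dropZeros N sh (λ t → f (w ∷ t))) ⟩
  ∑ (words N (suc r)) (λ w → ∑ (fillings N sh) (λ t → f (w ∷ dropEmpty t)))
    ≡⟨ ∑-words-cong N (suc r) (λ { (x ∷ w) _ → refl }) ⟩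
  ∑ (words N (suc r)) (λ w → ∑ (fillings N sh) (λ t → f (dropEmpty (w ∷ t)))) ≡⟨ ∑-fillings-∷ N (suc r) sh (f ∘ dropEmpty) ⟨
  _ ∎

-- The length hypotheses exclude an empty row above a nonempty one, so `dropEmpty` only deletes rows
-- at the bottom and never creates new neighbours.
isSSYT-tableau : ∀ {N} (u v w : List (Fin N)) → length v ≤ length u → length w ≤ length v →
  isSSYT (tableau u v w) ≡ rowWeak u ∧ (rowWeak v ∧ (rowWeak w ∧ (colStrict u v ∧ colStrict v w)))
isSSYT-tableau []      []      []      _ _ = refl
isSSYT-tableau (x ∷ u) []      []      _ _ = sym (Bool.∧-identityʳ (rowWeak (x ∷ u)))
isSSYT-tableau (x ∷ u) (y ∷ v) []      _ _ = cong (rowWeak (x ∷ u) ∧_)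
  (trans (Bool.∧-comm (colStrict (x ∷ u) (y ∷ v)) (rowWeak (y ∷ v)))
    (cong (rowWeak (y ∷ v) ∧_) (sym (Bool.∧-identityʳ (colStrict (x ∷ u) (y ∷ v))))))
isSSYT-tableau (x ∷ u) (y ∷ v) (z ∷ w) _ _ =
  shuffle (rowWeak (x ∷ u)) (rowWeak (y ∷ v)) (rowWeak (z ∷ w)) (colStrict (x ∷ u) (y ∷ v)) (colStrict (y ∷ v) (z ∷ w))
  where
  shuffle : ∀ a b c d e → a ∧ (d ∧ (b ∧ (e ∧ c))) ≡ a ∧ (b ∧ (c ∧ (d ∧ e)))
  shuffle false b     c     d     e     = refl
  shuffle true  false c     false e     = refl
  shuffle true  false c     true  e     = refl
  shuffle true  true  false false e     = refl
  shuffle true  true  true  false e     = refl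
  shuffle true  true  false true  false = refl
  shuffle true  true  false true  true  = refl
  shuffle true  true  true  true  false = refl
  shuffle true  true  true  true  true  = refl

∑-fillings-ssytSum : ∀ N a b c → b ≤ a → c ≤ b → (X : Tableau N → ℤ) →
  ∑ (fillings N (dropZeros (a ∷ b ∷ c ∷ []))) (λ t → [ isSSYT t ]ᵇ · X t) ≡
  ssytSum N (a , b , c) (λ u v w → X (tableau u v w))
∑-fillings-ssytSum N a b c b≤a c≤b X = begin
  _ ≡⟨ ∑-fillings-dropZeros N (a ∷ b ∷ c ∷ []) _ ⟩
  ∑ (fillings N (a ∷ b ∷ c ∷ [])) (λ t → [ isSSYT (dropEmpty t) ]ᵇ · X (dropEmpty t)) ≡⟨ ∑-fillings-∷ N a (b ∷ c ∷ []) _ ⟩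
  _ ≡⟨ ∑-cong (words N a) (λ u → trans (∑-fillings-∷ N b (c ∷ []) _) (∑-cong (words N b) (λ v →
         trans (∑-fillings-∷ N c [] _) (∑-cong (words N c) (λ w → ∑-fillings-[] N _))))) ⟩
  ∑ (words N a) (λ u → ∑ (words N b) (λ v → ∑ (words N c) (λ w → [ isSSYT (tableau u v w) ]ᵇ · X (tableau u v w))))
    ≡⟨ ∑-words-cong N a (λ u lu → trans (∑-words-cong N b (λ v lv → trans (∑-words-cong N c (λ w lw → entry u v w lu lv lw))
         (trans (sym (∑-*ˡ (words N c) [ rowWeak u ]ᵇ _)) (cong ([ rowWeak u ]ᵇ ·_) (sym (∑-*ˡ (words N c) [ rowWeak v ]ᵇ _))))))
         (sym (∑-*ˡ (words N b) [ rowWeak u ]ᵇ _))) ⟩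
  ∑ (words N a) (λ u → [ rowWeak u ]ᵇ · ∑ (words N b) (λ v → [ rowWeak v ]ᵇ · ∑ (words N c) (λ w → [ rowWeak w ]ᵇ ·
    ([ colStrict u v ]ᵇ · ([ colStrict v w ]ᵇ · X (tableau u v w))))))
    ≡⟨ trans (∑-cong (words N a) (λ u → cong ([ rowWeak u ]ᵇ ·_) (trans (∑-cong (words N b) (λ v → cong ([ rowWeak v ]ᵇ ·_)
         (sym (∑-filterᵇ rowWeak (words N c) _)))) (sym (∑-filterᵇ rowWeak (words N b) _))))) (sym (∑-filterᵇ rowWeak (words N a) _)) ⟩
  _ ∎
  where
  assoc : ∀ p q r s t x → (p · (q · (r · (s · t)))) · x ≡ p · (q · (r · (s · (t · x))))
  assoc = ℤSolver.solve-∀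
  split : ∀ p q r s t → [ p ∧ (q ∧ (r ∧ (s ∧ t))) ]ᵇ ≡ [ p ]ᵇ · ([ q ]ᵇ · ([ r ]ᵇ · ([ s ]ᵇ · [ t ]ᵇ)))
  split p q r s t = trans ([]ᵇ-∧ p _) (cong ([ p ]ᵇ ·_) (trans ([]ᵇ-∧ q _) (cong ([ q ]ᵇ ·_)
    (trans ([]ᵇ-∧ r _) (cong ([ r ]ᵇ ·_) ([]ᵇ-∧ s t))))))
  entry : ∀ u v w → length u ≡ a → length v ≡ b → length w ≡ c → [ isSSYT (tableau u v w) ]ᵇ · X (tableau u v w) ≡
    [ rowWeak u ]ᵇ · ([ rowWeak v ]ᵇ · ([ rowWeak w ]ᵇ · ([ colStrict u v ]ᵇ · ([ colStrict v w ]ᵇ · X (tableau u v w)))))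
  entry u v w refl refl refl = trans
    (cong (_· X (tableau u v w)) (trans (cong [_]ᵇ (isSSYT-tableau u v w b≤a c≤b))
      (split (rowWeak u) (rowWeak v) (rowWeak w) (colStrict u v) (colStrict v w))))
    (assoc [ rowWeak u ]ᵇ [ rowWeak v ]ᵇ [ rowWeak w ]ᵇ [ colStrict u v ]ᵇ [ colStrict v w ]ᵇ (X (tableau u v w)))

weight-dropEmpty : ∀ {N n} (w : Fin N → Vec ℕ n) t → weight w (dropEmpty t) ≡ weight w t
weight-dropEmpty w []            = refl
weight-dropEmpty w ([] ∷ t)      = weight-dropEmpty w t
weight-dropEmpty w ((x ∷ r) ∷ t) = cong (λ acc → foldr (λ i a → w i ⊕ a) acc (x ∷ r)) (weight-dropEmpty w t)

opaque
  unfolding schur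

  schurCoeff≡schur : ∀ a b c → b ≤ a → c ≤ b → ∀ n (α : Vec ℕ n) →
    + schurCoeff (dropZeros (a ∷ b ∷ c ∷ [])) n α ≡ schur n (a , b , c) (λ β → [ vecEqᵇ β α ]ᵇ)
  schurCoeff≡schur a b c b≤a c≤b n α = trans (length-filterᵇ-∑ _ (fillings n (dropZeros (a ∷ b ∷ c ∷ []))))
    (trans (∑-cong (fillings n (dropZeros (a ∷ b ∷ c ∷ []))) (λ t → []ᵇ-∧ (isSSYT t) (vecEqᵇ (weight unitVec t) α)))
      (trans (∑-fillings-ssytSum n a b c b≤a c≤b (λ t → [ vecEqᵇ (weight unitVec t) α ]ᵇ))
        (ssytSum-cong n (a , b , c) (λ u v w → cong (λ β → [ vecEqᵇ β α ]ᵇ) (weight-dropEmpty unitVec (u ∷ v ∷ w ∷ []))))))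

module Content (k : ℕ) where

  B : ℕ
  B = suc (3 * k)

  one-letter : ∀ a b c → a < B → b < B → c < B → (Y : Filling 1) →
    ssytSum 1 (a , b , c) Y ≡ ⟦ (b ≟ 0) ×-dec (c ≟ 0) ⟧ · Y (extend [] a) [] []
  one-letter a b c a< b< c< Y = begin
    _ ≡⟨ ssytSum-suc 0 B a b c a< b< c< Y ⟩
    ∑ (box B) (λ t → ⟦ (a , b , c) ≽? t ⟧ · ssytSum 0 t (Y' t))
      ≡⟨ ∑-cong (box B) (λ { t → trans (cong (⟦ (a , b , c) ≽? t ⟧ ·_) (ssytSum-zero t (Y' t)))
           (⟦⟧-nest ((a , b , c) ≽? t) (∣ t ∣ ≟ 0) (Y' t [] [] [])) }) ⟩
    ∑ (box B) (λ t → ⟦ P? t ⟧ · Y' t [] [] [])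
      ≡⟨ ∑-box-collapse B P? ((b ≟ 0) ×-dec (c ≟ 0)) 0 0 0 (λ t → Y' t [] [] [])
           (λ (a' , b' , c') (D , e) → ∣∣≡0⇒≡ a' b' c' e , zero-rows (subst ((a , b , c) ≽_) (∣∣≡0⇒≡ a' b' c' e) D))
           (λ { (refl , refl) → ((z≤n , z≤n) , (z≤n , z≤n) , z≤n) , refl }) (λ _ → s≤s z≤n , s≤s z≤n , s≤s z≤n) ⟩
    ⟦ (b ≟ 0) ×-dec (c ≟ 0) ⟧ · Y (extend [] a) (extend [] b) (extend [] c)
      ≡⟨ ⟦⟧-*-congʳ ((b ≟ 0) ×-dec (c ≟ 0)) (λ { (refl , refl) → refl }) ⟩
    _ ∎
    where
    Y' : Shape → Filling 0
    Y' (a' , b' , c') u v w = Y (extend u (a ∸ a')) (extend v (b ∸ b')) (extend w (c ∸ c'))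
    P? : ∀ t → Dec ((a , b , c) ≽ t × ∣ t ∣ ≡ 0)
    P? t = ((a , b , c) ≽? t) ×-dec (∣ t ∣ ≟ 0)
    zero-rows : (a , b , c) ≽ (0 , 0 , 0) → b ≡ 0 × c ≡ 0
    zero-rows ((_ , p) , (_ , q) , _) = ℕ.n≤0⇒n≡0 p , ℕ.n≤0⇒n≡0 q

  2k<B : 2 * k < B
  2k<B = s≤s (ℕ.*-monoˡ-≤ k {2} {3} (s≤s (s≤s z≤n)))

  ≽-≤ : ∀ {s t} → s ≽ t → ∣ t ∣ ≤ ∣ s ∣
  ≽-≤ ((p , _) , (q , _) , r) = ℕ.+-mono-≤ (ℕ.+-mono-≤ p q) r

  -- Stripping off the 3's and then the 2's leaves a single row of 1's. The content fixes all three
  -- sizes, so the shape of the 1's and 2's is a strip over (k) of size 2k, and each such shape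
  -- admits exactly one filling.
  three-letters : ∀ a b c → a < B → b < B → c < B → (Z : Filling 3) →
    ssytSum 3 (a , b , c) (λ u v w → [ vecEqᵇ (weight₃ u v w) (k ∷ k ∷ k ∷ []) ]ᵇ · Z u v w) ≡
    ⟦ a + b + c ≟ 3 * k ⟧ · ∑< (suc k) (λ x → ⟦ (a , b , c) ≽? twoRow k x ⟧ ·
      Z (extend (extend (extend [] k) (2 * k ∸ x ∸ k)) (a ∸ (2 * k ∸ x))) (extend (extend [] x) (b ∸ x)) (extend [] c))
  three-letters a b c a< b< c< Z = begin
    _ ≡⟨ ssytSum-suc 2 B a b c a< b< c< Y ⟩
    ∑ (box B) (λ κ → ⟦ s ≽? κ ⟧ · ssytSum 2 κ (Y₂ κ))
      ≡⟨ ∑-box-cong B (λ κ₁ κ₂ κ₃ l₁ l₂ l₃ → cong (⟦ s ≽? (κ₁ , κ₂ , κ₃) ⟧ ·_) (trans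
           (ssytSum-suc 1 B κ₁ κ₂ κ₃ l₁ l₂ l₃ (Y₂ (κ₁ , κ₂ , κ₃)))
           (∑-box-cong B (λ μ₁ μ₂ μ₃ m₁ m₂ m₃ → cong (⟦ (κ₁ , κ₂ , κ₃) ≽? (μ₁ , μ₂ , μ₃) ⟧ ·_)
             (one-letter μ₁ μ₂ μ₃ m₁ m₂ m₃ (Y₁ (κ₁ , κ₂ , κ₃) (μ₁ , μ₂ , μ₃))))))) ⟩
    ∑ (box B) (λ κ → ⟦ s ≽? κ ⟧ · ∑ (box B) (λ μ → ⟦ κ ≽? μ ⟧ · (⟦ flat? μ ⟧ · Y₁ κ μ (extend [] (proj₁ μ)) [] [])))
      ≡⟨ ∑-cong (box B) (λ κ → ⟦⟧-*-congʳ (s ≽? κ) (letter-1 κ)) ⟩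
    ∑ (box B) (λ κ → ⟦ s ≽? κ ⟧ · (⟦ (∣ κ ∣ ≟ 2 * k) ×-dec ((κ ≽? (k , 0 , 0)) ×-dec (a + b + c ≟ 3 * k)) ⟧ · Z' κ))
      ≡⟨ ∑-cong (box B) (λ κ → trans (cong (λ z → ⟦ s ≽? κ ⟧ · (z · Z' κ))
           (trans (⟦⟧-× (∣ κ ∣ ≟ 2 * k) ((κ ≽? (k , 0 , 0)) ×-dec (a + b + c ≟ 3 * k)))
             (cong (⟦ ∣ κ ∣ ≟ 2 * k ⟧ ·_) (⟦⟧-× (κ ≽? (k , 0 , 0)) (a + b + c ≟ 3 * k)))))
           (shuffle ⟦ s ≽? κ ⟧ ⟦ ∣ κ ∣ ≟ 2 * k ⟧ ⟦ κ ≽? (k , 0 , 0) ⟧ ⟦ a + b + c ≟ 3 * k ⟧ (Z' κ))) ⟩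
    ∑ (box B) (λ κ → ⟦ ∣ κ ∣ ≟ 2 * k ⟧ · (⟦ κ ≽? (k , 0 , 0) ⟧ · (⟦ a + b + c ≟ 3 * k ⟧ · (⟦ s ≽? κ ⟧ · Z' κ))))
      ≡⟨ ∑-row-k B k 2k<B (λ κ → ⟦ a + b + c ≟ 3 * k ⟧ · (⟦ s ≽? κ ⟧ · Z' κ)) ⟩
    ∑< (suc k) (λ x → ⟦ a + b + c ≟ 3 * k ⟧ · (⟦ s ≽? twoRow k x ⟧ · Z' (twoRow k x)))
      ≡⟨ ∑-*ˡ (upTo (suc k)) ⟦ a + b + c ≟ 3 * k ⟧ _ ⟨
    _ ∎
    where
    s : Shape
    s = a , b , c
    flat? : ∀ ((μ₁ , μ₂ , μ₃) : Shape) → Dec (μ₂ ≡ 0 × μ₃ ≡ 0)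
    flat? (μ₁ , μ₂ , μ₃) = (μ₂ ≟ 0) ×-dec (μ₃ ≟ 0)
    Y : Filling 3
    Y u v w = [ vecEqᵇ (weight₃ u v w) (k ∷ k ∷ k ∷ []) ]ᵇ · Z u v w
    Y₂ : Shape → Filling 2
    Y₂ (κ₁ , κ₂ , κ₃) u v w = Y (extend u (a ∸ κ₁)) (extend v (b ∸ κ₂)) (extend w (c ∸ κ₃))
    Y₁ : Shape → Shape → Filling 1
    Y₁ κ@(κ₁ , κ₂ , κ₃) (μ₁ , μ₂ , μ₃) u v w = Y₂ κ (extend u (κ₁ ∸ μ₁)) (extend v (κ₂ ∸ μ₂)) (extend w (κ₃ ∸ μ₃))
    Z' : Shape → ℤ
    Z' (κ₁ , κ₂ , κ₃) = Z (extend (extend (extend [] k) (κ₁ ∸ k)) (a ∸ κ₁)) (extend (extend [] κ₂) (b ∸ κ₂)) (extend (extend [] κ₃) (c ∸ κ₃))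
    shuffle : ∀ p q r t z → p · ((q · (r · t)) · z) ≡ q · (r · (t · (p · z)))
    shuffle = ℤSolver.solve-∀
    Z″ : Shape → Shape → ℤ
    Z″ (κ₁ , κ₂ , κ₃) (μ₁ , μ₂ , μ₃) = Z (extend (extend (extend [] μ₁) (κ₁ ∸ μ₁)) (a ∸ κ₁))
      (extend (extend [] (κ₂ ∸ μ₂)) (b ∸ κ₂)) (extend (extend [] (κ₃ ∸ μ₃)) (c ∸ κ₃))
    new : Shape → Shape → ℕ
    new (s₁ , s₂ , s₃) (t₁ , t₂ , t₃) = (s₁ ∸ t₁) + ((s₂ ∸ t₂) + ((s₃ ∸ t₃) + 0))
    -- The final `T true` mirrors the value of `vecEqᵇ` on empty vectors, so that this bracket is
    -- definitionally the comparison of contents.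
    content? : ∀ κ μ → Dec (proj₁ μ + 0 ≡ k × new κ μ ≡ k × new s κ ≡ k × T true)
    content? κ μ = (proj₁ μ + 0 ≟ k) ×-dec ((new κ μ ≟ k) ×-dec ((new s κ ≟ k) ×-dec T? true))
    Y₁≡ : ∀ κ μ → Y₁ κ μ (extend [] (proj₁ μ)) [] [] ≡ ⟦ content? κ μ ⟧ · Z″ κ μ
    Y₁≡ κ@(κ₁ , κ₂ , κ₃) μ@(μ₁ , μ₂ , μ₃) = cong (λ v → [ vecEqᵇ v (k ∷ k ∷ k ∷ []) ]ᵇ · Z″ κ μ)
      (trans (weight₃-extend (extend (extend [] μ₁) (κ₁ ∸ μ₁)) (extend [] (κ₂ ∸ μ₂)) (extend [] (κ₃ ∸ μ₃)) (a ∸ κ₁) (b ∸ κ₂) (c ∸ κ₃)) (cong (_∷ʳ new s κ)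
        (trans (weight₃-extend (extend [] μ₁) [] [] (κ₁ ∸ μ₁) (κ₂ ∸ μ₂) (κ₃ ∸ μ₃)) (cong (_∷ʳ new κ μ)
          (weight₃-extend [] [] [] μ₁ 0 0)))))
    new⇒size : ∀ {s t m} → s ≽ t → ∣ t ∣ ≡ m → new s t ≡ k → ∣ s ∣ ≡ m + k
    new⇒size {s} {t} D refl e = trans (sym (ℕ.m+[n∸m]≡n (≽-≤ D))) (cong (λ z → ∣ t ∣ + z) (trans (sym (≽-∣∣ D)) e))
    size⇒new : ∀ {s t m} → s ≽ t → ∣ t ∣ ≡ m → ∣ s ∣ ≡ m + k → new s t ≡ k
    size⇒new {s} {t} {m} D refl e = trans (≽-∣∣ D) (trans (cong (_∸ m) e) (ℕ.m+n∸m≡n m k))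
    k+k : k + k ≡ 2 * k
    k+k = cong (λ z → k + z) (sym (ℕ.+-identityʳ k))
    2k+k : 2 * k + k ≡ 3 * k
    2k+k = ℕ.+-comm (2 * k) k
    letter-1 : ∀ κ → s ≽ κ → ∑ (box B) (λ μ → ⟦ κ ≽? μ ⟧ · (⟦ flat? μ ⟧ · Y₁ κ μ (extend [] (proj₁ μ)) [] [])) ≡
      ⟦ (∣ κ ∣ ≟ 2 * k) ×-dec ((κ ≽? (k , 0 , 0)) ×-dec (a + b + c ≟ 3 * k)) ⟧ · Z' κ
    letter-1 κ s≽κ = begin
      _ ≡⟨ ∑-cong (box B) (λ μ → trans (cong (⟦ κ ≽? μ ⟧ ·_) (trans (cong (⟦ flat? μ ⟧ ·_) (Y₁≡ κ μ))
             (⟦⟧-nest (flat? μ) (content? κ μ) (Z″ κ μ))))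
             (⟦⟧-nest (κ ≽? μ) (flat? μ ×-dec content? κ μ) (Z″ κ μ))) ⟩
      ∑ (box B) (λ μ → ⟦ P? μ ⟧ · Z″ κ μ)
        ≡⟨ ∑-box-collapse B P? ((∣ κ ∣ ≟ 2 * k) ×-dec ((κ ≽? (k , 0 , 0)) ×-dec (a + b + c ≟ 3 * k))) k 0 0 (Z″ κ)
             (λ { (μ₁ , _ , _) (D , (refl , refl) , e₁ , e₂ , e₃ , _) → let μ≡k = trans (sym (ℕ.+-identityʳ μ₁)) e₁
                                                                            |κ| = trans (new⇒size D (trans (+0+0 μ₁) μ≡k) e₂) k+k in
                cong (_, 0 , 0) μ≡k , |κ| , subst (λ z → κ ≽ (z , 0 , 0)) μ≡k D , trans (new⇒size s≽κ |κ| e₃) 2k+k })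
             (λ (e₁ , D , e₂) → D , (refl , refl) , ℕ.+-identityʳ k , size⇒new D (+0+0 k) (trans e₁ (sym k+k))
                , size⇒new s≽κ e₁ (trans e₂ (sym 2k+k)) , _)
             (λ _ → ℕ.≤-<-trans (ℕ.m≤m+n k (k + 0)) 2k<B , s≤s z≤n , s≤s z≤n) ⟩
      _ ∎
      where
      P? : ∀ μ → Dec (κ ≽ μ × (proj₁ (proj₂ μ) ≡ 0 × proj₂ (proj₂ μ) ≡ 0) × proj₁ μ + 0 ≡ k × new κ μ ≡ k × new s κ ≡ k × T true)
      P? μ = (κ ≽? μ) ×-dec (flat? μ ×-dec content? κ μ)

-- Explicit tableaux and their types

0F 1F 2F : Fin 3
0F = fzero
1F = fsuc fzero
2F = fsuc (fsuc fzero)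

firstRow : ℕ → ℕ → ℕ → List (Fin 3)
firstRow k p q = (replicate k 0F ++ replicate p 1F) ++ replicate q 2F

secondRow : ℕ → ℕ → List (Fin 3)
secondRow x j = replicate x 1F ++ replicate j 2F

extend-replicate : ∀ {N} (x : Fin N) m p → extend (replicate m x) p ≡ replicate m (inject₁ x) ++ replicate p (fromℕ N)
extend-replicate {N} x m p = cong (_++ replicate p (fromℕ N)) (List.map-replicate inject₁ m x)

secondRow≡ : ∀ x j → extend (extend [] x) j ≡ secondRow x j
secondRow≡ x j = extend-replicate (fsuc fzero) x j

firstRow≡ : ∀ k p q → extend (extend (extend [] k) p) q ≡ firstRow k p q
firstRow≡ k p q = cong (_++ replicate q 2F) (begin
  map inject₁ (map inject₁ (replicate k fzero) ++ replicate p (fsuc fzero))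
    ≡⟨ List.map-++ inject₁ (map inject₁ (replicate k fzero)) (replicate p (fsuc fzero)) ⟩
  map inject₁ (map inject₁ (replicate k fzero)) ++ map inject₁ (replicate p (fsuc fzero))
    ≡⟨ cong₂ _++_ (trans (cong (map inject₁) (List.map-replicate inject₁ k fzero)) (List.map-replicate inject₁ k fzero))
         (List.map-replicate inject₁ p (fsuc fzero)) ⟩
  replicate k 0F ++ replicate p 1F ∎)

countIn-++ : ∀ r u v → countIn r (u ++ v) ≡ countIn r u + countIn r v
countIn-++ r []      v = refl
countIn-++ r (x ∷ u) v = trans (cong (λ z → (if toℕ x ≡ᵇ r then 1 else 0) + z) (countIn-++ r u v))
  (sym (ℕ.+-assoc (if toℕ x ≡ᵇ r then 1 else 0) (countIn r u) (countIn r v)))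

countIn-replicate : ∀ r m x → countIn r (replicate m x) ≡ m * (if toℕ x ≡ᵇ r then 1 else 0)
countIn-replicate r zero    x = refl
countIn-replicate r (suc m) x = cong (λ z → (if toℕ x ≡ᵇ r then 1 else 0) + z) (countIn-replicate r m x)

typeFewRows-tableau : ∀ y u i j → typeFewRows (tableau (y ∷ u) (secondRow i j) []) ≡ fewRowsType i j
typeFewRows-tableau y u i j = trans (by-row₂ (secondRow i j)) (cong₂ fewRowsType
  (trans (countIn-++ 1 (replicate i 1F) (replicate j 2F)) (trans (cong₂ _+_ (countIn-replicate 1 i 1F) (countIn-replicate 1 j 2F))
    (trans (cong₂ _+_ (ℕ.*-identityʳ i) (ℕ.*-zeroʳ j)) (ℕ.+-identityʳ i))))
  (trans (countIn-++ 2 (replicate i 1F) (replicate j 2F)) (trans (cong₂ _+_ (countIn-replicate 2 i 1F) (countIn-replicate 2 j 2F))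
    (cong₂ _+_ (ℕ.*-zeroʳ i) (ℕ.*-identityʳ j)))))
  where
  by-row₂ : ∀ v → typeFewRows (tableau (y ∷ u) v []) ≡ fewRowsType (countIn 1 v) (countIn 2 v)
  by-row₂ []      = refl
  by-row₂ (_ ∷ _) = refl

two-rows : ∀ {A : Set} (y : Fin 3) u v (s t : A) → (if 3 ≤ᵇ length (tableau (y ∷ u) v []) then s else t) ≡ t
two-rows y u []      s t = refl
two-rows y u (_ ∷ _) s t = refl

too-many : ∀ p m → p + suc (suc m) ≡ 1 → ⊥
too-many zero          m ()
too-many (suc zero)    m ()
too-many (suc (suc p)) m ()

-- Removing a column of length 3 takes one letter from the first block of each row, so the recursion
-- lowers k and c and keeps i, j, p, q. When only one letter of each kind is left, the hypotheses
-- leave the four standard tableaux, on which `asStd` agrees with the general rule; the last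
-- hypothesis excludes a second row 2, 3 under a single cell.
typeOf-tableau : ∀ k c i j p q → p + (c + i) ≡ suc k → q + (j + c) ≡ suc k → (c + i) + (c + i + j) ≤ 2 * suc k →
  typeOf (suc k) (tableau (firstRow (suc k) p q) (secondRow (c + i) j) (replicate c 2F)) ≡ shiftedType c i j
typeOf-tableau zero zero zero zero p q _ _ _ = refl
typeOf-tableau zero zero zero (suc zero) p q _ _ _ = refl
typeOf-tableau zero zero (suc zero) zero p q _ _ _ = refl
typeOf-tableau zero zero (suc zero) (suc j) p q _ _ (s≤s (s≤s ()))
typeOf-tableau zero zero i (suc (suc j)) p q _ e _ = ⊥-elim (too-many q (j + 0) e)
typeOf-tableau zero zero (suc (suc i)) j p q e _ _ = ⊥-elim (too-many p i e)
typeOf-tableau zero (suc zero) zero zero p q _ _ _ = refl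
typeOf-tableau zero (suc zero) zero (suc j) p q _ e _ = ⊥-elim (too-many q j (subst (λ z → q + suc z ≡ 1) (ℕ.+-comm j 1) e))
typeOf-tableau zero (suc zero) (suc i) j p q e _ _ = ⊥-elim (too-many p i e)
typeOf-tableau zero (suc (suc c)) i j p q e _ _ = ⊥-elim (too-many p (c + i) e)
typeOf-tableau (suc k) zero i j p q _ _ _ = trans
  (two-rows 0F ((replicate (suc k) 0F ++ replicate p 1F) ++ replicate q 2F) (secondRow i j) _ _)
  (typeFewRows-tableau 0F ((replicate (suc k) 0F ++ replicate p 1F) ++ replicate q 2F) i j)
typeOf-tableau (suc k) (suc c) i j p q e₁ e₂ le = cong transpose3 (typeOf-tableau k c i j p q
  (ℕ.suc-injective (trans (sym (ℕ.+-suc p (c + i))) e₁))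
  (ℕ.suc-injective (trans (sym (trans (cong (λ z → q + z) (ℕ.+-suc j c)) (ℕ.+-suc q (j + c)))) e₂))
  (ℕ.≤-pred (ℕ.≤-pred (subst₂ _≤_ (cong suc (ℕ.+-suc (c + i) (c + i + j))) (ℕ.*-suc 2 (suc k)) le))))

+-sum : ∀ {A : Set} (f : A → ℕ) xs → + sum (map f xs) ≡ ∑ xs (λ x → + f x)
+-sum f []       = sym (∑-[] _)
+-sum f (x ∷ xs) = trans (cong (+ f x +ℤ_) (+-sum f xs)) (sym (∑-∷ x xs _))

∑-partitions3 : ∀ m (f : List ℕ → ℤ) → ∑ (partitions3 m) f ≡
  ∑ (box (suc m)) (λ (a , b , c) → ⟦ (b ≤? a) ×-dec ((c ≤? b) ×-dec (a + b + c ≟ m)) ⟧ · f (dropZeros (a ∷ b ∷ c ∷ [])))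
∑-partitions3 m f = trans (∑-concatMap _ (upTo (suc m)) f) (trans (∑-cong (upTo (suc m)) (λ a →
  trans (∑-concatMap _ (upTo (suc m)) f) (∑-cong (upTo (suc m)) (λ b →
    trans (∑-concatMap _ (upTo (suc m)) f) (∑-cong (upTo (suc m)) (λ c →
      ∑-if ((b ≤ᵇ a) ∧ (c ≤ᵇ b) ∧ (a + b + c ≡ᵇ m)) (dropZeros (a ∷ b ∷ c ∷ []))))))))
  (sym (∑-box (suc m) _)))
  where
  ∑-if : ∀ b x → ∑ (if b then x ∷ [] else []) f ≡ [ b ]ᵇ · f x
  ∑-if true  x = trans (∑-singleton x f) (sym (ℤ.*-identityˡ (f x)))
  ∑-if false x = ∑-[] f

-- Comparison of the plethysms with the type sums

module Main (k' n : ℕ) (α : Vec ℕ n) where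

  k B : ℕ
  k = suc k'
  B = suc (3 * k)

  G : Vec ℕ n → ℤ
  G β = [ vecEqᵇ β α ]ᵇ

  combine : (Shape → ℤ) → ℤ
  combine f = ∑ (box B) (λ s → ⟦ ∣ s ∣ ≟ 3 * k ⟧ · (f s · schur n s G))

  combine-cong : ∀ {f g : Shape → ℤ} → (∀ s → ∣ s ∣ ≡ 3 * k → f s ≡ g s) → combine f ≡ combine g
  combine-cong h = ∑-cong (box B) (λ s → ⟦⟧-*-congʳ (∣ s ∣ ≟ 3 * k) (λ e → cong (_· schur n s G) (h s e)))

  combine-+ : ∀ f g → combine (λ s → f s +ℤ g s) ≡ combine f +ℤ combine g
  combine-+ f g = trans (∑-cong (box B) (λ s → distrib ⟦ ∣ s ∣ ≟ 3 * k ⟧ (f s) (g s) (schur n s G))) (∑-+ (box B) _ _)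
    where
    distrib : ∀ p x y z → p · ((x +ℤ y) · z) ≡ p · (x · z) +ℤ p · (y · z)
    distrib = ℤSolver.solve-∀

  typeWithShape : Shape → ℕ → Std3
  typeWithShape (a , b , c) x = shiftedType c (x ∸ c) (b ∸ x)

  typeSum : (Std3 → ℤ) → Shape → ℤ
  typeSum W s = multiplicity k (λ x → W (typeWithShape s x)) s

  -- For W = `is T` this is the right side of the theorem, by `rhs`. Arbitrary integer weights on
  -- types let the linear relations be checked type by type.
  byType : (Std3 → ℤ) → ℤ
  byType W = combine (typeSum W)

  typeSum-cong : ∀ {W W' : Std3 → ℤ} → (∀ U → W U ≡ W' U) → ∀ s → typeSum W s ≡ typeSum W' s
  typeSum-cong h s = ∑-cong (upTo (suc k)) (λ x → cong (⟦ s ≽? twoRow k x ⟧ ·_) (h (typeWithShape s x)))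

  byType-+ : ∀ W W' → byType (λ U → W U +ℤ W' U) ≡ byType W +ℤ byType W'
  byType-+ W W' = trans (combine-cong (λ s _ → trans (∑-cong (upTo (suc k)) (λ x →
      ℤ.*-distribˡ-+ ⟦ s ≽? twoRow k x ⟧ (W (typeWithShape s x)) (W' (typeWithShape s x))))
    (∑-+ (upTo (suc k)) _ _))) (combine-+ (typeSum W) (typeSum W'))

  multiplicity-nonpartition : ∀ w a b c → ¬ (c ≤ b × b ≤ a) → multiplicity k w (a , b , c) ≡ 0ℤ
  multiplicity-nonpartition w a b c ¬p = ∑-0 (upTo (suc k)) (λ x → ⟦⟧-no-* ((a , b , c) ≽? twoRow k x)
    (λ ((p₁ , p₂) , (p₃ , p₄) , _) → ¬p (ℕ.≤-trans p₄ p₃ , ℕ.≤-trans p₂ p₁)) (w x))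

  typeSum-bc : ∀ s → ∣ s ∣ ≡ 3 * k → typeSum bc s ≡ 0ℤ
  typeSum-bc (a , b , c) e = cases ((c ≤? b) ×-dec (b ≤? a))
    where
    cases : Dec (c ≤ b × b ≤ a) → typeSum bc (a , b , c) ≡ 0ℤ
    cases (no ¬p)         = multiplicity-nonpartition _ a b c ¬p
    cases (yes (p , q)) = trans (∑-types bc r) (∑-bc-shifted (c + Range.e r) (Range.f r))
      where r = range a b c k p q e

  typeSum-adb : ∀ s → ∣ s ∣ ≡ 3 * k → typeSum adb s ≡ coeff₃ s
  typeSum-adb (a , b , c) e = cases ((c ≤? b) ×-dec (b ≤? a))
    where
    cases : Dec (c ≤ b × b ≤ a) → typeSum adb (a , b , c) ≡ ⟦ (c ≤? b) ×-dec (b ≤? a) ⟧ · ψ (b ∸ c)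
    cases (no ¬p)         = trans (multiplicity-nonpartition _ a b c ¬p) (sym (⟦⟧-no-* ((c ≤? b) ×-dec (b ≤? a)) ¬p (ψ (b ∸ c))))
    cases (yes (p , q)) = begin
      typeSum adb (a , b , c) ≡⟨ ∑-types adb r ⟩
      _ ≡⟨ ∑-adb-shifted (c + Range.e r) f ⟩
      ψ f ≡⟨ ψ-3*+ (Range.e r) f ⟨
      ψ (3 * Range.e r + f) ≡⟨ cong ψ (trans (cong (_∸ c) (Range.b≡ r)) (ℕ.m+n∸m≡n c (3 * Range.e r + f))) ⟨
      ψ (b ∸ c) ≡⟨ ⟦⟧-yes-* ((c ≤? b) ×-dec (b ≤? a)) (p , q) (ψ (b ∸ c)) ⟨
      _ ∎
      where
      r = range a b c k p q e
      f = Range.f r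

  typeSum-sign : ∀ s → typeSum sign s ≡ multiplicity k sgn s
  typeSum-sign (a , b , c) = ∑-cong (upTo (suc k)) (λ x → ⟦⟧-*-congʳ ((a , b , c) ≽? twoRow k x)
    (λ (_ , (_ , c≤x) , _) → trans (sign-shiftedType c (x ∸ c) (b ∸ x)) (cong sgn (ℕ.m+[n∸m]≡n c≤x))))

  type-explicit : ∀ a b c x → a + b + c ≡ 3 * k → x ≤ k → (a , b , c) ≽ twoRow k x →
    typeOf k (tableau (extend (extend (extend [] k) (2 * k ∸ x ∸ k)) (a ∸ (2 * k ∸ x))) (extend (extend [] x) (b ∸ x)) (extend [] c)) ≡
    typeWithShape (a , b , c) x
  type-explicit a b c x e x≤k D@((h₁ , h₂) , (x≤b , c≤x) , _) = trans
    (cong (typeOf k) (cong₂ (λ u v → tableau u v (replicate c 2F))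
      (firstRow≡ k (2 * k ∸ x ∸ k) (a ∸ (2 * k ∸ x)))
      (trans (secondRow≡ x (b ∸ x)) (cong (λ z → secondRow z (b ∸ x)) (sym c+i)))))
    (typeOf-tableau k' c (x ∸ c) (b ∸ x) (2 * k ∸ x ∸ k) (a ∸ (2 * k ∸ x)) ones threes twos)
    where
    c+i : c + (x ∸ c) ≡ x
    c+i = ℕ.m+[n∸m]≡n c≤x
    x≤2k : x ≤ 2 * k
    x≤2k = ℕ.≤-trans x≤k (ℕ.m≤m+n k (k + 0))
    ones : 2 * k ∸ x ∸ k + (c + (x ∸ c)) ≡ k
    ones = begin
      2 * k ∸ x ∸ k + (c + (x ∸ c)) ≡⟨ cong₂ _+_ (trans (ℕ.∸-+-assoc (2 * k) x k) (trans (cong (2 * k ∸_) (ℕ.+-comm x k)) (sym (ℕ.∸-+-assoc (2 * k) k x)))) c+i ⟩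
      2 * k ∸ k ∸ x + x ≡⟨ cong (λ z → z ∸ x + x) (trans (ℕ.m+n∸m≡n k (k + 0)) (ℕ.+-identityʳ k)) ⟩
      k ∸ x + x ≡⟨ ℕ.m∸n+n≡m x≤k ⟩
      k ∎
    threes : a ∸ (2 * k ∸ x) + (b ∸ x + c) ≡ k
    threes = begin
      a ∸ (2 * k ∸ x) + (b ∸ x + c) ≡⟨ cong (λ z → a ∸ (2 * k ∸ x) + (b ∸ x + z)) (ℕ.+-identityʳ c) ⟨
      a ∸ (2 * k ∸ x) + (b ∸ x + (c + 0)) ≡⟨ ≽-∣∣ D ⟩
      a + b + c ∸ (2 * k ∸ x + x + 0) ≡⟨ cong₂ _∸_ e (trans (ℕ.+-identityʳ (2 * k ∸ x + x)) (ℕ.m∸n+n≡m x≤2k)) ⟩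
      3 * k ∸ 2 * k ≡⟨ ℕ.m+n∸n≡m k (2 * k) ⟩
      k ∎
    twos : (c + (x ∸ c)) + (c + (x ∸ c) + (b ∸ x)) ≤ 2 * k
    twos = subst₂ _≤_ (trans (ℕ.+-comm b x) (cong₂ _+_ (sym c+i) (trans (sym (ℕ.m+[n∸m]≡n x≤b)) (cong (_+ (b ∸ x)) (sym c+i)))))
      (ℕ.m∸n+n≡m x≤2k) (ℕ.+-monoˡ-≤ x h₂)

  -- All tableaux of one shape share the Schur factor `σ`; `three-letters` lists those of content (k
  -- , k , k) by x, and `type-explicit` reads off their types.
  tableaux-of-type : ∀ T a b c → a < B → b < B → c < B → b ≤ a → c ≤ b →
    ∑ (filterᵇ (λ t → isSSYT t ∧ vecEqᵇ (weight unitVec t) (k ∷ k ∷ k ∷ [])) (fillings 3 (dropZeros (a ∷ b ∷ c ∷ []))))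
      (λ S → [ std3Eqᵇ (typeOf k S) T ]ᵇ · + schurCoeff (shapeOf S) n α) ≡
    ⟦ a + b + c ≟ 3 * k ⟧ · (typeSum (is T) (a , b , c) · schur n (a , b , c) G)
  tableaux-of-type T a b c a< b< c< b≤a c≤b = begin
    _ ≡⟨ ∑-filterᵇ _ (fillings 3 sh) _ ⟩
    ∑ (fillings 3 sh) (λ t → [ isSSYT t ∧ W t ]ᵇ · ([ std3Eqᵇ (typeOf k t) T ]ᵇ · + schurCoeff (shapeOf t) n α))
      ≡⟨ ∑-fillings-cong 3 sh (λ t e → trans
           (cong₂ (λ p q → p · ([ std3Eqᵇ (typeOf k t) T ]ᵇ · q)) ([]ᵇ-∧ (isSSYT t) (W t))
             (trans (cong (λ z → + schurCoeff z n α) e) (schurCoeff≡schur a b c b≤a c≤b n α)))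
           (ℤ.*-assoc [ isSSYT t ]ᵇ [ W t ]ᵇ _)) ⟩
    ∑ (fillings 3 sh) (λ t → [ isSSYT t ]ᵇ · ([ W t ]ᵇ · ([ std3Eqᵇ (typeOf k t) T ]ᵇ · σ)))
      ≡⟨ ∑-fillings-ssytSum 3 a b c b≤a c≤b (λ t → [ W t ]ᵇ · ([ std3Eqᵇ (typeOf k t) T ]ᵇ · σ)) ⟩
    ssytSum 3 s (λ u v w → [ W (tableau u v w) ]ᵇ · Z u v w)
      ≡⟨ ssytSum-cong 3 s (λ u v w → cong (λ z → [ vecEqᵇ z (k ∷ k ∷ k ∷ []) ]ᵇ · Z u v w) (weight-dropEmpty unitVec (u ∷ v ∷ w ∷ []))) ⟩
    ssytSum 3 s (λ u v w → [ vecEqᵇ (weight₃ u v w) (k ∷ k ∷ k ∷ []) ]ᵇ · Z u v w)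
      ≡⟨ Content.three-letters k a b c a< b< c< Z ⟩
    _ ≡⟨ ⟦⟧-*-congʳ (a + b + c ≟ 3 * k) (λ e → trans (∑<-cong (suc k) (λ { x (s≤s x≤k) →
           trans (⟦⟧-*-congʳ (s ≽? twoRow k x) (λ D → cong (λ U → is T U · σ) (type-explicit a b c x e x≤k D)))
             (sym (ℤ.*-assoc ⟦ s ≽? twoRow k x ⟧ (is T (typeWithShape s x)) σ)) }))
           (sym (∑-*ʳ (upTo (suc k)) _ σ))) ⟩
    _ ∎
    where
    s : Shape
    s = a , b , c
    sh : List ℕ
    sh = dropZeros (a ∷ b ∷ c ∷ [])
    σ : ℤ
    σ = schur n s G
    W : Tableau 3 → Bool
    W t = vecEqᵇ (weight unitVec t) (k ∷ k ∷ k ∷ [])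
    Z : Filling 3
    Z u v w = is T (typeOf k (tableau u v w)) · σ

  rhs : ∀ T → + sum (map (λ S → schurCoeff (shapeOf S) n α) (filterᵇ (λ S → std3Eqᵇ (typeOf k S) T) (SSYTkkk k))) ≡
    byType (is T)
  rhs T = begin
    _ ≡⟨ +-sum _ (filterᵇ (λ S → std3Eqᵇ (typeOf k S) T) (SSYTkkk k)) ⟩
    _ ≡⟨ ∑-filterᵇ _ (SSYTkkk k) _ ⟩
    ∑ (SSYTkkk k) X ≡⟨ ∑-concatMap _ (partitions3 (3 * k)) X ⟩
    ∑ (partitions3 (3 * k)) (λ sh → ∑ (filterᵇ keep (fillings 3 sh)) X) ≡⟨ ∑-partitions3 (3 * k) _ ⟩
    ∑ (box B) (λ (a , b , c) → ⟦ (b ≤? a) ×-dec ((c ≤? b) ×-dec (a + b + c ≟ 3 * k)) ⟧ ·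
      ∑ (filterᵇ keep (fillings 3 (dropZeros (a ∷ b ∷ c ∷ [])))) X)
      ≡⟨ ∑-box-cong B (λ a b c a< b< c< → trans
           (⟦⟧-*-congʳ ((b ≤? a) ×-dec ((c ≤? b) ×-dec (a + b + c ≟ 3 * k)))
             (λ (b≤a , c≤b , _) → tableaux-of-type T a b c a< b< c< b≤a c≤b))
           (restrict a b c ((c ≤? b) ×-dec (b ≤? a)))) ⟩
    byType (is T) ∎
    where
    X : Tableau 3 → ℤ
    X S = [ std3Eqᵇ (typeOf k S) T ]ᵇ · + schurCoeff (shapeOf S) n α
    keep : Tableau 3 → Bool
    keep t = isSSYT t ∧ vecEqᵇ (weight unitVec t) (k ∷ k ∷ k ∷ [])
    restrict : ∀ a b c → Dec (c ≤ b × b ≤ a) →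
      ⟦ (b ≤? a) ×-dec ((c ≤? b) ×-dec (a + b + c ≟ 3 * k)) ⟧ ·
        (⟦ a + b + c ≟ 3 * k ⟧ · (typeSum (is T) (a , b , c) · schur n (a , b , c) G)) ≡
      ⟦ a + b + c ≟ 3 * k ⟧ · (typeSum (is T) (a , b , c) · schur n (a , b , c) G)
    restrict a b c (yes (p , q)) = ⟦⟧-merge ((b ≤? a) ×-dec ((c ≤? b) ×-dec (a + b + c ≟ 3 * k))) (a + b + c ≟ 3 * k) (a + b + c ≟ 3 * k)
      (λ _ e → e) (λ e → (q , p , e) , e) _
    restrict a b c (no ¬p) = trans
      (⟦⟧-no-* ((b ≤? a) ×-dec ((c ≤? b) ×-dec (a + b + c ≟ 3 * k))) (λ (q , p , _) → ¬p (p , q)) _)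
      (sym (*-0ʳ ⟦ a + b + c ≟ 3 * k ⟧ (cong (_· schur n (a , b , c) G) (multiplicity-nonpartition _ a b c ¬p))))

  open ThreeBoxes (monomials n k) α using (row; hook; column; all; diagonal; total; all≡; diagonal≡; total≡; p₁³; p₂p₁; p₁³-p₃;
    tableau-row; tableau-hook; tableau-column)

  ra rb rc rd : ℤ
  ra = byType (is Ta)
  rb = byType (is Tb)
  rc = byType (is Tc)
  rd = byType (is Td)

  all-types : (row +ℤ hook) +ℤ (hook +ℤ column) ≡ (ra +ℤ rb) +ℤ (rc +ℤ rd)
  all-types = begin
    _ ≡⟨ trans p₁³ (trans all≡ (Expansions.hhh k n G)) ⟩
    combine (multiplicity k (λ _ → 1ℤ)) ≡⟨ combine-cong (λ s _ → typeSum-cong is-total s) ⟨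
    byType (λ U → (is Ta U +ℤ is Tb U) +ℤ (is Tc U +ℤ is Td U)) ≡⟨ byType-+ (λ U → is Ta U +ℤ is Tb U) (λ U → is Tc U +ℤ is Td U) ⟩
    _ ≡⟨ cong₂ _+ℤ_ (byType-+ (is Ta) (is Tb)) (byType-+ (is Tc) (is Td)) ⟩
    _ ∎

  -- The counterpart of p₂ p₁ = s_(3) - s_(1,1,1). The negative terms are moved across so that
  -- additivity of `byType` is enough.
  signed-types : (row +ℤ hook) -ℤ (hook +ℤ column) +ℤ (rc +ℤ rd) ≡ ra +ℤ rb
  signed-types = begin
    _ ≡⟨ cong (_+ℤ (rc +ℤ rd)) (trans p₂p₁ (trans diagonal≡ (Expansions.p₂h k n G))) ⟩
    combine (multiplicity k sgn) +ℤ (rc +ℤ rd)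
      ≡⟨ cong₂ _+ℤ_ (combine-cong (λ s _ → sym (typeSum-sign s))) (sym (byType-+ (is Tc) (is Td))) ⟩
    byType sign +ℤ byType (λ U → is Tc U +ℤ is Td U) ≡⟨ byType-+ sign (λ U → is Tc U +ℤ is Td U) ⟨
    byType (λ U → sign U +ℤ (is Tc U +ℤ is Td U))
      ≡⟨ combine-cong (λ s _ → typeSum-cong (λ U → cancel (is Ta U +ℤ is Tb U) (is Tc U +ℤ is Td U)) s) ⟩
    byType (λ U → is Ta U +ℤ is Tb U) ≡⟨ byType-+ (is Ta) (is Tb) ⟩
    ra +ℤ rb ∎
    where
    cancel : ∀ x y → (x -ℤ y) +ℤ y ≡ x
    cancel = ℤSolver.solve-∀

  rb≡rc : rb ≡ rc
  rb≡rc = begin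
    rb ≡⟨ combine-cong (λ s _ → typeSum-cong (λ U → cancel (is Tb U) (is Tc U)) s) ⟩
    byType (λ U → bc U +ℤ is Tc U) ≡⟨ byType-+ bc (is Tc) ⟩
    byType bc +ℤ rc ≡⟨ cong (_+ℤ rc) (trans (combine-cong (λ s e → typeSum-bc s e)) (∑-0 (box B) (λ s → ℤ.*-zeroʳ ⟦ ∣ s ∣ ≟ 3 * k ⟧))) ⟩
    0ℤ +ℤ rc ≡⟨ ℤ.+-identityˡ rc ⟩
    rc ∎
    where
    cancel : ∀ x y → x ≡ (x -ℤ y) +ℤ y
    cancel = ℤSolver.solve-∀

  total-types : total +ℤ rb ≡ ra +ℤ rd
  total-types = begin
    _ ≡⟨ cong (_+ℤ rb) (trans total≡ (trans (Expansions.p₃ k n G) (combine-cong (λ s e → sym (typeSum-adb s e))))) ⟩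
    byType adb +ℤ rb ≡⟨ byType-+ adb (is Tb) ⟨
    byType (λ U → adb U +ℤ is Tb U) ≡⟨ combine-cong (λ s _ → typeSum-cong (λ U → cancel (is Ta U +ℤ is Td U) (is Tb U)) s) ⟩
    byType (λ U → is Ta U +ℤ is Td U) ≡⟨ byType-+ (is Ta) (is Td) ⟩
    ra +ℤ rd ∎
    where
    cancel : ∀ x y → (x -ℤ y) +ℤ y ≡ x
    cancel = ℤSolver.solve-∀

  -- Three times the hook is p₁³ - p₃. On the side of types this is (ra + rb + rc + rd) - (ra + rd -
  -- rb), which is 3 rb because rb = rc; the factor 3 then cancels in ℤ.
  hook≡rb : hook ≡ rb
  hook≡rb = ℤ.*-cancelˡ-≡ (+ 3) hook rb (begin
    + 3 · hook ≡⟨ expand hook total rb ⟩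
    ((hook +ℤ (hook +ℤ hook)) +ℤ total +ℤ rb) -ℤ (total +ℤ rb) ≡⟨ cong₂ (λ x y → (x +ℤ rb) -ℤ y) (trans p₁³-p₃ (trans (sym p₁³) all-types)) total-types ⟩
    ((ra +ℤ rb) +ℤ (rc +ℤ rd) +ℤ rb) -ℤ (ra +ℤ rd) ≡⟨ cong (λ z → ((ra +ℤ rb) +ℤ (z +ℤ rd) +ℤ rb) -ℤ (ra +ℤ rd)) (sym rb≡rc) ⟩
    ((ra +ℤ rb) +ℤ (rb +ℤ rd) +ℤ rb) -ℤ (ra +ℤ rd) ≡⟨ collect ra rb rd ⟩
    + 3 · rb ∎)
    where
    expand : ∀ h t b → + 3 · h ≡ ((h +ℤ (h +ℤ h)) +ℤ t +ℤ b) -ℤ (t +ℤ b)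
    expand = ℤSolver.solve-∀
    collect : ∀ a b d → ((a +ℤ b) +ℤ (b +ℤ d) +ℤ b) -ℤ (a +ℤ d) ≡ + 3 · b
    collect = ℤSolver.solve-∀

  -- Adding the relations for p₁³ and p₂ p₁ gives twice h₂ p₁ = s_(3) + s_(2,1), and twice the sum
  -- over the types `Ta` and `Tb`.
  row+hook≡ : row +ℤ hook ≡ ra +ℤ rb
  row+hook≡ = ℤ.*-cancelˡ-≡ (+ 2) (row +ℤ hook) (ra +ℤ rb) (begin
    + 2 · (row +ℤ hook) ≡⟨ expand (row +ℤ hook) (hook +ℤ column) (rc +ℤ rd) ⟩
    ((row +ℤ hook) +ℤ (hook +ℤ column)) +ℤ ((row +ℤ hook) -ℤ (hook +ℤ column) +ℤ (rc +ℤ rd)) -ℤ (rc +ℤ rd)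
      ≡⟨ cong₂ (λ x y → x +ℤ y -ℤ (rc +ℤ rd)) all-types signed-types ⟩
    (ra +ℤ rb) +ℤ (rc +ℤ rd) +ℤ (ra +ℤ rb) -ℤ (rc +ℤ rd) ≡⟨ collect (ra +ℤ rb) (rc +ℤ rd) ⟩
    + 2 · (ra +ℤ rb) ∎)
    where
    expand : ∀ x y z → + 2 · x ≡ (x +ℤ y) +ℤ (x -ℤ y +ℤ z) -ℤ z
    expand = ℤSolver.solve-∀
    collect : ∀ x z → x +ℤ z +ℤ x -ℤ z ≡ + 2 · x
    collect = ℤSolver.solve-∀

  row≡ra : row ≡ ra
  row≡ra = ∙-cancelʳ rb row ra (trans (cong (row +ℤ_) (sym hook≡rb)) row+hook≡)

  column≡rd : column ≡ rd
  column≡rd = ∙-cancelˡ rc column rd (∙-cancelˡ (ra +ℤ rb) (rc +ℤ column) (rc +ℤ rd)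
    (trans (cong₂ (λ x y → x +ℤ (y +ℤ column)) (sym row+hook≡) (sym (trans hook≡rb rb≡rc))) all-types))

  plethysm : ∀ T → + plethCoeff (std3Shape T) k n α ≡ byType (is T)
  plethysm Ta = trans tableau-row row≡ra
  plethysm Tb = trans tableau-hook hook≡rb
  plethysm Tc = trans tableau-hook (trans hook≡rb rb≡rc)
  plethysm Td = trans tableau-column column≡rd

theorem5p3 : (k : ℕ) → 1 ≤ k → (T : Std3) → (n : ℕ) → (α : Vec ℕ n) →
    plethCoeff (std3Shape T) k n α
      ≡ sum (map (λ S → schurCoeff (shapeOf S) n α)
                 (filterᵇ (λ S → std3Eqᵇ (typeOf k S) T) (SSYTkkk k)))
theorem5p3 (suc k') _ T n α = ℤ.+-injective (trans (Main.plethysm k' n α T) (sym (Main.rhs k' n α T)))
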